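{- Let $\mathcal{M}$ be a $\mathbb{Z}$-graded unitary magma and $\theta:\mathcal{M}\to\mathbb{Z}$ be a rank function of $\mathcal{M}$. The linear map $\mathrm{F}_\theta$ is an operad morphism from $\mathsf{C}\mathcal{M}$ to $\mathsf{RatFct}$.
   Context: Let $\mathbb{K}$ be a field of characteristic zero and $[n]=\{1,\dots,n\}$. A unitary magma is a set $\mathcal{M}$ with a binary operation $\star$ (not assumed associative) having a two-sided unit $\mathbb{1}_{\mathcal{M}}$. A $\mathbb{Z}$-graded unitary magma is a unitary magma admitting a unitary magma morphism $\theta:\mathcal{M}\to\mathbb{Z}$ (with $\mathbb{Z}$ additive); such a $\theta$ is a rank function. Operads are nonsymmetric operads in $\mathbb{K}$-vector spaces (graded from arity $1$, with partial compositions $\circ_i$ and a unit of arity $1$); operad morphisms are linear maps that respect arities, units and partial compositions. An $\mathcal{M}$-clique of arity $n\ge1$ is a map $\mathfrak{p}$ assigning a label $\mathfrak{p}(x,y)\in\mathcal{M}$ to each arc $(x,y)$, $1\le x<y\le n+1$; by convention the only $\mathcal{M}$-clique of arity $1$ is $\mathbf{u}$, with $\mathbf{u}(1,2)=\mathbb{1}_{\mathcal{M}}$. Write $\mathfrak{p}_0:=\mathfrak{p}(1,n+1)$ and $\mathfrak{p}_i:=\mathfrak{p}(i,i+1)$ for $i\in[n]$. $\mathsf{C}\mathcal{M}$ is the operad (with unit $\mathbf{u}$) such that $\mathsf{C}\mathcal{M}(n)$ has basis the $\mathcal{M}$-cliques of arity $n$, and for $\mathcal{M}$-cliques $\mathfrak{p},\mathfrak{q}$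 of arities $n,m$ and $i\in[n]$, $\mathfrak{p}\circ_i\mathfrak{q}$ is the $\mathcal{M}$-clique of arity $n+m-1$ with, for $1\le x<y\le n+m$, $$(\mathfrak{p}\circ_i\mathfrak{q})(x,y)=\begin{cases}\mathfrak{p}(x,y)&\text{if }y\le i,\\ \mathfrak{p}(x,y-m+1)&\text{if }x\le i<i+m\le y,\ (x,y)\ne(i,i+m),\\ \mathfrak{p}(x-m+1,y-m+1)&\text{if }i+m\le x,\\ \mathfrak{q}(x-i+1,y-i+1)&\text{if }i\le x<y\le i+m,\ (x,y)\ne(i,i+m),\\ \mathfrak{p}_i\star\mathfrak{q}_0&\text{if }(x,y)=(i,i+m),\\ \mathbb{1}_{\mathcal{M}}&\text{otherwise}.\end{cases}$$ $\mathsf{RatFct}$ is the operad with $\mathsf{RatFct}(n)=\mathbb{K}(u_1,\dots,u_n)$ (commutative rational functions), graded so that each element has a fixed arity, with unit the constant function $1\in\mathsf{RatFct}(1)$ and, for $f\in\mathsf{RatFct}(n)$, $g\in\mathsf{RatFct}(m)$, $i\in[n]$, $$f\circ_i g=f(u_1,\dots,u_{i-1},u_i+\dots+u_{i+m-1},u_{i+m},\dots,u_{n+m-1})\;g(u_i,\dots,u_{i+m-1}).$$ The map $\mathrm{F}_\theta:\mathsf{C}\mathcal{M}\to\mathsf{RatFct}$ is the linear map defined on an $\mathcal{M}$-clique $\mathfrak{p}$ of arity $n$ by $$\mathrm{F}_\theta(\mathfrak{p})=\prod_{1\le x<y\le n+1}(u_x+\dots+u_{y-1})^{\theta(\mathfrak{p}(x,y))}\in\mathsf{RatFct}(n).$$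 -}

module Defs where

open import Algebra.Apartness.Bundles using (HeytingField; module HeytingCommutativeRing)
open import Algebra.Bundles
  using (CommutativeRing; CommutativeMonoid; AbelianGroup; UnitalMagma; RawMonoid)
open import Algebra.Module.Bundles using (Module)
open import Algebra.Module.Bundles.Raw using (RawModule)
open import Algebra.Module.Structures.Biased using (IsModuleFromLeft)
open import Algebra.Morphism.Structures using (module RingMorphisms; module MonoidMorphisms)
import Algebra.Module.Morphism.Structures as ModuleMorphisms
import Algebra.Definitions.RawMonoid as RawMonoidDefs
import Algebra.Properties.CommutativeMonoid.Sum as Sums
import Algebra.Properties.CommutativeSemigroup as CommutativeSemigroupProperties
import Algebra.Properties.AbelianGroup as AbelianGroupProperties
import Algebra.Properties.Ring as RingProperties
import Algebra.Properties.Semiring.Exp as Exponentiation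
import Algebra.Solver.Ring.NaturalCoefficients.Default as SemiringSolver
open import Data.Bool.Base using (Bool; true; false; if_then_else_; _∧_)
open import Data.Empty using (⊥; ⊥-elim)
open import Data.Fin.Base as Fin using (Fin; zero; suc; toℕ; fromℕ<)
open import Data.Fin.Properties using (toℕ<n; toℕ-fromℕ<)
open import Data.Integer.Base as ℤ using (ℤ; +_; -[1+_])
open import Data.List.Base using (List; []; _∷_; map)
open import Data.Maybe.Base using (Maybe; just; nothing; _>>=_)
open import Data.Nat.Base as ℕ
  using (ℕ; zero; suc; _≤_; _<_; z≤n; s≤s; s≤s⁻¹; _∸_; _≤ᵇ_; _<ᵇ_)
open import Data.Nat.Properties as ℕₚ using (_≤?_; _<?_; _≟_)
open import Data.Product.Base using (∃; _×_; _,_; proj₁; proj₂)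
open import Data.Sum.Base using (_⊎_; inj₁; inj₂)
open import Function.Base using (_∘_; id)
open import Level using (Level; _⊔_) renaming (suc to lsuc)
open import Relation.Binary.Bundles using (Setoid)
open import Relation.Binary.Core using (Rel)
open import Relation.Binary.PropositionalEquality as ≡ using (_≡_; subst)
open import Relation.Binary.Structures using (IsEquivalence)
import Relation.Binary.Reasoning.Setoid as SetoidReasoning
open import Relation.Nullary using (¬_; Dec; yes; no)
open import Relation.Nullary.Decidable using (dec-true; dec-false; _×-dec_; recompute)
open import Relation.Binary.Definitions using (tri<; tri≈; tri>)

module +ℕ = CommutativeSemigroupProperties ℕₚ.+-commutativeSemigroup

IsRingHom : ∀ {a ℓa b ℓb} (R : CommutativeRing a ℓa) (S : CommutativeRing b ℓb) →
            (CommutativeRing.Carrier R → CommutativeRing.Carrier S) → Set _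
IsRingHom R S = RingMorphisms.IsRingHomomorphism
  (CommutativeRing.rawRing R) (CommutativeRing.rawRing S)

CharacteristicZero : ∀ {c ℓ} → CommutativeRing c ℓ → Set ℓ
CharacteristicZero R = ∀ n → ¬ (suc n ×′ 1#) ≈ 0#
  where
  open CommutativeRing R
  open RawMonoidDefs +-rawMonoid using () renaming (_×_ to _×′_)

-- No decidability of equality is assumed: ¬¬-stability, which a tight
-- apartness provides, is enough for fractions to form a ring.
record IsDomain {c ℓ} (R : CommutativeRing c ℓ) : Set (c ⊔ ℓ) where
  open CommutativeRing R
  field
    stable  : ∀ {x y} → ¬ ¬ (x ≈ y) → x ≈ y
    1≉0     : ¬ 1# ≈ 0#
    *-≉0    : ∀ {x y} → ¬ x ≈ 0# → ¬ y ≈ 0# → ¬ x * y ≈ 0#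

  *-cancelʳ : ∀ {x y z} → ¬ z ≈ 0# → x * z ≈ y * z → x ≈ y
  *-cancelʳ {x} {y} {z} z≉0 eq = stable λ x≉y →
    *-≉0 (x≉y ∘ x-y≈0⇒x≈y) z≉0 (begin
      (x - y) * z        ≈⟨ distribʳ z x (- y) ⟩
      x * z + (- y) * z  ≈⟨ +-cong eq (sym (-‿distribˡ-* y z)) ⟩
      y * z - y * z      ≈⟨ -‿inverseʳ (y * z) ⟩
      0#                 ∎)
    where
    open SetoidReasoning setoid
    open RingProperties ring using (-‿distribˡ-*)
    x-y≈0⇒x≈y : x - y ≈ 0# → x ≈ y
    x-y≈0⇒x≈y e = begin
      x              ≈⟨ +-identityʳ x ⟨
      x + 0#         ≈⟨ +-congˡ (-‿inverseˡ y) ⟨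
      x + (- y + y)  ≈⟨ +-assoc x (- y) y ⟨
      (x - y) + y    ≈⟨ +-congʳ e ⟩
      0# + y         ≈⟨ +-identityˡ y ⟩
      y              ∎

-- A field with decidable equality is a Heyting field whose apartness is
-- the negation of equality.
module HeytingFieldProperties {c ℓ₁ ℓ₂} (K : HeytingField c ℓ₁ ℓ₂) where
  open HeytingField K

  commutativeRing : CommutativeRing c ℓ₁
  commutativeRing = HeytingCommutativeRing.commutativeRing heytingCommutativeRing

  isDomain : IsDomain commutativeRing
  isDomain = record
    { stable = λ ¬¬eq → tight _ _ .proj₁ λ x#y → ¬¬eq λ x≈y → tight _ _ .proj₂ x≈y x#y
    ; 1≉0    = λ 1≈0 → tight _ _ .proj₂ 1≈0 (invertible⇒# (1# , inv , trans (*-comm _ _) inv))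
    ; *-≉0   = λ {x} {y} x≉0 y≉0 xy≈0 → x≉0 (tight _ _ .proj₁ λ x#0 →
                 y≉0 (cancel x y xy≈0 (#⇒invertible x#0)))
    }
    where
    open SetoidReasoning (CommutativeRing.setoid commutativeRing)
    open RingProperties (CommutativeRing.ring commutativeRing) using (-0#≈0#)
    minus0 : ∀ x → x + - 0# ≈ x
    minus0 x = trans (+-cong refl -0#≈0#) (+-identityʳ x)
    inv : 1# * (1# + - 0#) ≈ 1#
    inv = trans (*-identityˡ _) (minus0 1#)
    cancel : ∀ x y → x * y ≈ 0# → _ → y ≈ 0#
    cancel x y xy≈0 (z , zx≈1 , _) = begin
      y                    ≈⟨ *-identityˡ y ⟨
      1# * y               ≈⟨ *-cong zx≈1 refl ⟨
      (z * (x + - 0#)) * y ≈⟨ *-cong (*-cong refl (minus0 x)) refl ⟩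
      (z * x) * y          ≈⟨ *-assoc z x y ⟩
      z * (x * y)          ≈⟨ *-cong refl xy≈0 ⟩
      z * 0#               ≈⟨ zeroʳ z ⟩
      0#                   ∎

module _ {a ℓa b ℓb} (R : CommutativeRing a ℓa) (S : CommutativeRing b ℓb) where
  private
    module R = CommutativeRing R
    module S = CommutativeRing S

  -- Compatibility with 0 and - follows from the listed laws.
  mkRingHom : (f : R.Carrier → S.Carrier) →
              (∀ {x y} → x R.≈ y → f x S.≈ f y) →
              (∀ x y → f (x R.+ y) S.≈ f x S.+ f y) →
              (∀ x y → f (x R.* y) S.≈ f x S.* f y) →
              f R.1# S.≈ S.1# → IsRingHom R S f
  mkRingHom f f-cong f-+ f-* f-1 = record
    { isSemiringHomomorphism = record
      { isNearSemiringHomomorphism = record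
        { +-isMonoidHomomorphism = record
          { isMagmaHomomorphism = record
            { isRelHomomorphism = record { cong = f-cong }
            ; homo = f-+
            }
          ; ε-homo = f-0
          }
        ; *-homo = f-*
        }
      ; 1#-homo = f-1
      }
    ; -‿homo = f-neg
    }
    where
    open SetoidReasoning S.setoid
    open AbelianGroupProperties S.+-abelianGroup using (∙-cancelˡ; inverseˡ-unique)
    f-0 : f R.0# S.≈ S.0#
    f-0 = ∙-cancelˡ (f R.0#) (f R.0#) S.0# (begin
      f R.0# S.+ f R.0# ≈⟨ f-+ R.0# R.0# ⟨
      f (R.0# R.+ R.0#) ≈⟨ f-cong (R.+-identityʳ R.0#) ⟩
      f R.0#            ≈⟨ S.+-identityʳ _ ⟨
      f R.0# S.+ S.0#   ∎)
    f-neg : ∀ x → f (R.- x) S.≈ S.- f x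
    f-neg x = inverseˡ-unique (f (R.- x)) (f x)
      (S.trans (S.sym (f-+ (R.- x) x)) (S.trans (f-cong (R.-‿inverseˡ x)) f-0))

module IsRingHomProperties
  {a ℓa b ℓb} (R : CommutativeRing a ℓa) (S : CommutativeRing b ℓb)
  {f : CommutativeRing.Carrier R → CommutativeRing.Carrier S} (hom : IsRingHom R S f) where
  private
    module R = CommutativeRing R
    module S = CommutativeRing S
  open RingMorphisms.IsRingHomomorphism hom public
    using (+-homo; *-homo; 0#-homo; 1#-homo; -‿homo) renaming (⟦⟧-cong to cong)

  minus-homo : ∀ x y → f (x R.- y) S.≈ f x S.- f y
  minus-homo x y = S.trans (+-homo x (R.- y)) (S.+-congˡ (-‿homo y))

id-isRingHom : ∀ {a ℓa} (R : CommutativeRing a ℓa) → IsRingHom R R id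
id-isRingHom R = mkRingHom R R id id (λ _ _ → refl) (λ _ _ → refl) refl
  where open CommutativeRing R

∘-isRingHom : ∀ {a ℓa b ℓb c ℓc} (R : CommutativeRing a ℓa) (S : CommutativeRing b ℓb)
              (T : CommutativeRing c ℓc) {f g} →
              IsRingHom R S f → IsRingHom S T g → IsRingHom R T (g ∘ f)
∘-isRingHom R S T {f} {g} f-hom g-hom = mkRingHom R T (g ∘ f)
  (G.cong ∘ F.cong)
  (λ x y → trans (G.cong (F.+-homo x y)) (G.+-homo _ _))
  (λ x y → trans (G.cong (F.*-homo x y)) (G.*-homo _ _))
  (trans (G.cong F.1#-homo) G.1#-homo)
  where
  open CommutativeRing T
  module F = IsRingHomProperties R S f-hom
  module G = IsRingHomProperties S T g-hom

-- A polynomial is its list of coefficients, constant term first; trailing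
-- zeros are immaterial because equality compares coefficients.
module UnivariatePolynomial {c ℓ} (R : CommutativeRing c ℓ) where
  open CommutativeRing R renaming (Carrier to A)
  open RingProperties ring using (-0#≈0#)

  Polynomial : Set c
  Polynomial = List A

  coeff : Polynomial → ℕ → A
  coeff []      k       = 0#
  coeff (a ∷ p) zero    = a
  coeff (a ∷ p) (suc k) = coeff p k

  infix 4 _≈ₚ_
  record _≈ₚ_ (p q : Polynomial) : Set ℓ where
    constructor mk
    field at : ∀ k → coeff p k ≈ coeff q k
  open _≈ₚ_ public

  infixl 6 _+ₚ_
  _+ₚ_ : Polynomial → Polynomial → Polynomial
  []      +ₚ q       = q
  (a ∷ p) +ₚ []      = a ∷ p
  (a ∷ p) +ₚ (b ∷ q) = (a + b) ∷ (p +ₚ q)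

  -ₚ_ : Polynomial → Polynomial
  -ₚ p = map -_ p

  scale : A → Polynomial → Polynomial
  scale a p = map (a *_) p

  infixl 7 _*ₚ_
  _*ₚ_ : Polynomial → Polynomial → Polynomial
  []      *ₚ q = []
  (a ∷ p) *ₚ q = scale a q +ₚ (0# ∷ p *ₚ q)

  constant : A → Polynomial
  constant a = a ∷ []

  indeterminate : Polynomial
  indeterminate = 0# ∷ 1# ∷ []

  private
    ≈ₚ-refl : ∀ {p} → p ≈ₚ p
    ≈ₚ-refl .at k = refl

    ≈ₚ-sym : ∀ {p q} → p ≈ₚ q → q ≈ₚ p
    ≈ₚ-sym e .at k = sym (e .at k)

    ≈ₚ-trans : ∀ {p q r} → p ≈ₚ q → q ≈ₚ r → p ≈ₚ r
    ≈ₚ-trans e f .at k = trans (e .at k) (f .at k)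

    ≈ₚ-isEquivalence : IsEquivalence _≈ₚ_
    ≈ₚ-isEquivalence = record { refl = ≈ₚ-refl ; sym = ≈ₚ-sym ; trans = ≈ₚ-trans }

    ≈ₚ-setoid : Setoid c ℓ
    ≈ₚ-setoid = record { isEquivalence = ≈ₚ-isEquivalence }

    coeff-+ : ∀ p q k → coeff (p +ₚ q) k ≈ coeff p k + coeff q k
    coeff-+ []      q       k       = sym (+-identityˡ _)
    coeff-+ (a ∷ p) []      k       = sym (+-identityʳ _)
    coeff-+ (a ∷ p) (b ∷ q) zero    = refl
    coeff-+ (a ∷ p) (b ∷ q) (suc k) = coeff-+ p q k

    coeff-neg : ∀ p k → coeff (-ₚ p) k ≈ - coeff p k
    coeff-neg []      k       = sym -0#≈0#
    coeff-neg (a ∷ p) zero    = refl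
    coeff-neg (a ∷ p) (suc k) = coeff-neg p k

    coeff-scale : ∀ a p k → coeff (scale a p) k ≈ a * coeff p k
    coeff-scale a []      k       = sym (zeroʳ a)
    coeff-scale a (b ∷ p) zero    = refl
    coeff-scale a (b ∷ p) (suc k) = coeff-scale a p k

    +ₚ-cong : ∀ {p p′ q q′} → p ≈ₚ p′ → q ≈ₚ q′ → p +ₚ q ≈ₚ p′ +ₚ q′
    +ₚ-cong {p} {p′} {q} {q′} e f .at k =
      trans (coeff-+ p q k) (trans (+-cong (e .at k) (f .at k)) (sym (coeff-+ p′ q′ k)))

    +ₚ-assoc : ∀ p q r → (p +ₚ q) +ₚ r ≈ₚ p +ₚ (q +ₚ r)
    +ₚ-assoc p q r .at k = begin
      coeff ((p +ₚ q) +ₚ r) k             ≈⟨ coeff-+ (p +ₚ q) r k ⟩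
      coeff (p +ₚ q) k + coeff r k        ≈⟨ +-congʳ (coeff-+ p q k) ⟩
      (coeff p k + coeff q k) + coeff r k ≈⟨ +-assoc _ _ _ ⟩
      coeff p k + (coeff q k + coeff r k) ≈⟨ +-congˡ (coeff-+ q r k) ⟨
      coeff p k + coeff (q +ₚ r) k        ≈⟨ coeff-+ p (q +ₚ r) k ⟨
      coeff (p +ₚ (q +ₚ r)) k             ∎
      where open SetoidReasoning setoid

    +ₚ-comm : ∀ p q → p +ₚ q ≈ₚ q +ₚ p
    +ₚ-comm p q .at k = trans (coeff-+ p q k) (trans (+-comm _ _) (sym (coeff-+ q p k)))

    +ₚ-identityʳ : ∀ p → p +ₚ [] ≈ₚ p
    +ₚ-identityʳ p = +ₚ-comm p []

    -ₚ-cong : ∀ {p q} → p ≈ₚ q → -ₚ p ≈ₚ -ₚ q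
    -ₚ-cong {p} {q} e .at k =
      trans (coeff-neg p k) (trans (-‿cong (e .at k)) (sym (coeff-neg q k)))

    -ₚ-inverseʳ : ∀ p → p +ₚ (-ₚ p) ≈ₚ []
    -ₚ-inverseʳ p .at k =
      trans (coeff-+ p (-ₚ p) k) (trans (+-congˡ (coeff-neg p k)) (-‿inverseʳ _))

    +ₚ-abelianGroup : AbelianGroup c ℓ
    +ₚ-abelianGroup = record
      { _∙_ = _+ₚ_
      ; isAbelianGroup = record
        { isGroup = record
          { isMonoid = record
            { isSemigroup = record
              { isMagma = record { isEquivalence = ≈ₚ-isEquivalence ; ∙-cong = +ₚ-cong }
              ; assoc = +ₚ-assoc
              }
            ; identity = (λ p → ≈ₚ-refl) , +ₚ-identityʳ
            }
          ; inverse = (λ p → ≈ₚ-trans (+ₚ-comm (-ₚ p) p) (-ₚ-inverseʳ p)) , -ₚ-inverseʳ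
          ; ⁻¹-cong = -ₚ-cong
          }
        ; comm = +ₚ-comm
        }
      }
    open CommutativeSemigroupProperties (AbelianGroup.commutativeSemigroup +ₚ-abelianGroup)
      using (interchange; x∙yz≈y∙xz)

    ∷-cong : ∀ {a b p q} → a ≈ b → p ≈ₚ q → a ∷ p ≈ₚ b ∷ q
    ∷-cong e f .at zero    = e
    ∷-cong e f .at (suc k) = f .at k

    tail-cong : ∀ {a b p q} → a ∷ p ≈ₚ b ∷ q → p ≈ₚ q
    tail-cong e .at k = e .at (suc k)

    ∷-zero : ∀ {a p} → a ≈ 0# → p ≈ₚ [] → a ∷ p ≈ₚ []
    ∷-zero e f .at zero    = e
    ∷-zero e f .at (suc k) = f .at k

    tail-zero : ∀ {a p} → a ∷ p ≈ₚ [] → p ≈ₚ []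
    tail-zero e .at k = e .at (suc k)

    shift-+ : ∀ p q → 0# ∷ (p +ₚ q) ≈ₚ (0# ∷ p) +ₚ (0# ∷ q)
    shift-+ p q = ∷-cong (sym (+-identityʳ 0#)) ≈ₚ-refl

    scale-cong : ∀ {a b p q} → a ≈ b → p ≈ₚ q → scale a p ≈ₚ scale b q
    scale-cong {a} {b} {p} {q} e f .at k =
      trans (coeff-scale a p k) (trans (*-cong e (f .at k)) (sym (coeff-scale b q k)))

    scale-distribˡ : ∀ a p q → scale a (p +ₚ q) ≈ₚ scale a p +ₚ scale a q
    scale-distribˡ a p q .at k = begin
      coeff (scale a (p +ₚ q)) k                  ≈⟨ coeff-scale a (p +ₚ q) k ⟩
      a * coeff (p +ₚ q) k                        ≈⟨ *-congˡ (coeff-+ p q k) ⟩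
      a * (coeff p k + coeff q k)                 ≈⟨ distribˡ a _ _ ⟩
      a * coeff p k + a * coeff q k               ≈⟨ +-cong (coeff-scale a p k) (coeff-scale a q k) ⟨
      coeff (scale a p) k + coeff (scale a q) k   ≈⟨ coeff-+ (scale a p) (scale a q) k ⟨
      coeff (scale a p +ₚ scale a q) k            ∎
      where open SetoidReasoning setoid

    scale-* : ∀ a b p → scale (a * b) p ≈ₚ scale a (scale b p)
    scale-* a b p .at k = begin
      coeff (scale (a * b) p) k     ≈⟨ coeff-scale (a * b) p k ⟩
      (a * b) * coeff p k           ≈⟨ *-assoc a b _ ⟩
      a * (b * coeff p k)           ≈⟨ *-congˡ (coeff-scale b p k) ⟨
      a * coeff (scale b p) k       ≈⟨ coeff-scale a (scale b p) k ⟨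
      coeff (scale a (scale b p)) k ∎
      where open SetoidReasoning setoid

    scale-1 : ∀ p → scale 1# p ≈ₚ p
    scale-1 p .at k = trans (coeff-scale 1# p k) (*-identityˡ _)

    scale-0 : ∀ {a} p → a ≈ 0# → scale a p ≈ₚ []
    scale-0 {a} p e .at k = trans (coeff-scale a p k) (trans (*-congʳ e) (zeroˡ _))

    *ₚ-zeroʳ : ∀ p → p *ₚ [] ≈ₚ []
    *ₚ-zeroʳ []      = ≈ₚ-refl
    *ₚ-zeroʳ (a ∷ p) = ∷-zero refl (*ₚ-zeroʳ p)

    *ₚ-congˡ : ∀ p {q q′} → q ≈ₚ q′ → p *ₚ q ≈ₚ p *ₚ q′
    *ₚ-congˡ []      e = ≈ₚ-refl
    *ₚ-congˡ (a ∷ p) e = +ₚ-cong (scale-cong refl e) (∷-cong refl (*ₚ-congˡ p e))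

    *ₚ-∷ : ∀ p b q → p *ₚ (b ∷ q) ≈ₚ scale b p +ₚ (0# ∷ p *ₚ q)
    *ₚ-∷ []      b q = ≈ₚ-sym (∷-zero refl ≈ₚ-refl)
    *ₚ-∷ (a ∷ p) b q = ∷-cong (+-congʳ (*-comm a b)) (begin
      scale a q +ₚ p *ₚ (b ∷ q)                 ≈⟨ +ₚ-cong ≈ₚ-refl (*ₚ-∷ p b q) ⟩
      scale a q +ₚ (scale b p +ₚ (0# ∷ p *ₚ q)) ≈⟨ x∙yz≈y∙xz (scale a q) (scale b p) (0# ∷ p *ₚ q) ⟩
      scale b p +ₚ (scale a q +ₚ (0# ∷ p *ₚ q)) ∎)
      where open SetoidReasoning ≈ₚ-setoid

    *ₚ-comm : ∀ p q → p *ₚ q ≈ₚ q *ₚ p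
    *ₚ-comm []      q = ≈ₚ-sym (*ₚ-zeroʳ q)
    *ₚ-comm (a ∷ p) q = begin
      scale a q +ₚ (0# ∷ p *ₚ q) ≈⟨ +ₚ-cong ≈ₚ-refl (∷-cong refl (*ₚ-comm p q)) ⟩
      scale a q +ₚ (0# ∷ q *ₚ p) ≈⟨ *ₚ-∷ q a p ⟨
      q *ₚ (a ∷ p)               ∎
      where open SetoidReasoning ≈ₚ-setoid

    *ₚ-congʳ : ∀ q {p p′} → p ≈ₚ p′ → p *ₚ q ≈ₚ p′ *ₚ q
    *ₚ-congʳ q {p} {p′} e = ≈ₚ-trans (*ₚ-comm p q) (≈ₚ-trans (*ₚ-congˡ q e) (*ₚ-comm q p′))

    *ₚ-distribˡ : ∀ p q r → p *ₚ (q +ₚ r) ≈ₚ p *ₚ q +ₚ p *ₚ r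
    *ₚ-distribˡ []      q r = ≈ₚ-refl
    *ₚ-distribˡ (a ∷ p) q r = begin
      scale a (q +ₚ r) +ₚ (0# ∷ p *ₚ (q +ₚ r))
        ≈⟨ +ₚ-cong (scale-distribˡ a q r) (∷-cong refl (*ₚ-distribˡ p q r)) ⟩
      (scale a q +ₚ scale a r) +ₚ (0# ∷ (p *ₚ q +ₚ p *ₚ r))
        ≈⟨ +ₚ-cong ≈ₚ-refl (shift-+ (p *ₚ q) (p *ₚ r)) ⟩
      (scale a q +ₚ scale a r) +ₚ ((0# ∷ p *ₚ q) +ₚ (0# ∷ p *ₚ r))
        ≈⟨ interchange (scale a q) (scale a r) (0# ∷ p *ₚ q) (0# ∷ p *ₚ r) ⟩
      (scale a q +ₚ (0# ∷ p *ₚ q)) +ₚ (scale a r +ₚ (0# ∷ p *ₚ r)) ∎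
      where open SetoidReasoning ≈ₚ-setoid

    *ₚ-distribʳ : ∀ r p q → (p +ₚ q) *ₚ r ≈ₚ p *ₚ r +ₚ q *ₚ r
    *ₚ-distribʳ r p q = ≈ₚ-trans (*ₚ-comm (p +ₚ q) r)
      (≈ₚ-trans (*ₚ-distribˡ r p q) (+ₚ-cong (*ₚ-comm r p) (*ₚ-comm r q)))

    scale-shift : ∀ a p → scale a (0# ∷ p) ≈ₚ 0# ∷ scale a p
    scale-shift a p = ∷-cong (zeroʳ a) ≈ₚ-refl

    scale-*ₚ : ∀ a p q → scale a p *ₚ q ≈ₚ scale a (p *ₚ q)
    scale-*ₚ a []      q = ≈ₚ-refl
    scale-*ₚ a (b ∷ p) q = begin
      scale (a * b) q +ₚ (0# ∷ scale a p *ₚ q)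
        ≈⟨ +ₚ-cong (scale-* a b q) (∷-cong refl (scale-*ₚ a p q)) ⟩
      scale a (scale b q) +ₚ (0# ∷ scale a (p *ₚ q))
        ≈⟨ +ₚ-cong ≈ₚ-refl (scale-shift a (p *ₚ q)) ⟨
      scale a (scale b q) +ₚ scale a (0# ∷ p *ₚ q)
        ≈⟨ scale-distribˡ a (scale b q) (0# ∷ p *ₚ q) ⟨
      scale a (scale b q +ₚ (0# ∷ p *ₚ q)) ∎
      where open SetoidReasoning ≈ₚ-setoid

    shift-*ₚ : ∀ p q → (0# ∷ p) *ₚ q ≈ₚ 0# ∷ p *ₚ q
    shift-*ₚ p q = +ₚ-cong (scale-0 q refl) ≈ₚ-refl

    *ₚ-assoc : ∀ p q r → (p *ₚ q) *ₚ r ≈ₚ p *ₚ (q *ₚ r)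
    *ₚ-assoc []      q r = ≈ₚ-refl
    *ₚ-assoc (a ∷ p) q r = begin
      (scale a q +ₚ (0# ∷ p *ₚ q)) *ₚ r        ≈⟨ *ₚ-distribʳ r (scale a q) (0# ∷ p *ₚ q) ⟩
      scale a q *ₚ r +ₚ (0# ∷ p *ₚ q) *ₚ r     ≈⟨ +ₚ-cong (scale-*ₚ a q r) (shift-*ₚ (p *ₚ q) r) ⟩
      scale a (q *ₚ r) +ₚ (0# ∷ (p *ₚ q) *ₚ r) ≈⟨ +ₚ-cong ≈ₚ-refl (∷-cong refl (*ₚ-assoc p q r)) ⟩
      scale a (q *ₚ r) +ₚ (0# ∷ p *ₚ (q *ₚ r)) ∎
      where open SetoidReasoning ≈ₚ-setoid

    constant-*ₚ : ∀ a p → constant a *ₚ p ≈ₚ scale a p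
    constant-*ₚ a p = ≈ₚ-trans (+ₚ-cong ≈ₚ-refl (∷-zero refl ≈ₚ-refl)) (+ₚ-identityʳ _)

    *ₚ-identityˡ : ∀ p → constant 1# *ₚ p ≈ₚ p
    *ₚ-identityˡ p = ≈ₚ-trans (constant-*ₚ 1# p) (scale-1 p)

    ∷-decompose : ∀ a p → a ∷ p ≈ₚ constant a +ₚ indeterminate *ₚ p
    ∷-decompose a p = begin
      a ∷ p                                    ≈⟨ ∷-cong (+-identityʳ a) ≈ₚ-refl ⟨
      constant a +ₚ (0# ∷ p)                   ≈⟨ +ₚ-cong {constant a} ≈ₚ-refl (∷-cong refl (*ₚ-identityˡ p)) ⟨
      constant a +ₚ (0# ∷ constant 1# *ₚ p)    ≈⟨ +ₚ-cong {constant a} ≈ₚ-refl (shift-*ₚ (constant 1#) p) ⟨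
      constant a +ₚ indeterminate *ₚ p         ∎
      where open SetoidReasoning ≈ₚ-setoid

  commutativeRing : CommutativeRing c ℓ
  commutativeRing = record
    { Carrier = Polynomial
    ; _≈_ = _≈ₚ_
    ; _+_ = _+ₚ_
    ; _*_ = _*ₚ_
    ; -_ = -ₚ_
    ; 0# = []
    ; 1# = constant 1#
    ; isCommutativeRing = record
      { isRing = record
        { +-isAbelianGroup = AbelianGroup.isAbelianGroup +ₚ-abelianGroup
        ; *-cong = λ {p} {p′} {q} {q′} e f → ≈ₚ-trans (*ₚ-congˡ p f) (*ₚ-congʳ q′ e)
        ; *-assoc = *ₚ-assoc
        ; *-identity = *ₚ-identityˡ , λ p → ≈ₚ-trans (*ₚ-comm p (constant 1#)) (*ₚ-identityˡ p)
        ; distrib = *ₚ-distribˡ , *ₚ-distribʳ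
        }
      ; *-comm = *ₚ-comm
      }
    }

  constant-isRingHom : IsRingHom R commutativeRing constant
  constant-isRingHom = mkRingHom R commutativeRing constant
    (λ e → ∷-cong e ≈ₚ-refl) (λ _ _ → ≈ₚ-refl)
    (λ a b → ≈ₚ-sym (constant-*ₚ a (constant b))) ≈ₚ-refl

  isDomain : IsDomain R → IsDomain commutativeRing
  isDomain dom = record
    { stable = λ ¬¬e → mk λ k → stable λ ¬e → ¬¬e λ e → ¬e (e .at k)
    ; 1≉0    = λ e → 1≉0 (e .at 0)
    ; *-≉0   = λ {p} {q} p≉0 q≉0 e → noZeroDivisors p q e p≉0 q≉0
    }
    where
    open IsDomain dom
    noZeroDivisors : ∀ p q → p *ₚ q ≈ₚ [] → ¬ p ≈ₚ [] → ¬ q ≈ₚ [] → ⊥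
    noZeroDivisors []      q       e p≉0 q≉0 = p≉0 ≈ₚ-refl
    noZeroDivisors (a ∷ p) []      e p≉0 q≉0 = q≉0 ≈ₚ-refl
    noZeroDivisors (a ∷ p) (b ∷ q) e p≉0 q≉0 = *-≉0
      (λ a≈0 → noZeroDivisors p (b ∷ q)
        (tail-zero (≈ₚ-trans (≈ₚ-sym (+ₚ-cong (scale-0 (b ∷ q) a≈0) ≈ₚ-refl)) e))
        (p≉0 ∘ ∷-zero a≈0) q≉0)
      (λ b≈0 → noZeroDivisors (a ∷ p) q
        (tail-zero (≈ₚ-trans (≈ₚ-sym (+ₚ-cong (scale-0 (a ∷ p) b≈0) ≈ₚ-refl))
          (≈ₚ-trans (≈ₚ-sym (*ₚ-∷ (a ∷ p) b q)) e)))
        p≉0 (q≉0 ∘ ∷-zero b≈0))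
      (trans (sym (+-identityʳ _)) (e .at 0))

  module _ {b ℓb} (S : CommutativeRing b ℓb) where
    private module S = CommutativeRing S

    evaluate : (A → S.Carrier) → S.Carrier → Polynomial → S.Carrier
    evaluate h x []      = S.0#
    evaluate h x (a ∷ p) = h a S.+ x S.* evaluate h x p

    evaluate-isRingHom : ∀ {h} → IsRingHom R S h → ∀ x →
                         IsRingHom commutativeRing S (evaluate h x)
    evaluate-isRingHom {h} hom x = mkRingHom commutativeRing S ev ev-cong ev-+ ev-* ev-1
      where
      open IsRingHomProperties R S hom
      open SetoidReasoning S.setoid
      open CommutativeSemigroupProperties S.+-commutativeSemigroup
        using () renaming (interchange to +-interchange)
      open CommutativeSemigroupProperties S.*-commutativeSemigroup
        using () renaming (x∙yz≈y∙xz to *-swap)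
      ev = evaluate h x

      cons-0 : ∀ {a s} → a ≈ 0# → s S.≈ S.0# → h a S.+ x S.* s S.≈ S.0#
      cons-0 {a} {s} e f = begin
        h a S.+ x S.* s         ≈⟨ S.+-cong (S.trans (cong e) 0#-homo) (S.*-congˡ f) ⟩
        S.0# S.+ x S.* S.0#     ≈⟨ S.+-identityˡ _ ⟩
        x S.* S.0#              ≈⟨ S.zeroʳ x ⟩
        S.0#                    ∎

      ev-0 : ∀ p → p ≈ₚ [] → ev p S.≈ S.0#
      ev-0 []      e = S.refl
      ev-0 (a ∷ p) e = cons-0 (e .at 0) (ev-0 p (tail-zero e))

      ev-cong : ∀ {p q} → p ≈ₚ q → ev p S.≈ ev q
      ev-cong {[]}    {q}     e = S.sym (ev-0 q (≈ₚ-sym e))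
      ev-cong {a ∷ p} {[]}    e = ev-0 (a ∷ p) e
      ev-cong {a ∷ p} {b ∷ q} e =
        S.+-cong (cong (e .at 0)) (S.*-congˡ (ev-cong {p} {q} (tail-cong e)))

      ev-+ : ∀ p q → ev (p +ₚ q) S.≈ ev p S.+ ev q
      ev-+ []      q       = S.sym (S.+-identityˡ _)
      ev-+ (a ∷ p) []      = S.sym (S.+-identityʳ _)
      ev-+ (a ∷ p) (b ∷ q) = begin
        h (a + b) S.+ x S.* ev (p +ₚ q)
          ≈⟨ S.+-cong (+-homo a b) (S.trans (S.*-congˡ (ev-+ p q)) (S.distribˡ x _ _)) ⟩
        (h a S.+ h b) S.+ (x S.* ev p S.+ x S.* ev q)
          ≈⟨ +-interchange _ _ _ _ ⟩
        ev (a ∷ p) S.+ ev (b ∷ q) ∎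

      ev-scale : ∀ a p → ev (scale a p) S.≈ h a S.* ev p
      ev-scale a []      = S.sym (S.zeroʳ _)
      ev-scale a (b ∷ p) = begin
        h (a * b) S.+ x S.* ev (scale a p)
          ≈⟨ S.+-cong (*-homo a b) (S.*-congˡ (ev-scale a p)) ⟩
        h a S.* h b S.+ x S.* (h a S.* ev p)
          ≈⟨ S.+-congˡ (*-swap x (h a) (ev p)) ⟩
        h a S.* h b S.+ h a S.* (x S.* ev p)
          ≈⟨ S.distribˡ (h a) (h b) _ ⟨
        h a S.* ev (b ∷ p) ∎

      ev-* : ∀ p q → ev (p *ₚ q) S.≈ ev p S.* ev q
      ev-* []      q = S.sym (S.zeroˡ _)
      ev-* (a ∷ p) q = begin
        ev (scale a q +ₚ (0# ∷ p *ₚ q))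
          ≈⟨ ev-+ (scale a q) (0# ∷ p *ₚ q) ⟩
        ev (scale a q) S.+ (h 0# S.+ x S.* ev (p *ₚ q))
          ≈⟨ S.+-cong (ev-scale a q) (S.trans (S.+-cong 0#-homo (S.*-congˡ (ev-* p q))) (S.+-identityˡ _)) ⟩
        h a S.* ev q S.+ x S.* (ev p S.* ev q)
          ≈⟨ S.+-congˡ (S.*-assoc x (ev p) (ev q)) ⟨
        h a S.* ev q S.+ (x S.* ev p) S.* ev q
          ≈⟨ S.distribʳ (ev q) (h a) _ ⟨
        ev (a ∷ p) S.* ev q ∎

      ev-1 : ev (constant 1#) S.≈ S.1#
      ev-1 = S.trans (S.+-cong 1#-homo (S.zeroʳ x)) (S.+-identityʳ _)

    evaluate-constant : ∀ h x a → evaluate h x (constant a) S.≈ h a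
    evaluate-constant h x a = S.trans (S.+-congˡ (S.zeroʳ x)) (S.+-identityʳ _)

    evaluate-indeterminate : ∀ {h} → IsRingHom R S h → ∀ x → evaluate h x indeterminate S.≈ x
    evaluate-indeterminate {h} hom x = begin
      h 0# S.+ x S.* evaluate h x (constant 1#)
        ≈⟨ S.+-cong 0#-homo (S.*-congˡ (S.trans (evaluate-constant h x 1#) 1#-homo)) ⟩
      S.0# S.+ x S.* S.1# ≈⟨ S.+-identityˡ _ ⟩
      x S.* S.1#          ≈⟨ S.*-identityʳ x ⟩
      x                   ∎
      where
      open IsRingHomProperties R S hom
      open SetoidReasoning S.setoid

    hom-unique : ∀ {f g} → IsRingHom commutativeRing S f → IsRingHom commutativeRing S g →
                 (∀ a → f (constant a) S.≈ g (constant a)) →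
                 f indeterminate S.≈ g indeterminate →
                 ∀ p → f p S.≈ g p
    hom-unique {f} {g} f-hom g-hom onConst onX = go
      where
      module F = IsRingHomProperties commutativeRing S f-hom
      module G = IsRingHomProperties commutativeRing S g-hom
      open SetoidReasoning S.setoid
      go : ∀ p → f p S.≈ g p
      go []      = S.trans F.0#-homo (S.sym G.0#-homo)
      go (a ∷ p) = begin
        f (a ∷ p)
          ≈⟨ F.cong (∷-decompose a p) ⟩
        f (constant a +ₚ indeterminate *ₚ p)
          ≈⟨ S.trans (F.+-homo _ _) (S.+-congˡ (F.*-homo _ _)) ⟩
        f (constant a) S.+ f indeterminate S.* f p
          ≈⟨ S.+-cong (onConst a) (S.*-cong onX (go p)) ⟩
        g (constant a) S.+ g indeterminate S.* g p
          ≈⟨ S.trans (G.+-homo _ _) (S.+-congˡ (G.*-homo _ _)) ⟨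
        g (constant a +ₚ indeterminate *ₚ p)
          ≈⟨ G.cong (∷-decompose a p) ⟨
        g (a ∷ p) ∎

-- R[u₁, …, uₙ] = R[u₂, …, uₙ][u₁].  Opaque so that n can be inferred from
-- polynomialRing R n.
opaque
  polynomialRing : ∀ {c ℓ} → CommutativeRing c ℓ → ℕ → CommutativeRing c ℓ
  polynomialRing R zero    = R
  polynomialRing R (suc n) = UnivariatePolynomial.commutativeRing (polynomialRing R n)

  polynomialRing-isDomain : ∀ {c ℓ} {R : CommutativeRing c ℓ} → IsDomain R →
                            ∀ n → IsDomain (polynomialRing R n)
  polynomialRing-isDomain dom zero    = dom
  polynomialRing-isDomain dom (suc n) =
    UnivariatePolynomial.isDomain _ (polynomialRing-isDomain dom n)

module IntervalSums {a ℓ} (M : CommutativeMonoid a ℓ) where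
  open CommutativeMonoid M
  open Sums M using (sum; sum-cong-≋; sum-replicate-zero; ∑-distrib-+)
  open SetoidReasoning setoid

  intervalSum : ∀ {n} → (Fin n → Carrier) → ℕ → ℕ → Carrier
  intervalSum h x y = sum λ j → if (x ≤ᵇ toℕ j) ∧ (toℕ j <ᵇ y) then h j else ε

  intervalSum-cong : ∀ {n} {h k : Fin n → Carrier} → (∀ j → h j ≈ k j) →
                     ∀ x y → intervalSum h x y ≈ intervalSum k x y
  intervalSum-cong {h = h} {k} e x y = sum-cong-≋ λ j → go ((x ≤ᵇ toℕ j) ∧ (toℕ j <ᵇ y)) (e j)
    where
    go : ∀ b {x y} → x ≈ y → (if b then x else ε) ≈ (if b then y else ε)
    go false e = refl
    go true  e = e

  prefix-0 : ∀ {n} (h : Fin n → Carrier) → intervalSum h 0 0 ≈ ε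
  prefix-0 {n} h = sum-replicate-zero n

  prefix-suc : ∀ {n} (h : Fin n → Carrier) (k : Fin n) →
               intervalSum h 0 (suc (toℕ k)) ≈ intervalSum h 0 (toℕ k) ∙ h k
  prefix-suc {suc n} h zero    = begin
    h zero ∙ intervalSum (h ∘ suc) 0 0    ≈⟨ ∙-congˡ (prefix-0 (h ∘ suc)) ⟩
    h zero ∙ ε                            ≈⟨ comm _ _ ⟩
    ε ∙ h zero                            ≈⟨ ∙-congʳ (trans (identityˡ _) (prefix-0 (h ∘ suc))) ⟨
    (ε ∙ intervalSum (h ∘ suc) 0 0) ∙ h zero ∎
  prefix-suc {suc n} h (suc k) = trans (∙-congˡ (prefix-suc (h ∘ suc) k)) (sym (assoc _ _ _))

  prefix-split : ∀ {n} (h : Fin n → Carrier) {x y} → x ≤ y →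
                 intervalSum h 0 x ∙ intervalSum h x y ≈ intervalSum h 0 y
  prefix-split {n} h {x} {y} x≤y = trans (sym (∑-distrib-+ {n} _ _)) (sum-cong-≋ pointwise)
    where
    pointwise : ∀ j → (if toℕ j <ᵇ x then h j else ε) ∙
                      (if (x ≤ᵇ toℕ j) ∧ (toℕ j <ᵇ y) then h j else ε)
                      ≈ (if toℕ j <ᵇ y then h j else ε)
    pointwise j with toℕ j <? x | toℕ j <? y
    ... | yes j<x | yes j<y
      rewrite dec-true (toℕ j <? x) j<x | dec-true (toℕ j <? y) j<y
            | dec-false (x ≤? toℕ j) (ℕₚ.<⇒≱ j<x) = identityʳ _
    ... | yes j<x | no  j≮y = ⊥-elim (j≮y (ℕₚ.<-≤-trans j<x x≤y))
    ... | no  j≮x | yes j<y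
      rewrite dec-false (toℕ j <? x) j≮x | dec-true (toℕ j <? y) j<y
            | dec-true (x ≤? toℕ j) (ℕₚ.≮⇒≥ j≮x) = identityˡ _
    ... | no  j≮x | no  j≮y
      rewrite dec-false (toℕ j <? x) j≮x | dec-false (toℕ j <? y) j≮y
            | dec-true (x ≤? toℕ j) (ℕₚ.≮⇒≥ j≮x) = identityˡ _

module _ {a ℓa b ℓb} (R : CommutativeRing a ℓa) (S : CommutativeRing b ℓb)
         {f : CommutativeRing.Carrier R → CommutativeRing.Carrier S} (hom : IsRingHom R S f) where
  private
    module R = CommutativeRing R
    module S = CommutativeRing S
    open IsRingHomProperties R S hom
    open IntervalSums R.+-commutativeMonoid using () renaming (intervalSum to ∑ᴿ)
    open IntervalSums S.+-commutativeMonoid using () renaming (intervalSum to ∑ˢ)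
    open RawMonoidDefs R.+-rawMonoid using () renaming (sum to sumᴿ)
    open RawMonoidDefs S.+-rawMonoid using () renaming (sum to sumˢ)

  sum-homo : ∀ {n} (h : Fin n → R.Carrier) (k : Fin n → S.Carrier) →
             (∀ j → f (h j) S.≈ k j) → f (sumᴿ h) S.≈ sumˢ k
  sum-homo {zero}  h k e = 0#-homo
  sum-homo {suc n} h k e =
    S.trans (+-homo _ _) (S.+-cong (e zero) (sum-homo (h ∘ suc) (k ∘ suc) (e ∘ suc)))

  intervalSum-homo : ∀ {n} (h : Fin n → R.Carrier) x y → f (∑ᴿ h x y) S.≈ ∑ˢ (f ∘ h) x y
  intervalSum-homo h x y = sum-homo _ _ λ j → go ((x ≤ᵇ toℕ j) ∧ (toℕ j <ᵇ y)) j
    where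
    go : ∀ b j → f (if b then h j else R.0#) S.≈ (if b then f (h j) else S.0#)
    go false j = 0#-homo
    go true  j = S.refl

module Telescoping {a ℓ} (S : CommutativeRing a ℓ) where
  open CommutativeRing S
  open IntervalSums +-commutativeMonoid
  open SetoidReasoning setoid
  open RingProperties ring using (-0#≈0#)

  step : ∀ x y z → (y - x) + (z - y) ≈ z - x
  step x y z = begin
    (y - x) + (z - y)     ≈⟨ +-comm _ _ ⟩
    (z - y) + (y - x)     ≈⟨ +-assoc z (- y) (y - x) ⟩
    z + (- y + (y - x))   ≈⟨ +-congˡ (+-assoc (- y) y (- x)) ⟨
    z + ((- y + y) - x)   ≈⟨ +-congˡ (trans (+-congʳ (-‿inverseˡ y)) (+-identityˡ _)) ⟩
    z - x                 ∎

  minus-cancel : ∀ x y z → (x - z) - (y - z) ≈ x - y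
  minus-cancel x y z = begin
    (x - z) - (y - z)  ≈⟨ +-congˡ flip-minus ⟩
    (x - z) + (z - y)  ≈⟨ +-comm _ _ ⟩
    (z - y) + (x - z)  ≈⟨ step y z x ⟩
    x - y              ∎
    where
    open AbelianGroupProperties +-abelianGroup using (⁻¹-∙-comm; ⁻¹-involutive)
    flip-minus : - (y - z) ≈ z - y
    flip-minus = begin
      - (y - z)     ≈⟨ ⁻¹-∙-comm y (- z) ⟨
      - y + - - z   ≈⟨ +-congˡ (⁻¹-involutive z) ⟩
      - y + z       ≈⟨ +-comm _ _ ⟩
      z - y         ∎

  prefix-telescopes : ∀ {n} (h : Fin n → Carrier) (g : ℕ → Carrier) →
                      (∀ j → h j ≈ g (suc (toℕ j)) - g (toℕ j)) →
                      ∀ {x} → x ≤ n → intervalSum h 0 x ≈ g x - g 0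
  prefix-telescopes h g e {zero}  _   = trans (prefix-0 h) (sym (-‿inverseʳ (g 0)))
  prefix-telescopes {n} h g e {suc x} x<n = begin
    intervalSum h 0 (suc x)                  ≈⟨ last ⟩
    intervalSum h 0 x + (g (suc x) - g x)    ≈⟨ +-congʳ (prefix-telescopes h g e (ℕₚ.<⇒≤ x<n)) ⟩
    (g x - g 0) + (g (suc x) - g x)          ≈⟨ step (g 0) (g x) (g (suc x)) ⟩
    g (suc x) - g 0                          ∎
    where
    last : intervalSum h 0 (suc x) ≈ intervalSum h 0 x + (g (suc x) - g x)
    last = subst (λ k → intervalSum h 0 (suc k) ≈ intervalSum h 0 k + (g (suc k) - g k))
      (toℕ-fromℕ< x<n) (trans (prefix-suc h (fromℕ< x<n)) (+-congˡ (e (fromℕ< x<n))))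

module MultivariatePolynomials {c ℓ} (R : CommutativeRing c ℓ) where
  private
    module R = CommutativeRing R
    module Uni n = UnivariatePolynomial (polynomialRing R n)
    module Pol n = CommutativeRing (polynomialRing R n)

  Poly : ℕ → Set c
  Poly n = Pol.Carrier n

  infix 4 [_]_≈_
  [_]_≈_ : ∀ n → Poly n → Poly n → Set ℓ
  [ n ] p ≈ q = Pol._≈_ n p q

  opaque
    unfolding polynomialRing

    constant : ∀ n → R.Carrier → Poly n
    constant zero    a = a
    constant (suc n) a = Uni.constant n (constant n a)

    weaken : ∀ n → Poly n → Poly (suc n)
    weaken n = Uni.constant n

    var : ∀ {n} → Fin n → Poly n
    var {suc n} zero    = Uni.indeterminate n
    var {suc n} (suc j) = weaken n (var j)

    weaken-isRingHom : ∀ n → IsRingHom (polynomialRing R n) (polynomialRing R (suc n)) (weaken n)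
    weaken-isRingHom n = Uni.constant-isRingHom n

    constant-isRingHom : ∀ n → IsRingHom R (polynomialRing R n) (constant n)
    constant-isRingHom zero    = id-isRingHom R
    constant-isRingHom (suc n) =
      ∘-isRingHom R (polynomialRing R n) (polynomialRing R (suc n))
        (constant-isRingHom n) (weaken-isRingHom n)

  -- The variables being numbered from 0, this is u_x + … + u_{y-1}.
  opaque
    interval : ∀ n → ℕ → ℕ → Poly n
    interval n = IntervalSums.intervalSum (Pol.+-commutativeMonoid n) (var {n})

  module _ {b ℓb} (S : CommutativeRing b ℓb) where
    private module S = CommutativeRing S

    opaque
      unfolding polynomialRing constant

      eval : (R.Carrier → S.Carrier) → ∀ {n} → (Fin n → S.Carrier) → Poly n → S.Carrier
      eval h {zero}  ρ p = h p
      eval h {suc n} ρ p = Uni.evaluate n S (eval h (ρ ∘ suc)) (ρ zero) p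

      eval-isRingHom : ∀ {h} → IsRingHom R S h → ∀ {n} (ρ : Fin n → S.Carrier) →
                       IsRingHom (polynomialRing R n) S (eval h ρ)
      eval-isRingHom hom {zero}  ρ = hom
      eval-isRingHom hom {suc n} ρ =
        Uni.evaluate-isRingHom n S (eval-isRingHom hom (ρ ∘ suc)) (ρ zero)

      eval-constant : ∀ {h} → IsRingHom R S h → ∀ {n} (ρ : Fin n → S.Carrier) a →
                      eval h ρ (constant n a) S.≈ h a
      eval-constant     hom {zero}  ρ a = S.refl
      eval-constant {h} hom {suc n} ρ a = S.trans
        (Uni.evaluate-constant n S (eval h (ρ ∘ suc)) (ρ zero) (constant n a))
        (eval-constant hom (ρ ∘ suc) a)

      eval-var : ∀ {h} → IsRingHom R S h → ∀ {n} (ρ : Fin n → S.Carrier) j →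
                 eval h ρ (var j) S.≈ ρ j
      eval-var     hom {suc n} ρ zero    =
        Uni.evaluate-indeterminate n S (eval-isRingHom hom (ρ ∘ suc)) (ρ zero)
      eval-var {h} hom {suc n} ρ (suc j) = S.trans
        (Uni.evaluate-constant n S (eval h (ρ ∘ suc)) (ρ zero) (var j))
        (eval-var hom (ρ ∘ suc) j)

      hom-unique : ∀ n {f g} → IsRingHom (polynomialRing R n) S f →
                   IsRingHom (polynomialRing R n) S g →
                   (∀ a → f (constant n a) S.≈ g (constant n a)) →
                   (∀ (j : Fin n) → f (var j) S.≈ g (var j)) →
                   ∀ p → f p S.≈ g p
      hom-unique zero    f-hom g-hom onConst onVar p = onConst p
      hom-unique (suc n) f-hom g-hom onConst onVar = Uni.hom-unique n S f-hom g-hom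
        (hom-unique n
          (∘-isRingHom (polynomialRing R n) (polynomialRing R (suc n)) S (weaken-isRingHom n) f-hom)
          (∘-isRingHom (polynomialRing R n) (polynomialRing R (suc n)) S (weaken-isRingHom n) g-hom)
          onConst (onVar ∘ suc))
        (onVar zero)

    opaque
      unfolding interval

      eval-interval : ∀ {h} → IsRingHom R S h → ∀ {n} (ρ : Fin n → S.Carrier) (g : ℕ → S.Carrier) →
                      (∀ j → ρ j S.≈ g (suc (toℕ j)) S.- g (toℕ j)) →
                      ∀ {x} → x ≤ n → eval h ρ (interval n 0 x) S.≈ g x S.- g 0
      eval-interval {h} hom {n} ρ g e {x} x≤n = S.trans
        (intervalSum-homo (polynomialRing R n) S (eval-isRingHom hom ρ) (var {n}) 0 x)
        (Telescoping.prefix-telescopes S (eval h ρ ∘ var) g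
          (λ j → S.trans (eval-var hom ρ j) (e j)) x≤n)

  substitute : ∀ {n} m → (Fin n → Poly m) → Poly n → Poly m
  substitute m = eval (polynomialRing R m) (constant m)

  substitute-isRingHom : ∀ {n} m (ρ : Fin n → Poly m) →
    IsRingHom (polynomialRing R n) (polynomialRing R m) (substitute m ρ)
  substitute-isRingHom m = eval-isRingHom (polynomialRing R m) (constant-isRingHom m)

  substitute-constant : ∀ {n} m (ρ : Fin n → Poly m) a →
                        [ m ] substitute m ρ (constant n a) ≈ constant m a
  substitute-constant m = eval-constant (polynomialRing R m) (constant-isRingHom m)

  substitute-on-var : ∀ {n} m (ρ : Fin n → Poly m) j → [ m ] substitute m ρ (var j) ≈ ρ j
  substitute-on-var m = eval-var (polynomialRing R m) (constant-isRingHom m)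

  substitute-cong : ∀ {n} m {ρ ρ′ : Fin n → Poly m} → (∀ j → [ m ] ρ j ≈ ρ′ j) →
                    ∀ p → [ m ] substitute m ρ p ≈ substitute m ρ′ p
  substitute-cong {n} m {ρ} {ρ′} e = hom-unique (polynomialRing R m) n
    (substitute-isRingHom m ρ) (substitute-isRingHom m ρ′)
    (λ a → trans (substitute-constant m ρ a) (sym (substitute-constant m ρ′ a)))
    (λ j → trans (substitute-on-var m ρ j) (trans (e j) (sym (substitute-on-var m ρ′ j))))
    where open Pol m

  substitute-var : ∀ n p → [ n ] substitute {n} n var p ≈ p
  substitute-var n = hom-unique (polynomialRing R n) n
    (substitute-isRingHom n (var {n})) (id-isRingHom (polynomialRing R n))
    (substitute-constant n (var {n})) (substitute-on-var n var)

  substitute-∘ : ∀ {n} m l (ρ : Fin n → Poly m) (σ : Fin m → Poly l) p →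
    [ l ] substitute l σ (substitute m ρ p) ≈ substitute l (substitute l σ ∘ ρ) p
  substitute-∘ {n} m l ρ σ = hom-unique (polynomialRing R l) n
    (∘-isRingHom (polynomialRing R n) (polynomialRing R m) (polynomialRing R l)
      (substitute-isRingHom m ρ) (substitute-isRingHom l σ))
    (substitute-isRingHom l (substitute l σ ∘ ρ))
    (λ a → trans (trans (Σ.cong (substitute-constant m ρ a)) (substitute-constant l σ a))
      (sym (substitute-constant l (substitute l σ ∘ ρ) a)))
    (λ j → trans (Σ.cong (substitute-on-var m ρ j))
      (sym (substitute-on-var l (substitute l σ ∘ ρ) j)))
    where
    open Pol l
    module Σ = IsRingHomProperties (polynomialRing R m) (polynomialRing R l)
                 (substitute-isRingHom l σ)

  opaque
    unfolding interval

    interval-difference : ∀ n {x y} → x ≤ y →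
      [ n ] interval n x y ≈ Pol._-_ n (interval n 0 y) (interval n 0 x)
    interval-difference n {x} {y} x≤y = sym (begin
      interval n 0 y - interval n 0 x
        ≈⟨ +-congʳ (IntervalSums.prefix-split +-commutativeMonoid (var {n}) x≤y) ⟨
      (interval n 0 x + interval n x y) - interval n 0 x
        ≈⟨ xyx⁻¹≈y (interval n 0 x) (interval n x y) ⟩
      interval n x y ∎)
      where
      open Pol n
      open SetoidReasoning setoid
      open AbelianGroupProperties +-abelianGroup using (xyx⁻¹≈y)

    var-difference : ∀ {n} (j : Fin n) →
      [ n ] var j ≈ Pol._-_ n (interval n 0 (suc (toℕ j))) (interval n 0 (toℕ j))
    var-difference {n} j = sym (begin
      interval n 0 (suc (toℕ j)) - interval n 0 (toℕ j)
        ≈⟨ +-congʳ (IntervalSums.prefix-suc +-commutativeMonoid (var {n}) j) ⟩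
      (interval n 0 (toℕ j) + var j) - interval n 0 (toℕ j)
        ≈⟨ xyx⁻¹≈y (interval n 0 (toℕ j)) (var j) ⟩
      var j ∎)
      where
      open Pol n
      open SetoidReasoning setoid
      open AbelianGroupProperties +-abelianGroup using (xyx⁻¹≈y)

  -- Evaluating u_x at 1 and the other variables at 0 maps the sum to 1.
  interval-≉0 : IsDomain R → ∀ n {x y} → x < y → y ≤ n → ¬ [ n ] interval n x y ≈ Pol.0# n
  interval-≉0 dom n {x} {y} x<y y≤n e = IsDomain.1≉0 dom (begin
    1#                                                  ≈⟨ diff ⟨
    g y - g x                       ≈⟨ Telescoping.minus-cancel R (g y) (g x) (g 0) ⟨
    (g y - g 0) - (g x - g 0)
      ≈⟨ +-cong (eval-interval R id-hom ρ g (λ _ → refl) y≤n)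
                (-‿cong (eval-interval R id-hom ρ g (λ _ → refl) x≤n)) ⟨
    ev (interval n 0 y) - ev (interval n 0 x)           ≈⟨ E.minus-homo _ _ ⟨
    ev (Pol._-_ n (interval n 0 y) (interval n 0 x))    ≈⟨ E.cong (interval-difference n x≤y) ⟨
    ev (interval n x y)                                 ≈⟨ E.cong e ⟩
    ev (Pol.0# n)                                       ≈⟨ E.0#-homo ⟩
    0#                                                  ∎)
    where
    open R
    open SetoidReasoning setoid
    open RingProperties ring using (-0#≈0#)
    id-hom = id-isRingHom R
    x≤y = ℕₚ.<⇒≤ x<y
    x≤n = ℕₚ.≤-trans x≤y y≤n
    g : ℕ → Carrier
    g v = if x <ᵇ v then 1# else 0#
    ρ : Fin n → Carrier
    ρ j = g (suc (toℕ j)) - g (toℕ j)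
    ev = eval R id ρ
    module E = IsRingHomProperties (polynomialRing R n) R (eval-isRingHom R id-hom ρ)
    diff : g y - g x ≈ 1#
    diff rewrite dec-true (x <? y) x<y | dec-false (x <? x) (ℕₚ.<-irrefl ≡.refl) =
      trans (+-congˡ -0#≈0#) (+-identityʳ 1#)

module FieldOfFractions {c ℓ} (R : CommutativeRing c ℓ) (dom : IsDomain R) where
  open CommutativeRing R
  open IsDomain dom

  record Fraction : Set (c ⊔ ℓ) where
    constructor fraction
    field
      num   : Carrier
      den   : Carrier
      den≉0 : ¬ den ≈ 0#
  open Fraction public

  infix 4 _≈ᶠ_
  record _≈ᶠ_ (f g : Fraction) : Set ℓ where
    constructor mk
    field cross : num f * den g ≈ num g * den f
  open _≈ᶠ_ public

  embed : Carrier → Fraction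
  embed p = fraction p 1# 1≉0

  0ᶠ 1ᶠ : Fraction
  0ᶠ = embed 0#
  1ᶠ = embed 1#

  infixl 6 _+ᶠ_
  infixl 7 _*ᶠ_

  opaque
    _+ᶠ_ _*ᶠ_ : Fraction → Fraction → Fraction
    fraction a b b≉0 +ᶠ fraction c d d≉0 = fraction (a * d + c * b) (b * d) (*-≉0 b≉0 d≉0)
    fraction a b b≉0 *ᶠ fraction c d d≉0 = fraction (a * c) (b * d) (*-≉0 b≉0 d≉0)

    -ᶠ_ : Fraction → Fraction
    -ᶠ fraction a b b≉0 = fraction (- a) b b≉0

  ≈ᶠ-from-parts : ∀ {f g} → num f ≈ num g → den f ≈ den g → f ≈ᶠ g
  ≈ᶠ-from-parts e e′ = mk (*-cong e (sym e′))

  private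
    open SemiringSolver commutativeSemiring using (solve; _:+_; _:*_; _:=_; con)
    open SetoidReasoning setoid
    open RingProperties ring using (-‿distribˡ-*)

    opaque
      unfolding _+ᶠ_

      ≈ᶠ-refl : ∀ {f} → f ≈ᶠ f
      ≈ᶠ-refl = mk refl

      ≈ᶠ-sym : ∀ {f g} → f ≈ᶠ g → g ≈ᶠ f
      ≈ᶠ-sym (mk e) = mk (sym e)

      ≈ᶠ-trans : ∀ {f g h} → f ≈ᶠ g → g ≈ᶠ h → f ≈ᶠ h
      ≈ᶠ-trans {fraction a b _} {fraction c d d≉0} {fraction e k _} (mk p) (mk q) =
        mk (*-cancelʳ d≉0 (begin
          (a * k) * d ≈⟨ solve 3 (λ a k d → (a :* k) :* d := (a :* d) :* k) refl a k d ⟩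
          (a * d) * k ≈⟨ *-congʳ p ⟩
          (c * b) * k ≈⟨ solve 3 (λ c b k → (c :* b) :* k := (c :* k) :* b) refl c b k ⟩
          (c * k) * b ≈⟨ *-congʳ q ⟩
          (e * d) * b ≈⟨ solve 3 (λ e d b → (e :* d) :* b := (e :* b) :* d) refl e d b ⟩
          (e * b) * d ∎))

      +ᶠ-cong : ∀ {f f′ g g′} → f ≈ᶠ f′ → g ≈ᶠ g′ → f +ᶠ g ≈ᶠ f′ +ᶠ g′
      +ᶠ-cong {fraction a b _} {fraction a′ b′ _} {fraction c d _} {fraction c′ d′ _} (mk p) (mk q) =
        mk (begin
          (a * d + c * b) * (b′ * d′)
            ≈⟨ solve 6 (λ a b c d b′ d′ → (a :* d :+ c :* b) :* (b′ :* d′)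
                 := (a :* b′) :* (d :* d′) :+ (c :* d′) :* (b :* b′)) refl a b c d b′ d′ ⟩
          (a * b′) * (d * d′) + (c * d′) * (b * b′)
            ≈⟨ +-cong (*-congʳ p) (*-congʳ q) ⟩
          (a′ * b) * (d * d′) + (c′ * d) * (b * b′)
            ≈⟨ solve 6 (λ a′ b c′ d b′ d′ → (a′ :* b) :* (d :* d′) :+ (c′ :* d) :* (b :* b′)
                 := (a′ :* d′ :+ c′ :* b′) :* (b :* d)) refl a′ b c′ d b′ d′ ⟩
          (a′ * d′ + c′ * b′) * (b * d) ∎)

      *ᶠ-cong : ∀ {f f′ g g′} → f ≈ᶠ f′ → g ≈ᶠ g′ → f *ᶠ g ≈ᶠ f′ *ᶠ g′
      *ᶠ-cong {fraction a b _} {fraction a′ b′ _} {fraction c d _} {fraction c′ d′ _} (mk p) (mk q) =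
        mk (begin
          (a * c) * (b′ * d′)   ≈⟨ *-interchange a c b′ d′ ⟩
          (a * b′) * (c * d′)   ≈⟨ *-cong p q ⟩
          (a′ * b) * (c′ * d)   ≈⟨ *-interchange a′ b c′ d ⟩
          (a′ * c′) * (b * d)   ∎)
        where
        open CommutativeSemigroupProperties *-commutativeSemigroup
          using () renaming (interchange to *-interchange)

      -ᶠ-cong : ∀ {f g} → f ≈ᶠ g → -ᶠ f ≈ᶠ -ᶠ g
      -ᶠ-cong {fraction a b _} {fraction c d _} (mk p) = mk (begin
        - a * d    ≈⟨ -‿distribˡ-* a d ⟨
        - (a * d)  ≈⟨ -‿cong p ⟩
        - (c * b)  ≈⟨ -‿distribˡ-* c b ⟩
        - c * b    ∎)

      +ᶠ-assoc : ∀ f g h → (f +ᶠ g) +ᶠ h ≈ᶠ f +ᶠ (g +ᶠ h)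
      +ᶠ-assoc (fraction a b _) (fraction c d _) (fraction e k _) = ≈ᶠ-from-parts
        (solve 6 (λ a b c d e k → (a :* d :+ c :* b) :* k :+ e :* (b :* d)
          := a :* (d :* k) :+ (c :* k :+ e :* d) :* b) refl a b c d e k)
        (*-assoc b d k)

      +ᶠ-comm : ∀ f g → f +ᶠ g ≈ᶠ g +ᶠ f
      +ᶠ-comm (fraction a b _) (fraction c d _) = ≈ᶠ-from-parts (+-comm _ _) (*-comm b d)

      +ᶠ-identityˡ : ∀ f → 0ᶠ +ᶠ f ≈ᶠ f
      +ᶠ-identityˡ (fraction a b _) = ≈ᶠ-from-parts
        (trans (+-cong (zeroˡ b) (*-identityʳ a)) (+-identityˡ a)) (*-identityˡ b)

      -ᶠ-inverseˡ : ∀ f → (-ᶠ f) +ᶠ f ≈ᶠ 0ᶠ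
      -ᶠ-inverseˡ (fraction a b _) = mk (begin
        (- a * b + a * b) * 1#   ≈⟨ *-identityʳ _ ⟩
        - a * b + a * b          ≈⟨ distribʳ b (- a) a ⟨
        (- a + a) * b            ≈⟨ *-congʳ (-‿inverseˡ a) ⟩
        0# * b                   ≈⟨ trans (zeroˡ b) (sym (zeroˡ _)) ⟩
        0# * (b * b)             ∎)

      *ᶠ-assoc : ∀ f g h → (f *ᶠ g) *ᶠ h ≈ᶠ f *ᶠ (g *ᶠ h)
      *ᶠ-assoc (fraction a b _) (fraction c d _) (fraction e k _) =
        ≈ᶠ-from-parts (*-assoc a c e) (*-assoc b d k)

      *ᶠ-comm : ∀ f g → f *ᶠ g ≈ᶠ g *ᶠ f
      *ᶠ-comm (fraction a b _) (fraction c d _) = ≈ᶠ-from-parts (*-comm a c) (*-comm b d)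

      *ᶠ-identityˡ : ∀ f → 1ᶠ *ᶠ f ≈ᶠ f
      *ᶠ-identityˡ (fraction a b _) = ≈ᶠ-from-parts (*-identityˡ a) (*-identityˡ b)

      *ᶠ-distribˡ : ∀ f g h → f *ᶠ (g +ᶠ h) ≈ᶠ f *ᶠ g +ᶠ f *ᶠ h
      *ᶠ-distribˡ (fraction a b _) (fraction c d _) (fraction e k _) = mk
        (solve 6 (λ a b c d e k → (a :* (c :* k :+ e :* d)) :* ((b :* d) :* (b :* k))
          := ((a :* c) :* (b :* k) :+ (a :* e) :* (b :* d)) :* (b :* (d :* k))) refl a b c d e k)

  commutativeRing : CommutativeRing (c ⊔ ℓ) ℓ
  commutativeRing = record
    { Carrier = Fraction
    ; _≈_ = _≈ᶠ_
    ; _+_ = _+ᶠ_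
    ; _*_ = _*ᶠ_
    ; -_ = -ᶠ_
    ; 0# = 0ᶠ
    ; 1# = 1ᶠ
    ; isCommutativeRing = record
      { isRing = record
        { +-isAbelianGroup = record
          { isGroup = record
            { isMonoid = record
              { isSemigroup = record
                { isMagma = record
                  { isEquivalence = record { refl = ≈ᶠ-refl ; sym = ≈ᶠ-sym ; trans = ≈ᶠ-trans }
                  ; ∙-cong = +ᶠ-cong
                  }
                ; assoc = +ᶠ-assoc
                }
              ; identity = +ᶠ-identityˡ , λ f → ≈ᶠ-trans (+ᶠ-comm f 0ᶠ) (+ᶠ-identityˡ f)
              }
            ; inverse = -ᶠ-inverseˡ , λ f → ≈ᶠ-trans (+ᶠ-comm f (-ᶠ f)) (-ᶠ-inverseˡ f)
            ; ⁻¹-cong = -ᶠ-cong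
            }
          ; comm = +ᶠ-comm
          }
        ; *-cong = *ᶠ-cong
        ; *-assoc = *ᶠ-assoc
        ; *-identity = *ᶠ-identityˡ , λ f → ≈ᶠ-trans (*ᶠ-comm f 1ᶠ) (*ᶠ-identityˡ f)
        ; distrib = *ᶠ-distribˡ , λ h f g → ≈ᶠ-trans (*ᶠ-comm (f +ᶠ g) h)
            (≈ᶠ-trans (*ᶠ-distribˡ h f g) (+ᶠ-cong (*ᶠ-comm h f) (*ᶠ-comm h g)))
        }
      ; *-comm = *ᶠ-comm
      }
    }

  opaque
    unfolding _+ᶠ_

    embed-isRingHom : IsRingHom R commutativeRing embed
    embed-isRingHom = mkRingHom R commutativeRing embed
      (λ e → ≈ᶠ-from-parts e refl)
      (λ x y → ≈ᶠ-from-parts (sym (+-cong (*-identityʳ x) (*-identityʳ y))) (sym (*-identityʳ 1#)))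
      (λ x y → ≈ᶠ-from-parts refl (sym (*-identityʳ 1#)))
      ≈ᶠ-refl

  embed-≉0 : ∀ {p} → ¬ p ≈ 0# → ¬ embed p ≈ᶠ 0ᶠ
  embed-≉0 p≉0 (mk e) = p≉0 (trans (sym (*-identityʳ _)) (trans e (zeroˡ 1#)))

  inverse : (f : Fraction) → ¬ f ≈ᶠ 0ᶠ → Fraction
  inverse (fraction a b b≉0) f≉0 = fraction b a
    λ a≈0 → f≉0 (mk (trans (*-congʳ a≈0) (trans (zeroˡ 1#) (sym (zeroˡ b)))))

  opaque
    unfolding _+ᶠ_

    inverseʳ : ∀ f f≉0 → f *ᶠ inverse f f≉0 ≈ᶠ 1ᶠ
    inverseʳ (fraction a b _) f≉0 = mk (trans (*-identityʳ _) (trans (*-comm a b) (sym (*-identityˡ _))))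

  power : (f : Fraction) → ¬ f ≈ᶠ 0ᶠ → ℤ → Fraction
  power f f≉0 (+ n)    = f ^ n
    where open Exponentiation (CommutativeRing.semiring commutativeRing)
  power f f≉0 -[1+ n ] = inverse f f≉0 ^ suc n
    where open Exponentiation (CommutativeRing.semiring commutativeRing)

module _ {a ℓa b ℓb} {R : CommutativeRing a ℓa} (domR : IsDomain R)
         {S : CommutativeRing b ℓb} (domS : IsDomain S) where
  private
    module R = CommutativeRing R
    module S = CommutativeRing S
    module FR = FieldOfFractions R domR
    module FS = FieldOfFractions S domS

  module _ (φ : R.Carrier → S.Carrier) (φ-≉0 : ∀ {p} → ¬ p R.≈ R.0# → ¬ φ p S.≈ S.0#) where

    mapFraction : FR.Fraction → FS.Fraction
    mapFraction f = FS.fraction (φ (FR.num f)) (φ (FR.den f)) (φ-≉0 (FR.den≉0 f))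

    opaque
      unfolding FieldOfFractions._+ᶠ_

      mapFraction-isRingHom : IsRingHom R S φ →
        IsRingHom FR.commutativeRing FS.commutativeRing mapFraction
      mapFraction-isRingHom hom = mkRingHom FR.commutativeRing FS.commutativeRing mapFraction
        (λ (FR.mk e) → FS.mk (S.trans (S.sym (*-homo _ _)) (S.trans (cong e) (*-homo _ _))))
        (λ f g → FS.≈ᶠ-from-parts (S.trans (+-homo _ _) (S.+-cong (*-homo _ _) (*-homo _ _)))
          (*-homo _ _))
        (λ f g → FS.≈ᶠ-from-parts (*-homo _ _) (*-homo _ _))
        (FS.≈ᶠ-from-parts 1#-homo 1#-homo)
        where open IsRingHomProperties R S hom

-- Arities start at 1: component n is the module of operations of arity
-- suc n, and the inputs of such an operation are indexed by Fin (suc n).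
-- Composites have arity suc n + suc m - 1 = suc (n + m).
record Operad {r ℓr} (R : CommutativeRing r ℓr) m ℓm : Set (r ⊔ ℓr ⊔ lsuc (m ⊔ ℓm)) where
  private module R = CommutativeRing R
  field
    component : ℕ → Module R m ℓm

  Op : ℕ → Set m
  Op n = Module.Carrierᴹ (component n)

  infix 4 [_]_≈_
  [_]_≈_ : ∀ n → Op n → Op n → Set ℓm
  [ n ] x ≈ y = Module._≈ᴹ_ (component n) x y

  private
    add : ∀ n → Op n → Op n → Op n
    add n = Module._+ᴹ_ (component n)
    smul : ∀ n → R.Carrier → Op n → Op n
    smul n = Module._*ₗ_ (component n)

  field
    unit : Op 0
    comp : ∀ n m → Op n → Fin (suc n) → Op m → Op (n ℕ.+ m)

    comp-cong : ∀ n m {x x′ y y′} i → [ n ] x ≈ x′ → [ m ] y ≈ y′ →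
                [ n ℕ.+ m ] comp n m x i y ≈ comp n m x′ i y′
    comp-+ˡ : ∀ n m x x′ i y → [ n ℕ.+ m ]
              comp n m (add n x x′) i y ≈ add (n ℕ.+ m) (comp n m x i y) (comp n m x′ i y)
    comp-+ʳ : ∀ n m x i y y′ → [ n ℕ.+ m ]
              comp n m x i (add m y y′) ≈ add (n ℕ.+ m) (comp n m x i y) (comp n m x i y′)
    comp-*ˡ : ∀ n m a x i y → [ n ℕ.+ m ]
              comp n m (smul n a x) i y ≈ smul (n ℕ.+ m) a (comp n m x i y)
    comp-*ʳ : ∀ n m a x i y → [ n ℕ.+ m ]
              comp n m x i (smul m a y) ≈ smul (n ℕ.+ m) a (comp n m x i y)

    identityˡ : ∀ m y → [ m ] comp 0 m unit zero y ≈ y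
    identityʳ : ∀ n x i → [ n ] subst Op (ℕₚ.+-identityʳ n) (comp n 0 x i unit) ≈ x

    sequential : ∀ n m l x y z (i : Fin (suc n)) (j : Fin (suc m)) (k : Fin (suc (n ℕ.+ m))) →
      toℕ k ≡ toℕ i ℕ.+ toℕ j →
      [ n ℕ.+ (m ℕ.+ l) ]
      subst Op (ℕₚ.+-assoc n m l) (comp (n ℕ.+ m) l (comp n m x i y) k z)
      ≈ comp n (m ℕ.+ l) x i (comp m l y j z)

    parallel : ∀ n m l x y z (i k : Fin (suc n))
      (i′ : Fin (suc (n ℕ.+ l))) (k′ : Fin (suc (n ℕ.+ m))) → toℕ i < toℕ k →
      toℕ i′ ≡ toℕ i → toℕ k′ ≡ toℕ k ℕ.+ m →
      [ (n ℕ.+ l) ℕ.+ m ]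
      subst Op (+ℕ.xy∙z≈xz∙y n m l) (comp (n ℕ.+ m) l (comp n m x i y) k′ z)
      ≈ comp (n ℕ.+ l) m (comp n l x k z) i′ y

module _ {r ℓr m₁ ℓ₁ m₂ ℓ₂} {R : CommutativeRing r ℓr}
         (O : Operad R m₁ ℓ₁) (P : Operad R m₂ ℓ₂) where
  private
    module R = CommutativeRing R
    module O = Operad O
    module P = Operad P

    rawModule : ∀ {m ℓ} → Module R m ℓ → RawModule R.Carrier m ℓ
    rawModule = Module.rawBimodule

  record IsOperadMorphism (φ : ∀ n → O.Op n → P.Op n) : Set (r ⊔ m₁ ⊔ ℓ₁ ⊔ ℓ₂) where
    field
      linear    : ∀ n → ModuleMorphisms.ModuleMorphisms.IsModuleHomomorphism
                    (rawModule (O.component n)) (rawModule (P.component n)) (φ n)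
      unit-homo : P.[ 0 ] φ 0 O.unit ≈ P.unit
      comp-homo : ∀ n m x i y →
        P.[ n ℕ.+ m ] φ (n ℕ.+ m) (O.comp n m x i y) ≈ P.comp n m (φ n x) i (φ m y)

-- Gluing a polygon with m + 1 input edges along the edge (i , i + 1)
-- moves vertex v of the outer polygon to outerVertex i m v and vertex v
-- of the inner polygon to i + v.
outerVertex : ℕ → ℕ → ℕ → ℕ
outerVertex i m v with v ≤? i
... | yes _ = v
... | no  _ = v ℕ.+ m

outerVertex-≤ : ∀ i m {v} → v ≤ i → outerVertex i m v ≡ v
outerVertex-≤ i m {v} v≤i with v ≤? i
... | yes _   = ≡.refl
... | no  v≰i = ⊥-elim (v≰i v≤i)

outerVertex-> : ∀ i m {v} → i < v → outerVertex i m v ≡ v ℕ.+ m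
outerVertex-> i m {v} i<v with v ≤? i
... | yes v≤i = ⊥-elim (ℕₚ.<⇒≱ i<v v≤i)
... | no  _   = ≡.refl

outerVertex-bound : ∀ i m {n v} → v ≤ n → outerVertex i m v ≤ n ℕ.+ m
outerVertex-bound i m {n} {v} v≤n with v ≤? i
... | yes _ = ℕₚ.≤-trans v≤n (ℕₚ.m≤m+n n m)
... | no  _ = ℕₚ.+-monoˡ-≤ m v≤n

outer∘outer-seq : ∀ i j m l v → j ≤ m →
  outerVertex (i ℕ.+ j) l (outerVertex i m v) ≡ outerVertex i (m ℕ.+ l) v
outer∘outer-seq i j m l v j≤m with v ≤? i
... | yes v≤i = outerVertex-≤ (i ℕ.+ j) l (ℕₚ.≤-trans v≤i (ℕₚ.m≤m+n i j))
... | no  v≰i = ≡.trans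
  (outerVertex-> (i ℕ.+ j) l (ℕₚ.+-mono-<-≤ (ℕₚ.≰⇒> v≰i) j≤m)) (ℕₚ.+-assoc v m l)

outer∘inner-seq : ∀ i j l v → outerVertex (i ℕ.+ j) l (i ℕ.+ v) ≡ i ℕ.+ outerVertex j l v
outer∘inner-seq i j l v with v ≤? j
... | yes v≤j = outerVertex-≤ (i ℕ.+ j) l (ℕₚ.+-monoʳ-≤ i v≤j)
... | no  v≰j = ≡.trans
  (outerVertex-> (i ℕ.+ j) l (ℕₚ.+-monoʳ-< i (ℕₚ.≰⇒> v≰j))) (ℕₚ.+-assoc i v l)

outer∘outer-par : ∀ i k m l v → i < k →
  outerVertex (k ℕ.+ m) l (outerVertex i m v) ≡ outerVertex i m (outerVertex k l v)
outer∘outer-par i k m l v i<k with v ≤? i | v ≤? k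
... | yes v≤i | yes v≤k = ≡.trans (outerVertex-≤ (k ℕ.+ m) l (ℕₚ.≤-trans v≤k (ℕₚ.m≤m+n k m)))
  (≡.sym (outerVertex-≤ i m v≤i))
... | yes v≤i | no  v≰k = ⊥-elim (v≰k (ℕₚ.≤-trans v≤i (ℕₚ.<⇒≤ i<k)))
... | no  v≰i | yes v≤k = ≡.trans (outerVertex-≤ (k ℕ.+ m) l (ℕₚ.+-monoˡ-≤ m v≤k))
  (≡.sym (outerVertex-> i m (ℕₚ.≰⇒> v≰i)))
... | no  v≰i | no  v≰k = ≡.trans (outerVertex-> (k ℕ.+ m) l (ℕₚ.+-monoˡ-< m (ℕₚ.≰⇒> v≰k)))
  (≡.trans (+ℕ.xy∙z≈xz∙y v m l)
    (≡.sym (outerVertex-> i m (ℕₚ.<-≤-trans (ℕₚ.≰⇒> v≰i) (ℕₚ.m≤m+n v l)))))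

inner∘outer-par : ∀ i k m l v → i < k → v ≤ suc m → outerVertex (k ℕ.+ m) l (i ℕ.+ v) ≡ i ℕ.+ v
inner∘outer-par i k m l v i<k v≤m = outerVertex-≤ (k ℕ.+ m) l
  (subst (i ℕ.+ v ≤_) (≡.refl {x = k ℕ.+ m}) (ℕₚ.≤-trans (ℕₚ.+-monoʳ-≤ i v≤m)
    (subst (_≤ k ℕ.+ m) (≡.sym (ℕₚ.+-suc i m)) (ℕₚ.+-monoˡ-≤ m i<k))))

inner-par : ∀ i k m v → i < k → (k ℕ.+ m) ℕ.+ v ≡ outerVertex i m (k ℕ.+ v)
inner-par i k m v i<k = ≡.trans (+ℕ.xy∙z≈xz∙y k m v)
  (≡.sym (outerVertex-> i m (ℕₚ.<-≤-trans i<k (ℕₚ.m≤m+n k v))))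

module _ {a ℓa b ℓb} {R : CommutativeRing a ℓa} {S : CommutativeRing b ℓb}
         {ι : CommutativeRing.Carrier R → CommutativeRing.Carrier S} (hom : IsRingHom R S ι) where
  private module S = CommutativeRing S
  open IsRingHomProperties R S hom

  algebra⇒module : Module R b ℓb
  algebra⇒module = record
    { Carrierᴹ = S.Carrier
    ; _≈ᴹ_ = S._≈_
    ; _+ᴹ_ = S._+_
    ; _*ₗ_ = λ a x → ι a S.* x
    ; _*ᵣ_ = λ x a → ι a S.* x
    ; 0ᴹ = S.0#
    ; -ᴹ_ = S.-_
    ; isModule = IsModuleFromLeft.isModule {commutativeRing = R} (record
      { isLeftModule = record
        { isLeftSemimodule = record
          { +ᴹ-isCommutativeMonoid = S.+-isCommutativeMonoid
          ; isPreleftSemimodule = record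
            { *ₗ-cong = λ e → S.*-cong (cong e)
            ; *ₗ-zeroˡ = λ x → S.trans (S.*-congʳ 0#-homo) (S.zeroˡ x)
            ; *ₗ-distribʳ = λ x a b → S.trans (S.*-congʳ (+-homo a b)) (S.distribʳ x _ _)
            ; *ₗ-identityˡ = λ x → S.trans (S.*-congʳ 1#-homo) (S.*-identityˡ x)
            ; *ₗ-assoc = λ a b x → S.trans (S.*-congʳ (*-homo a b)) (S.*-assoc _ _ x)
            ; *ₗ-zeroʳ = λ a → S.zeroʳ _
            ; *ₗ-distribˡ = λ a → S.distribˡ _
            }
          }
        ; -ᴹ‿cong = S.-‿cong
        ; -ᴹ‿inverse = S.-‿inverse
        }
      })
    }

module RationalFunctions {c ℓ} (K : CommutativeRing c ℓ) (dom : IsDomain K) where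
  open MultivariatePolynomials K public
  private
    module K = CommutativeRing K
    module Pol n = CommutativeRing (polynomialRing K n)

  poly-isDomain : ∀ n → IsDomain (polynomialRing K n)
  poly-isDomain = polynomialRing-isDomain dom

  module Frac n = FieldOfFractions (polynomialRing K n) (poly-isDomain n)
  module Rat n = CommutativeRing (Frac.commutativeRing n)

  RationalFunction : ℕ → Set (c ⊔ ℓ)
  RationalFunction = Frac.Fraction

  scalar : ∀ n → K.Carrier → RationalFunction n
  scalar n a = Frac.embed n (constant n a)

  scalar-isRingHom : ∀ n → IsRingHom K (Frac.commutativeRing n) (scalar n)
  scalar-isRingHom n = ∘-isRingHom K (polynomialRing K n) (Frac.commutativeRing n)
    (constant-isRingHom n) (Frac.embed-isRingHom n)

  rationalFunctions : ℕ → Module K (c ⊔ ℓ) ℓ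
  rationalFunctions n = algebra⇒module {R = K} {S = Frac.commutativeRing n} {ι = scalar n} (scalar-isRingHom n)

  -- Substituting polynomials into a rational function makes sense when no
  -- nonzero polynomial is sent to zero.
  record Substitution (a b : ℕ) : Set (c ⊔ ℓ) where
    constructor substitution
    field
      image   : Fin a → Poly b
      nonzero : ∀ {p} → ¬ [ a ] p ≈ Pol.0# a → ¬ [ b ] substitute b image p ≈ Pol.0# b
  open Substitution public

  infixr 8 _[_]
  _[_] : ∀ {a b} → RationalFunction a → Substitution a b → RationalFunction b
  _[_] {a} {b} f s = mapFraction (poly-isDomain a) (poly-isDomain b)
    (substitute b (image s)) (nonzero s) f

  []-isRingHom : ∀ {a b} (s : Substitution a b) →
    IsRingHom (Frac.commutativeRing a) (Frac.commutativeRing b) (_[ s ])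
  []-isRingHom {a} {b} s = mapFraction-isRingHom (poly-isDomain a) (poly-isDomain b)
    (substitute b (image s)) (nonzero s) (substitute-isRingHom b (image s))

  []-scalar : ∀ {a b} (s : Substitution a b) x → Rat._≈_ b (scalar a x [ s ]) (scalar b x)
  []-scalar {a} {b} s x = Frac.≈ᶠ-from-parts b (substitute-constant b (image s) x) 1#-homo
    where
    open IsRingHomProperties (polynomialRing K a) (polynomialRing K b)
           (substitute-isRingHom b (image s))

  []-cong : ∀ {a b} (s t : Substitution a b) → (∀ j → [ b ] image s j ≈ image t j) →
            ∀ f → Rat._≈_ b (f [ s ]) (f [ t ])
  []-cong {a} {b} s t e f =
    Frac.≈ᶠ-from-parts b (substitute-cong b e (Frac.num f)) (substitute-cong b e (Frac.den f))

  infixr 9 _⨾_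
  _⨾_ : ∀ {a b d} → Substitution a b → Substitution b d → Substitution a d
  image   (_⨾_ {d = d} s t)     = substitute d (image t) ∘ image s
  nonzero (_⨾_ {a} {b} {d} s t) {p} p≉0 e = nonzero t (nonzero s p≉0)
    (Pol.trans d (substitute-∘ b d (image s) (image t) p) e)

  []-⨾ : ∀ {a b d} (s : Substitution a b) (t : Substitution b d) f →
         Rat._≈_ d ((f [ s ]) [ t ]) (f [ s ⨾ t ])
  []-⨾ {a} {b} {d} s t f = Frac.≈ᶠ-from-parts d
    (substitute-∘ b d (image s) (image t) (Frac.num f))
    (substitute-∘ b d (image s) (image t) (Frac.den f))

  difference : ∀ b → (ℕ → ℕ) → ℕ → ℕ → Poly b
  difference b f x y = Pol._-_ b (interval b 0 (f y)) (interval b 0 (f x))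

  -- An interval is determined by its endpoints, so a map f on polygon vertices
  -- induces a substitution, sending u_{x+1} + … + u_y to the interval from
  -- f x to f y (1-based variables).
  record Moves {a} b (ρ : Fin a → Poly b) (f : ℕ → ℕ) : Set ℓ where
    constructor moves
    field image-var : ∀ j → [ b ] ρ j ≈ difference b f (toℕ j) (suc (toℕ j))
  open Moves public

  moves-difference : ∀ {a} b (ρ : Fin a → Poly b) {f} → Moves b ρ f → ∀ {x y} → x ≤ a → y ≤ a →
    [ b ] substitute b ρ (Pol._-_ a (interval a 0 y) (interval a 0 x)) ≈ difference b f x y
  moves-difference {a} b ρ {f} mv {x} {y} x≤a y≤a = begin
    substitute b ρ (Pol._-_ a (interval a 0 y) (interval a 0 x))
      ≈⟨ minus-homo _ _ ⟩
    substitute b ρ (interval a 0 y) - substitute b ρ (interval a 0 x)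
      ≈⟨ +-cong (ev y≤a) (-‿cong (ev x≤a)) ⟩
    (g y - g 0) - (g x - g 0)
      ≈⟨ Telescoping.minus-cancel (polynomialRing K b) (g y) (g x) (g 0) ⟩
    g y - g x ∎
    where
    open Pol b
    open SetoidReasoning setoid
    open IsRingHomProperties (polynomialRing K a) (polynomialRing K b) (substitute-isRingHom b ρ)
      using (minus-homo)
    g : ℕ → Poly b
    g v = interval b 0 (f v)
    ev : ∀ {v} → v ≤ a → [ b ] substitute b ρ (interval a 0 v) ≈ (g v - g 0)
    ev = eval-interval (polynomialRing K b) (constant-isRingHom b) ρ g (image-var mv)

  moves-interval : ∀ {a} b (ρ : Fin a → Poly b) {f} → Moves b ρ f →
    ∀ {x y} → x ≤ y → y ≤ a → f x ≤ f y →
    [ b ] substitute b ρ (interval a x y) ≈ interval b (f x) (f y)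
  moves-interval {a} b ρ {f} mv {x} {y} x≤y y≤a fx≤fy = begin
    substitute b ρ (interval a x y)
      ≈⟨ cong (interval-difference a x≤y) ⟩
    substitute b ρ (Pol._-_ a (interval a 0 y) (interval a 0 x))
      ≈⟨ moves-difference b ρ mv (ℕₚ.≤-trans x≤y y≤a) y≤a ⟩
    difference b f x y
      ≈⟨ interval-difference b fx≤fy ⟨
    interval b (f x) (f y) ∎
    where
    open Pol b
    open SetoidReasoning setoid
    open IsRingHomProperties (polynomialRing K a) (polynomialRing K b) (substitute-isRingHom b ρ)
      using (cong)

  private
    difference-≗ : ∀ b {f g x y} → f x ≡ g x → f y ≡ g y → difference b f x y ≡ difference b g x y
    difference-≗ b e e′ = ≡.cong₂ (λ v w → Pol._-_ b (interval b 0 w) (interval b 0 v)) e e′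

    -- f is injective on vertices, hence the substitution has a left inverse.
    retract-nonzero : ∀ {a} b (ρ : Fin a → Poly b) (f g : ℕ → ℕ) → Moves b ρ f →
      (∀ {v} → v ≤ a → f v ≤ b) → (∀ {v} → v ≤ a → g (f v) ≡ v) →
      ∀ {p} → ¬ [ a ] p ≈ Pol.0# a → ¬ [ b ] substitute b ρ p ≈ Pol.0# b
    retract-nonzero {a} b ρ f g mv f≤b gf {p} p≉0 e = p≉0 (begin
      p                                     ≈⟨ substitute-var a p ⟨
      substitute a var p                    ≈⟨ substitute-cong a onVar p ⟨
      substitute a (substitute a σ ∘ ρ) p   ≈⟨ substitute-∘ b a ρ σ p ⟨
      substitute a σ (substitute b ρ p)     ≈⟨ cong e ⟩
      substitute a σ (Pol.0# b)             ≈⟨ 0#-homo ⟩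
      0#                                    ∎)
      where
      open Pol a
      open SetoidReasoning setoid
      σ : Fin b → Poly a
      σ j = difference a g (toℕ j) (suc (toℕ j))
      open IsRingHomProperties (polynomialRing K b) (polynomialRing K a) (substitute-isRingHom a σ)
        using (cong; 0#-homo)
      onVar : ∀ j → [ a ] substitute a σ (ρ j) ≈ var j
      onVar j = begin
        substitute a σ (ρ j)
          ≈⟨ cong (image-var mv j) ⟩
        substitute a σ (difference b f (toℕ j) (suc (toℕ j)))
          ≈⟨ moves-difference a σ {g} (moves λ _ → refl) (f≤b j≤a) (f≤b (toℕ<n j)) ⟩
        difference a g (f (toℕ j)) (f (suc (toℕ j)))
          ≡⟨ ≡.cong₂ (λ v w → interval a 0 w - interval a 0 v) (gf j≤a) (gf (toℕ<n j)) ⟩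
        interval a 0 (suc (toℕ j)) - interval a 0 (toℕ j)
          ≈⟨ var-difference j ⟨
        var j ∎
        where j≤a = ℕₚ.<⇒≤ (toℕ<n j)

  moves-⨾ : ∀ {a b d} (s : Substitution a b) (t : Substitution b d) {f g} →
    (∀ {v} → v ≤ a → f v ≤ b) →
    Moves b (image s) f → Moves d (image t) g → Moves d (image (s ⨾ t)) (g ∘ f)
  moves-⨾ {a} {b} {d} s t f≤b mf mg = moves λ j → Pol.trans d (cong (image-var mf j))
    (moves-difference d (image t) mg (f≤b (ℕₚ.<⇒≤ (toℕ<n j))) (f≤b (toℕ<n j)))
    where
    open IsRingHomProperties (polynomialRing K b) (polynomialRing K d)
           (substitute-isRingHom d (image t)) using (cong)

  moves-unique : ∀ {a b} (s t : Substitution a b) {f g} →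
    Moves b (image s) f → Moves b (image t) g → (∀ {v} → v ≤ a → f v ≡ g v) →
    ∀ h → Rat._≈_ b (h [ s ]) (h [ t ])
  moves-unique {a} {b} s t {f} {g} mf mg f≗g = []-cong s t λ j →
    trans (image-var mf j) (trans (reflexive (difference-≗ b {f} {g} (f≗g (ℕₚ.<⇒≤ (toℕ<n j))) (f≗g (toℕ<n j))))
      (sym (image-var mg j)))
    where open Pol b

  moves-subst : ∀ {a b d} (e : b ≡ d) (s : Substitution a b) {f} →
    Moves b (image s) f → Moves d (image (subst (Substitution a) e s)) f
  moves-subst ≡.refl s mv = mv

  moves-id : ∀ {a} (s : Substitution a a) {f} → Moves a (image s) f →
    (∀ {v} → v ≤ a → f v ≡ v) → ∀ h → Rat._≈_ a (h [ s ]) h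
  moves-id {a} s {f} mv f≗id h = Frac.≈ᶠ-from-parts a (identity (Frac.num h)) (identity (Frac.den h))
    where
    open Pol a
    identity : ∀ p → [ a ] substitute a (image s) p ≈ p
    identity p = trans (substitute-cong a
      (λ j → trans (image-var mv j) (trans
        (reflexive (difference-≗ a {f} {id} (f≗id (ℕₚ.<⇒≤ (toℕ<n j))) (f≗id (toℕ<n j))))
        (sym (var-difference j)))) p) (substitute-var a p)

  module _ (n m : ℕ) (i : Fin (suc n)) where
    private
      N : ℕ
      N = suc (n ℕ.+ m)
      i≤n : toℕ i ≤ n
      i≤n = s≤s⁻¹ (toℕ<n i)

    -- With 1-based i and variables, and arities n + 1 and m + 1, this is
    -- (u₁, …, u_{i-1}, u_i + … + u_{i+m}, u_{i+m+1}, …, u_{n+m+1}).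
    outerImage : Fin (suc n) → Poly N
    outerImage j with ℕₚ.<-cmp (toℕ j) (toℕ i)
    ... | tri< _ _ _ = var (fromℕ< {toℕ j} (ℕₚ.<-≤-trans (toℕ<n j) (s≤s (ℕₚ.m≤m+n n m))))
    ... | tri≈ _ _ _ = interval N (toℕ i) (toℕ i ℕ.+ suc m)
    ... | tri> _ _ _ = var (fromℕ< {toℕ j ℕ.+ m} (ℕₚ.+-monoˡ-< m (toℕ<n j)))

    -- Likewise (u_i, …, u_{i+m})
    innerImage : Fin (suc m) → Poly N
    innerImage j = var (fromℕ< {toℕ i ℕ.+ toℕ j}
      (s≤s (ℕₚ.+-mono-≤ i≤n (s≤s⁻¹ (toℕ<n j)))))

    private
      var-fromℕ< : ∀ {k} (k<N : k < N) →
        [ N ] var (fromℕ< k<N) ≈ Pol._-_ N (interval N 0 (suc k)) (interval N 0 k)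
      var-fromℕ< {k} k<N = subst
        (λ l → [ N ] var (fromℕ< k<N) ≈ Pol._-_ N (interval N 0 (suc l)) (interval N 0 l))
        (toℕ-fromℕ< k<N) (var-difference (fromℕ< k<N))

    private
      relabel : ∀ {p} {f : ℕ → ℕ} {j x y} →
        [ N ] p ≈ difference N id x y → f j ≡ x → f (suc j) ≡ y → [ N ] p ≈ difference N f j (suc j)
      relabel e ≡.refl ≡.refl = e

    outer-moves : Moves N outerImage (outerVertex (toℕ i) m)
    outer-moves .image-var j with ℕₚ.<-cmp (toℕ j) (toℕ i)
    ... | tri< j<i _ _ = relabel {f = outerVertex (toℕ i) m} {toℕ j}
      (var-fromℕ< (ℕₚ.<-≤-trans (toℕ<n j) (s≤s (ℕₚ.m≤m+n n m))))
      (outerVertex-≤ (toℕ i) m (ℕₚ.<⇒≤ j<i)) (outerVertex-≤ (toℕ i) m j<i)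
    ... | tri≈ _ j≡i _ = relabel {f = outerVertex (toℕ i) m} {toℕ j}
      (interval-difference N (ℕₚ.m≤m+n (toℕ i) (suc m)))
      (≡.trans (≡.cong (outerVertex (toℕ i) m) j≡i) (outerVertex-≤ (toℕ i) m ℕₚ.≤-refl))
      (≡.trans (≡.cong (outerVertex (toℕ i) m ∘ suc) j≡i)
        (≡.trans (outerVertex-> (toℕ i) m (ℕₚ.n<1+n (toℕ i))) (≡.sym (ℕₚ.+-suc (toℕ i) m))))
    ... | tri> _ _ i<j = relabel {f = outerVertex (toℕ i) m} {toℕ j}
      (var-fromℕ< (ℕₚ.+-monoˡ-< m (toℕ<n j)))
      (outerVertex-> (toℕ i) m i<j) (outerVertex-> (toℕ i) m (ℕₚ.m<n⇒m<1+n i<j))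

    inner-moves : Moves N innerImage (toℕ i ℕ.+_)
    inner-moves .image-var j = relabel {f = toℕ i ℕ.+_} {toℕ j}
      (var-fromℕ< (s≤s (ℕₚ.+-mono-≤ i≤n (s≤s⁻¹ (toℕ<n j)))))
      ≡.refl (ℕₚ.+-suc (toℕ i) (toℕ j))

    private
      collapse : ℕ → ℕ
      collapse v with v ≤? toℕ i
      ... | yes _ = v
      ... | no  _ = v ∸ m

      collapse-outer : ∀ v → collapse (outerVertex (toℕ i) m v) ≡ v
      collapse-outer v with v ≤? toℕ i
      collapse-outer v | yes v≤i with v ≤? toℕ i
      ... | yes _   = ≡.refl
      ... | no  v≰i = ⊥-elim (v≰i v≤i)
      collapse-outer v | no  v≰i with v ℕ.+ m ≤? toℕ i
      ... | yes v+m≤i = ⊥-elim (v≰i (ℕₚ.m+n≤o⇒m≤o v v+m≤i))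
      ... | no  _     = ℕₚ.m+n∸n≡m v m

    inner-bound : ∀ {v} → v ≤ suc m → toℕ i ℕ.+ v ≤ N
    inner-bound {v} v≤m = subst (toℕ i ℕ.+ v ≤_) (ℕₚ.+-suc n m) (ℕₚ.+-mono-≤ i≤n v≤m)

    outer : Substitution (suc n) N
    outer = substitution outerImage (retract-nonzero N outerImage (outerVertex (toℕ i) m) collapse
      outer-moves (outerVertex-bound (toℕ i) m) (λ {v} _ → collapse-outer v))

    inner : Substitution (suc m) N
    inner = substitution innerImage (retract-nonzero N innerImage (toℕ i ℕ.+_) (_∸ toℕ i)
      inner-moves inner-bound (λ {v} _ → ℕₚ.m+n∸m≡n (toℕ i) v))

    compose : RationalFunction (suc n) → RationalFunction (suc m) → RationalFunction N
    compose f g = Rat._*_ N (f [ outer ]) (g [ inner ])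

  private
    cast : ∀ {n n′} → n ≡ n′ → RationalFunction (suc n) → RationalFunction (suc n′)
    cast = subst (RationalFunction ∘ suc)

    castˢ : ∀ {a n n′} → n ≡ n′ → Substitution a (suc n) → Substitution a (suc n′)
    castˢ {a} = subst (Substitution a ∘ suc)

    cast-* : ∀ {n n′} (e : n ≡ n′) f g →
             Rat._≈_ (suc n′) (cast e (Rat._*_ (suc n) f g)) (Rat._*_ (suc n′) (cast e f) (cast e g))
    cast-* {n} ≡.refl f g = Rat.refl (suc n)

    cast-cong : ∀ {n n′} (e : n ≡ n′) {f g} → Rat._≈_ (suc n) f g → Rat._≈_ (suc n′) (cast e f) (cast e g)
    cast-cong ≡.refl eq = eq

    cast-[] : ∀ {a n n′} (e : n ≡ n′) (s : Substitution a (suc n)) f →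
              Rat._≈_ (suc n′) (cast e (f [ s ])) (f [ castˢ e s ])
    cast-[] {n = n} ≡.refl s f = Rat.refl (suc n)

    cast-moves : ∀ {a n n′} (e : n ≡ n′) (s : Substitution a (suc n)) {f} →
                 Moves (suc n) (image s) f → Moves (suc n′) (image (castˢ e s)) f
    cast-moves ≡.refl s mv = mv

    -- Two composites of substitutions that move the vertices alike agree.
    square : ∀ {a b n n′ d} (e : n ≡ n′) (s : Substitution a b) (t : Substitution b (suc n))
      (s′ : Substitution a d) (t′ : Substitution d (suc n′)) {f g f′ g′} →
      Moves b (image s) f → Moves (suc n) (image t) g →
      Moves d (image s′) f′ → Moves (suc n′) (image t′) g′ →
      (∀ {v} → v ≤ a → f v ≤ b) → (∀ {v} → v ≤ a → f′ v ≤ d) →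
      (∀ {v} → v ≤ a → g (f v) ≡ g′ (f′ v)) →
      ∀ h → Rat._≈_ (suc n′) (cast e ((h [ s ]) [ t ])) ((h [ s′ ]) [ t′ ])
    square {n = n} {n′} e s t s′ t′ ms mt ms′ mt′ bound bound′ same h = begin
      cast e ((h [ s ]) [ t ])  ≈⟨ cast-cong e ([]-⨾ s t h) ⟩
      cast e (h [ s ⨾ t ])      ≈⟨ cast-[] e (s ⨾ t) h ⟩
      h [ castˢ e (s ⨾ t) ]
        ≈⟨ moves-unique (castˢ e (s ⨾ t)) (s′ ⨾ t′)
             (cast-moves e (s ⨾ t) (moves-⨾ s t bound ms mt)) (moves-⨾ s′ t′ bound′ ms′ mt′) same h ⟩
      h [ s′ ⨾ t′ ]             ≈⟨ []-⨾ s′ t′ h ⟨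
      (h [ s′ ]) [ t′ ]         ∎
      where open SetoidReasoning (Rat.setoid (suc n′))

    triangle : ∀ {a b n n′} (e : n ≡ n′) (s : Substitution a b) (t : Substitution b (suc n))
      (u : Substitution a (suc n′)) {f g h} →
      Moves b (image s) f → Moves (suc n) (image t) g → Moves (suc n′) (image u) h →
      (∀ {v} → v ≤ a → f v ≤ b) → (∀ {v} → v ≤ a → g (f v) ≡ h v) →
      ∀ k → Rat._≈_ (suc n′) (cast e ((k [ s ]) [ t ])) (k [ u ])
    triangle {n = n} {n′} e s t u ms mt mu bound same k = begin
      cast e ((k [ s ]) [ t ])  ≈⟨ cast-cong e ([]-⨾ s t k) ⟩
      cast e (k [ s ⨾ t ])      ≈⟨ cast-[] e (s ⨾ t) k ⟩
      k [ castˢ e (s ⨾ t) ]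
        ≈⟨ moves-unique (castˢ e (s ⨾ t)) u
             (cast-moves e (s ⨾ t) (moves-⨾ s t bound ms mt)) mu same k ⟩
      k [ u ]                   ∎
      where open SetoidReasoning (Rat.setoid (suc n′))

    single : ∀ {a n n′} (e : n ≡ n′) (s : Substitution a (suc n)) (t : Substitution a (suc n′)) {f g} →
      Moves (suc n) (image s) f → Moves (suc n′) (image t) g → (∀ {v} → v ≤ a → f v ≡ g v) →
      ∀ h → Rat._≈_ (suc n′) (cast e (h [ s ])) (h [ t ])
    single {n′ = n′} e s t ms mt same h = Rat.trans (suc n′) (cast-[] e s h)
      (moves-unique (castˢ e s) t (cast-moves e s ms) mt same h)

    1ʳ : ∀ n → RationalFunction n
    1ʳ = Rat.1#

    []-1 : ∀ {a b} (s : Substitution a b) → Rat._≈_ b (1ʳ a [ s ]) (1ʳ b)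
    []-1 {a} {b} s = 1#-homo
      where open IsRingHomProperties (Frac.commutativeRing a) (Frac.commutativeRing b) ([]-isRingHom s)

    compose-identityˡ : ∀ m g → Rat._≈_ (suc m) (compose 0 m zero (1ʳ 1) g) g
    compose-identityˡ m g = trans
      (*-cong ([]-1 (outer 0 m zero)) (moves-id (inner 0 m zero) (inner-moves 0 m zero) (λ _ → ≡.refl) g))
      (*-identityˡ g)
      where open Rat (suc m) hiding (zero)

    compose-identityʳ : ∀ n f i → Rat._≈_ (suc n) (cast (ℕₚ.+-identityʳ n) (compose n 0 i f (1ʳ 1))) f
    compose-identityʳ n f i = begin
      cast e (f [ outer n 0 i ] * 1ʳ 1 [ inner n 0 i ])
        ≈⟨ cast-cong e (N.trans (N.*-congˡ ([]-1 (inner n 0 i))) (N.*-identityʳ _)) ⟩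
      cast e (f [ outer n 0 i ])
        ≈⟨ cast-[] e (outer n 0 i) f ⟩
      f [ castˢ e (outer n 0 i) ]
        ≈⟨ moves-id (castˢ e (outer n 0 i)) (cast-moves e (outer n 0 i) (outer-moves n 0 i))
             (λ {v} _ → stays v) f ⟩
      f ∎
      where
      e = ℕₚ.+-identityʳ n
      module N = Rat (suc (n ℕ.+ 0))
      open N using (_*_)
      open SetoidReasoning (Rat.setoid (suc n))
      stays : ∀ v → outerVertex (toℕ i) 0 v ≡ v
      stays v with v ≤? toℕ i
      ... | yes _ = ≡.refl
      ... | no  _ = ℕₚ.+-identityʳ v

    compose-sequential : ∀ n m l f g h (i : Fin (suc n)) (j : Fin (suc m)) (k : Fin (suc (n ℕ.+ m))) →
      toℕ k ≡ toℕ i ℕ.+ toℕ j →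
      Rat._≈_ (suc (n ℕ.+ (m ℕ.+ l)))
        (cast (ℕₚ.+-assoc n m l) (compose (n ℕ.+ m) l k (compose n m i f g) h))
        (compose n (m ℕ.+ l) i f (compose m l j g h))
    compose-sequential n m l f g h i j k k≡ = begin
      cast e (compose (n ℕ.+ m) l k (compose n m i f g) h)
        ≈⟨ cast-* e (compose n m i f g [ o₂ ]) (h [ i₂ ]) ⟩
      cast e (compose n m i f g [ o₂ ]) * cast e (h [ i₂ ])
        ≈⟨ *-congʳ (trans (cast-cong e (O₂.*-homo (f [ o₁ ]) (g [ i₁ ])))
             (cast-* e ((f [ o₁ ]) [ o₂ ]) ((g [ i₁ ]) [ o₂ ]))) ⟩
      (cast e ((f [ o₁ ]) [ o₂ ]) * cast e ((g [ i₁ ]) [ o₂ ])) * cast e (h [ i₂ ])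
        ≈⟨ *-cong (*-cong
             (triangle e o₁ o₂ o₃ (outer-moves n m i) (outer-moves (n ℕ.+ m) l k)
               (outer-moves n (m ℕ.+ l) i) (outerVertex-bound (toℕ i) m)
               (λ {v} _ → ≡.trans (at-k (λ x → outerVertex x l (outerVertex (toℕ i) m v)))
                 (outer∘outer-seq (toℕ i) (toℕ j) m l v (s≤s⁻¹ (toℕ<n j)))) f)
             (square e i₁ o₂ o₄ i₃ (inner-moves n m i) (outer-moves (n ℕ.+ m) l k)
               (outer-moves m l j) (inner-moves n (m ℕ.+ l) i)
               (inner-bound n m i) (outerVertex-bound (toℕ j) l)
               (λ {v} _ → ≡.trans (at-k (λ x → outerVertex x l (toℕ i ℕ.+ v)))
                 (outer∘inner-seq (toℕ i) (toℕ j) l v)) g))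
             (sym (back h)) ⟩
      (f [ o₃ ] * (g [ o₄ ]) [ i₃ ]) * (h [ i₄ ]) [ i₃ ]
        ≈⟨ *-assoc _ _ _ ⟩
      f [ o₃ ] * ((g [ o₄ ]) [ i₃ ] * (h [ i₄ ]) [ i₃ ])
        ≈⟨ *-congˡ (I₃.*-homo (g [ o₄ ]) (h [ i₄ ])) ⟨
      compose n (m ℕ.+ l) i f (compose m l j g h) ∎
      where
      e = ℕₚ.+-assoc n m l
      N = suc (n ℕ.+ (m ℕ.+ l))
      open Rat N
      open SetoidReasoning setoid
      o₁ = outer n m i
      i₁ = inner n m i
      o₂ = outer (n ℕ.+ m) l k
      i₂ = inner (n ℕ.+ m) l k
      o₃ = outer n (m ℕ.+ l) i
      i₃ = inner n (m ℕ.+ l) i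
      o₄ = outer m l j
      i₄ = inner m l j
      module O₂ = IsRingHomProperties (Frac.commutativeRing (suc (n ℕ.+ m)))
        (Frac.commutativeRing (suc (n ℕ.+ m ℕ.+ l))) ([]-isRingHom o₂)
      module I₃ = IsRingHomProperties (Frac.commutativeRing (suc (m ℕ.+ l)))
        (Frac.commutativeRing N) ([]-isRingHom i₃)
      at-k : (F : ℕ → ℕ) → F (toℕ k) ≡ F (toℕ i ℕ.+ toℕ j)
      at-k F = ≡.cong F k≡
      back : ∀ h → (h [ i₄ ]) [ i₃ ] ≈ cast e (h [ i₂ ])
      back h = sym (trans (cast-[] e i₂ h) (trans
        (moves-unique (castˢ e i₂) (i₄ ⨾ i₃) (cast-moves e i₂ (inner-moves (n ℕ.+ m) l k))
          (moves-⨾ i₄ i₃ (inner-bound m l j) (inner-moves m l j) (inner-moves n (m ℕ.+ l) i))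
          (λ {v} _ → ≡.trans (at-k (ℕ._+ v)) (ℕₚ.+-assoc (toℕ i) (toℕ j) v)) h)
        (sym ([]-⨾ i₄ i₃ h))))

    compose-parallel : ∀ n m l f g h (i k : Fin (suc n))
      (i′ : Fin (suc (n ℕ.+ l))) (k′ : Fin (suc (n ℕ.+ m))) → toℕ i < toℕ k →
      toℕ i′ ≡ toℕ i → toℕ k′ ≡ toℕ k ℕ.+ m →
      Rat._≈_ (suc (n ℕ.+ l ℕ.+ m))
        (cast (+ℕ.xy∙z≈xz∙y n m l) (compose (n ℕ.+ m) l k′ (compose n m i f g) h))
        (compose (n ℕ.+ l) m i′ (compose n l k f h) g)
    compose-parallel n m l f g h i k i′ k′ i<k i′≡ k′≡ = begin
      cast e (compose (n ℕ.+ m) l k′ (compose n m i f g) h)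
        ≈⟨ cast-* e (compose n m i f g [ o₂ ]) (h [ i₂ ]) ⟩
      cast e (compose n m i f g [ o₂ ]) * cast e (h [ i₂ ])
        ≈⟨ *-congʳ (trans (cast-cong e (O₂.*-homo (f [ o₁ ]) (g [ i₁ ])))
             (cast-* e ((f [ o₁ ]) [ o₂ ]) ((g [ i₁ ]) [ o₂ ]))) ⟩
      (cast e ((f [ o₁ ]) [ o₂ ]) * cast e ((g [ i₁ ]) [ o₂ ])) * cast e (h [ i₂ ])
        ≈⟨ *-cong (*-cong
             (square e o₁ o₂ o₃ o₄ (outer-moves n m i) (outer-moves (n ℕ.+ m) l k′)
               (outer-moves n l k) (outer-moves (n ℕ.+ l) m i′)
               (outerVertex-bound (toℕ i) m) (outerVertex-bound (toℕ k) l)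
               (λ {v} _ → ≡.trans (at-k (λ x → outerVertex x l (outerVertex (toℕ i) m v)))
                 (≡.trans (outer∘outer-par (toℕ i) (toℕ k) m l v i<k)
                   (at-i (λ x → outerVertex x m (outerVertex (toℕ k) l v))))) f)
             (triangle e i₁ o₂ i₄ (inner-moves n m i) (outer-moves (n ℕ.+ m) l k′)
               (inner-moves (n ℕ.+ l) m i′) (inner-bound n m i)
               (λ {v} v≤ → ≡.trans (at-k (λ x → outerVertex x l (toℕ i ℕ.+ v)))
                 (≡.trans (inner∘outer-par (toℕ i) (toℕ k) m l v i<k v≤) (at-i (ℕ._+ v)))) g))
             back ⟩
      ((f [ o₃ ]) [ o₄ ] * g [ i₄ ]) * (h [ i₃ ]) [ o₄ ]
        ≈⟨ *-swap _ _ _ ⟩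
      ((f [ o₃ ]) [ o₄ ] * (h [ i₃ ]) [ o₄ ]) * g [ i₄ ]
        ≈⟨ *-congʳ (O₄.*-homo (f [ o₃ ]) (h [ i₃ ])) ⟨
      compose (n ℕ.+ l) m i′ (compose n l k f h) g ∎
      where
      e = +ℕ.xy∙z≈xz∙y n m l
      N = suc (n ℕ.+ l ℕ.+ m)
      open Rat N
      open SetoidReasoning setoid
      open CommutativeSemigroupProperties *-commutativeSemigroup
        using () renaming (xy∙z≈xz∙y to *-swap)
      o₁ = outer n m i
      i₁ = inner n m i
      o₂ = outer (n ℕ.+ m) l k′
      i₂ = inner (n ℕ.+ m) l k′
      o₃ = outer n l k
      i₃ = inner n l k
      o₄ = outer (n ℕ.+ l) m i′
      i₄ = inner (n ℕ.+ l) m i′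
      module O₂ = IsRingHomProperties (Frac.commutativeRing (suc (n ℕ.+ m)))
        (Frac.commutativeRing (suc (n ℕ.+ m ℕ.+ l))) ([]-isRingHom o₂)
      module O₄ = IsRingHomProperties (Frac.commutativeRing (suc (n ℕ.+ l)))
        (Frac.commutativeRing N) ([]-isRingHom o₄)
      at-k : (F : ℕ → ℕ) → F (toℕ k′) ≡ F (toℕ k ℕ.+ m)
      at-k F = ≡.cong F k′≡
      at-i : (F : ℕ → ℕ) → F (toℕ i) ≡ F (toℕ i′)
      at-i F = ≡.cong F (≡.sym i′≡)
      back : cast e (h [ i₂ ]) ≈ (h [ i₃ ]) [ o₄ ]
      back = trans (cast-[] e i₂ h) (trans
        (moves-unique (castˢ e i₂) (i₃ ⨾ o₄) (cast-moves e i₂ (inner-moves (n ℕ.+ m) l k′))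
          (moves-⨾ i₃ o₄ (inner-bound n l k) (inner-moves n l k) (outer-moves (n ℕ.+ l) m i′))
          (λ {v} _ → ≡.trans (at-k (ℕ._+ v)) (≡.trans (inner-par (toℕ i) (toℕ k) m v i<k)
            (at-i (λ x → outerVertex x m (toℕ k ℕ.+ v))))) h)
        (sym ([]-⨾ i₃ o₄ h)))

  operad : Operad K (c ⊔ ℓ) ℓ
  operad = record
    { component  = rationalFunctions ∘ suc
    ; unit       = 1ʳ 1
    ; comp       = λ n m f i g → compose n m i f g
    ; comp-cong  = λ n m {f} {f′} {g} {g′} i e e′ → Rat.*-cong (suc (n ℕ.+ m))
        (RingMorphisms.IsRingHomomorphism.⟦⟧-cong ([]-isRingHom (outer n m i)) {f} {f′} e)
        (RingMorphisms.IsRingHomomorphism.⟦⟧-cong ([]-isRingHom (inner n m i)) {g} {g′} e′)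
    ; comp-+ˡ    = comp-+ˡ
    ; comp-+ʳ    = comp-+ʳ
    ; comp-*ˡ    = comp-*ˡ
    ; comp-*ʳ    = comp-*ʳ
    ; identityˡ  = compose-identityˡ
    ; identityʳ  = compose-identityʳ
    ; sequential = compose-sequential
    ; parallel   = compose-parallel
    }
    where
    module _ (n m : ℕ) (i : Fin (suc n)) where
      module Out = IsRingHomProperties (Frac.commutativeRing (suc n))
        (Frac.commutativeRing (suc (n ℕ.+ m))) ([]-isRingHom (outer n m i))
      module In = IsRingHomProperties (Frac.commutativeRing (suc m))
        (Frac.commutativeRing (suc (n ℕ.+ m))) ([]-isRingHom (inner n m i))

    comp-+ˡ : ∀ n m f f′ i g → _
    comp-+ˡ n m f f′ i g = trans (*-congʳ (Out.+-homo n m i f f′)) (distribʳ _ _ _)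
      where open Rat (suc (n ℕ.+ m))
    comp-+ʳ : ∀ n m f i g g′ → _
    comp-+ʳ n m f i g g′ = trans (*-congˡ (In.+-homo n m i g g′)) (distribˡ _ _ _)
      where open Rat (suc (n ℕ.+ m))
    comp-*ˡ : ∀ n m a f i g → _
    comp-*ˡ n m a f i g = trans
      (*-congʳ (trans (Out.*-homo n m i (scalar (suc n) a) f) (*-congʳ ([]-scalar (outer n m i) a))))
      (*-assoc _ _ _)
      where open Rat (suc (n ℕ.+ m))
    comp-*ʳ : ∀ n m a f i g → _
    comp-*ʳ n m a f i g = trans
      (*-congˡ (trans (In.*-homo n m i (scalar (suc m) a) g) (*-congʳ ([]-scalar (inner n m i) a))))
      (x∙yz≈y∙xz _ _ _)
      where
      open Rat (suc (n ℕ.+ m))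
      open CommutativeSemigroupProperties *-commutativeSemigroup using (x∙yz≈y∙xz)

module _ {r ℓr m₁ ℓ₁ m₂ ℓ₂} {R : CommutativeRing r ℓr} (M : Module R m₁ ℓ₁) (N : Module R m₂ ℓ₂) where
  private
    module R = CommutativeRing R
    module M = Module M
    module N = Module N

  -- Compatibility with 0 and - follows.
  record IsLinear (f : M.Carrierᴹ → N.Carrierᴹ) : Set (r ⊔ m₁ ⊔ ℓ₁ ⊔ ℓ₂) where
    constructor isLinear
    field
      cong   : ∀ {x y} → x M.≈ᴹ y → f x N.≈ᴹ f y
      +-homo : ∀ x y → f (x M.+ᴹ y) N.≈ᴹ f x N.+ᴹ f y
      *-homo : ∀ a x → f (a M.*ₗ x) N.≈ᴹ a N.*ₗ f x

    0-homo : f M.0ᴹ N.≈ᴹ N.0ᴹ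
    0-homo = N.≈ᴹ-trans (cong (M.≈ᴹ-sym (M.*ₗ-zeroˡ M.0ᴹ)))
      (N.≈ᴹ-trans (*-homo R.0# M.0ᴹ) (N.*ₗ-zeroˡ _))

∘-isLinear : ∀ {r ℓr m₁ ℓ₁ m₂ ℓ₂ m₃ ℓ₃} {R : CommutativeRing r ℓr}
             (L : Module R m₁ ℓ₁) (M : Module R m₂ ℓ₂) (N : Module R m₃ ℓ₃) {f g} →
             IsLinear L M f → IsLinear M N g → IsLinear L N (g ∘ f)
∘-isLinear L M N f-lin g-lin = isLinear
  (G.cong ∘ F.cong)
  (λ x y → ≈ᴹ-trans (G.cong (F.+-homo x y)) (G.+-homo _ _))
  (λ a x → ≈ᴹ-trans (G.cong (F.*-homo a x)) (G.*-homo a _))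
  where
  open Module N
  module F = IsLinear f-lin
  module G = IsLinear g-lin

-- The free module on a setoid, presented by generators and relations.
module FreeModule {r ℓr} (R : CommutativeRing r ℓr) where
  private module R = CommutativeRing R

  infixl 6 _⊕_
  infixr 7 _·_
  data Combination {x} (X : Set x) : Set (r ⊔ x) where
    gen : X → Combination X
    𝟎   : Combination X
    _⊕_ : Combination X → Combination X → Combination X
    _·_ : R.Carrier → Combination X → Combination X

  module _ {x ℓx} (X : Setoid x ℓx) where
    private module X = Setoid X

    infix 4 _≋_
    data _≋_ : Rel (Combination X.Carrier) (r ⊔ ℓr ⊔ x ⊔ ℓx) where
      ≋-refl  : ∀ {s} → s ≋ s
      ≋-sym   : ∀ {s t} → s ≋ t → t ≋ s
      ≋-trans : ∀ {s t u} → s ≋ t → t ≋ u → s ≋ u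
      gen-cong : ∀ {p q} → p X.≈ q → gen p ≋ gen q
      ⊕-cong   : ∀ {s s′ t t′} → s ≋ s′ → t ≋ t′ → s ⊕ t ≋ s′ ⊕ t′
      ·-cong   : ∀ {a b s t} → a R.≈ b → s ≋ t → a · s ≋ b · t
      ⊕-assoc     : ∀ s t u → (s ⊕ t) ⊕ u ≋ s ⊕ (t ⊕ u)
      ⊕-comm      : ∀ s t → s ⊕ t ≋ t ⊕ s
      ⊕-identityˡ : ∀ s → 𝟎 ⊕ s ≋ s
      ·-identity  : ∀ s → R.1# · s ≋ s
      ·-assoc     : ∀ a b s → (a R.* b) · s ≋ a · b · s
      ·-distribˡ  : ∀ a s t → a · (s ⊕ t) ≋ a · s ⊕ a · t
      ·-distribʳ  : ∀ a b s → (a R.+ b) · s ≋ a · s ⊕ b · s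
      ·-zero      : ∀ s → R.0# · s ≋ 𝟎

    private
      negate : Combination X.Carrier → Combination X.Carrier
      negate s = (R.- R.1#) · s

      negate-inverseˡ : ∀ s → negate s ⊕ s ≋ 𝟎
      negate-inverseˡ s = ≋-trans (⊕-cong ≋-refl (≋-sym (·-identity s)))
        (≋-trans (≋-sym (·-distribʳ _ _ s))
          (≋-trans (·-cong (R.-‿inverseˡ R.1#) ≋-refl) (·-zero s)))

    freeModule : Module R (r ⊔ x) (r ⊔ ℓr ⊔ x ⊔ ℓx)
    freeModule = record
      { Carrierᴹ = Combination X.Carrier
      ; _≈ᴹ_ = _≋_
      ; _+ᴹ_ = _⊕_
      ; _*ₗ_ = _·_
      ; _*ᵣ_ = λ s a → a · s
      ; 0ᴹ = 𝟎
      ; -ᴹ_ = negate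
      ; isModule = IsModuleFromLeft.isModule {commutativeRing = R} (record
        { isLeftModule = record
          { isLeftSemimodule = record
            { +ᴹ-isCommutativeMonoid = record
              { isMonoid = record
                { isSemigroup = record
                  { isMagma = record
                    { isEquivalence = record { refl = ≋-refl ; sym = ≋-sym ; trans = ≋-trans }
                    ; ∙-cong = ⊕-cong
                    }
                  ; assoc = ⊕-assoc
                  }
                ; identity = ⊕-identityˡ , λ s → ≋-trans (⊕-comm s 𝟎) (⊕-identityˡ s)
                }
              ; comm = ⊕-comm
              }
            ; isPreleftSemimodule = record
              { *ₗ-cong = ·-cong
              ; *ₗ-zeroˡ = ·-zero
              ; *ₗ-distribʳ = λ s a b → ·-distribʳ a b s
              ; *ₗ-identityˡ = ·-identity
              ; *ₗ-assoc = ·-assoc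
              ; *ₗ-zeroʳ = λ a → ≋-trans (·-cong R.refl (≋-sym (·-zero 𝟎)))
                  (≋-trans (≋-sym (·-assoc a R.0# 𝟎))
                    (≋-trans (·-cong (R.zeroʳ a) ≋-refl) (·-zero 𝟎)))
              ; *ₗ-distribˡ = ·-distribˡ
              }
            }
          ; -ᴹ‿cong = ·-cong R.refl
          ; -ᴹ‿inverse = negate-inverseˡ , λ s → ≋-trans (⊕-comm s (negate s)) (negate-inverseˡ s)
          }
        })
      }

  module _ {x n ℓn} {X : Set x} (N : Module R n ℓn) where
    private module N = Module N
    open CommutativeSemigroupProperties
      (CommutativeMonoid.commutativeSemigroup N.+ᴹ-commutativeMonoid) using (interchange)

    extend : (X → N.Carrierᴹ) → Combination X → N.Carrierᴹ
    extend f (gen p) = f p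
    extend f 𝟎       = N.0ᴹ
    extend f (s ⊕ t) = extend f s N.+ᴹ extend f t
    extend f (a · s) = a N.*ₗ extend f s

    extend-ext : ∀ {f g : X → N.Carrierᴹ} → (∀ p → f p N.≈ᴹ g p) → ∀ s → extend f s N.≈ᴹ extend g s
    extend-ext e (gen p) = e p
    extend-ext e 𝟎       = N.≈ᴹ-refl
    extend-ext e (s ⊕ t) = N.+ᴹ-cong (extend-ext e s) (extend-ext e t)
    extend-ext e (a · s) = N.*ₗ-congˡ (extend-ext e s)

    extend-pointwise : ∀ {l ℓl} (L : Module R l ℓl) (f : X → Module.Carrierᴹ L → N.Carrierᴹ) →
      (∀ p → IsLinear L N (f p)) → ∀ s → IsLinear L N (λ t → extend (λ p → f p t) s)
    extend-pointwise L f lin s = isLinear (λ e → extend-ext (λ p → IsLinear.cong (lin p) e) s)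
      (sum s) (scaled s)
      where
      module L = Module L
      open SetoidReasoning N.≈ᴹ-setoid
      sum : ∀ s t t′ → extend (λ p → f p (t L.+ᴹ t′)) s
                       N.≈ᴹ extend (λ p → f p t) s N.+ᴹ extend (λ p → f p t′) s
      sum (gen p)  t t′ = IsLinear.+-homo (lin p) t t′
      sum 𝟎        t t′ = N.≈ᴹ-sym (N.+ᴹ-identityˡ N.0ᴹ)
      sum (s ⊕ s′) t t′ = N.≈ᴹ-trans (N.+ᴹ-cong (sum s t t′) (sum s′ t t′)) (interchange _ _ _ _)
      sum (a · s)  t t′ = N.≈ᴹ-trans (N.*ₗ-congˡ (sum s t t′)) (N.*ₗ-distribˡ a _ _)
      scaled : ∀ s b t → extend (λ p → f p (b L.*ₗ t)) s N.≈ᴹ b N.*ₗ extend (λ p → f p t) s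
      scaled (gen p)  b t = IsLinear.*-homo (lin p) b t
      scaled 𝟎        b t = N.≈ᴹ-sym (N.*ₗ-zeroʳ b)
      scaled (s ⊕ s′) b t = N.≈ᴹ-trans (N.+ᴹ-cong (scaled s b t) (scaled s′ b t))
        (N.≈ᴹ-sym (N.*ₗ-distribˡ b _ _))
      scaled (a · s)  b t = begin
        a N.*ₗ extend (λ p → f p (b L.*ₗ t)) s    ≈⟨ N.*ₗ-congˡ (scaled s b t) ⟩
        a N.*ₗ b N.*ₗ extend (λ p → f p t) s      ≈⟨ N.*ₗ-assoc a b _ ⟨
        (a R.* b) N.*ₗ extend (λ p → f p t) s     ≈⟨ N.*ₗ-congʳ (R.*-comm a b) ⟩
        (b R.* a) N.*ₗ extend (λ p → f p t) s     ≈⟨ N.*ₗ-assoc b a _ ⟩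
        b N.*ₗ a N.*ₗ extend (λ p → f p t) s      ∎

  module _ {x ℓx n ℓn} (X : Setoid x ℓx) (N : Module R n ℓn) where
    private
      module X = Setoid X
      module N = Module N

    extend-isLinear : ∀ {f : X.Carrier → N.Carrierᴹ} → (∀ {p q} → p X.≈ q → f p N.≈ᴹ f q) →
                      IsLinear (freeModule X) N (extend N f)
    extend-isLinear {f} f-cong = isLinear cong (λ _ _ → N.≈ᴹ-refl) (λ _ _ → N.≈ᴹ-refl)
      where
      cong : ∀ {s t} → _≋_ X s t → extend N f s N.≈ᴹ extend N f t
      cong ≋-refl             = N.≈ᴹ-refl
      cong (≋-sym e)          = N.≈ᴹ-sym (cong e)
      cong (≋-trans e e′)     = N.≈ᴹ-trans (cong e) (cong e′)
      cong (gen-cong e)       = f-cong e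
      cong (⊕-cong e e′)      = N.+ᴹ-cong (cong e) (cong e′)
      cong (·-cong e e′)      = N.*ₗ-cong e (cong e′)
      cong (⊕-assoc s t u)    = N.+ᴹ-assoc _ _ _
      cong (⊕-comm s t)       = N.+ᴹ-comm _ _
      cong (⊕-identityˡ s)    = N.+ᴹ-identityˡ _
      cong (·-identity s)     = N.*ₗ-identityˡ _
      cong (·-assoc a b s)    = N.*ₗ-assoc a b _
      cong (·-distribˡ a s t) = N.*ₗ-distribˡ a _ _
      cong (·-distribʳ a b s) = N.*ₗ-distribʳ _ a b
      cong (·-zero s)         = N.*ₗ-zeroˡ _

    linear-unique : ∀ {f g} → IsLinear (freeModule X) N f → IsLinear (freeModule X) N g →
                    (∀ p → f (gen p) N.≈ᴹ g (gen p)) → ∀ s → f s N.≈ᴹ g s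
    linear-unique {f} {g} f-lin g-lin e = go
      where
      module F = IsLinear f-lin
      module G = IsLinear g-lin
      go : ∀ s → f s N.≈ᴹ g s
      go (gen p) = e p
      go 𝟎       = N.≈ᴹ-trans F.0-homo (N.≈ᴹ-sym G.0-homo)
      go (s ⊕ t) = N.≈ᴹ-trans (F.+-homo s t)
        (N.≈ᴹ-trans (N.+ᴹ-cong (go s) (go t)) (N.≈ᴹ-sym (G.+-homo s t)))
      go (a · s) = N.≈ᴹ-trans (F.*-homo a s)
        (N.≈ᴹ-trans (N.*ₗ-congˡ (go s)) (N.≈ᴹ-sym (G.*-homo a s)))

-- The arcs of a polygon with vertices 0, …, n: vertices are numbered
-- from 0, one less than in the 1-based convention.
record Arc (n : ℕ) : Set where
  constructor arc
  field
    source  : ℕ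
    target  : ℕ
    .ordered : source < target
    .bounded : target ≤ n
open Arc public

-- The six cases in the definition of the label of (x , y) in a composite
-- at i with an inner clique of arity m.  For x < y and m ≥ 1 they exclude
-- each other.
data Position (i m x y : ℕ) : Set where
  before   : y ≤ i → Position i m x y
  around   : x ≤ i → i ℕ.+ m ≤ y → ¬ (x ≡ i × y ≡ i ℕ.+ m) → Position i m x y
  after    : i ℕ.+ m ≤ x → Position i m x y
  inside   : i ≤ x → y ≤ i ℕ.+ m → ¬ (x ≡ i × y ≡ i ℕ.+ m) → Position i m x y
  glued    : x ≡ i → y ≡ i ℕ.+ m → Position i m x y
  crossing : ¬ y ≤ i → ¬ (x ≤ i × i ℕ.+ m ≤ y) → ¬ i ℕ.+ m ≤ x →
             ¬ (i ≤ x × y ≤ i ℕ.+ m) → Position i m x y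

position : ∀ i m x y → Position i m x y
position i m x y with x ≟ i ×-dec y ≟ i ℕ.+ m
... | yes (x≡i , y≡i+m) = glued x≡i y≡i+m
... | no  ¬glued with y ≤? i
...   | yes y≤i = before y≤i
...   | no  y≰i with x ≤? i ×-dec i ℕ.+ m ≤? y
...     | yes (x≤i , i+m≤y) = around x≤i i+m≤y ¬glued
...     | no  ¬around with i ℕ.+ m ≤? x
...       | yes i+m≤x = after i+m≤x
...       | no  i+m≰x with i ≤? x ×-dec y ≤? i ℕ.+ m
...         | yes (i≤x , y≤i+m) = inside i≤x y≤i+m ¬glued
...         | no  ¬inside       = crossing y≰i ¬around i+m≰x ¬inside

module Cliques {a ℓ} (M : UnitalMagma a ℓ) where
  open UnitalMagma M renaming (_∙_ to _⋆_; ε to 𝟙)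

  -- A clique of arity suc n
  record Clique (n : ℕ) : Set (a ⊔ ℓ) where
    field
      label     : Arc (suc n) → Carrier
      arity-one : n ≡ 0 → ∀ α → label α ≈ 𝟙
  open Clique public

  infix 4 _≈ᶜ_
  record _≈ᶜ_ {n} (p q : Clique n) : Set ℓ where
    constructor mk
    field labels : ∀ α → label p α ≈ label q α
  open _≈ᶜ_ public

  cliques : ℕ → Setoid (a ⊔ ℓ) ℓ
  cliques n = record
    { Carrier = Clique n
    ; _≈_ = _≈ᶜ_
    ; isEquivalence = record
      { refl  = mk λ α → refl
      ; sym   = λ e → mk λ α → sym (labels e α)
      ; trans = λ e f → mk λ α → trans (labels e α) (labels f α)
      }
    }

  𝐮 : Clique 0
  𝐮 = record { label = λ _ → 𝟙 ; arity-one = λ _ _ → refl }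

  base : ∀ {n} → Clique n → Carrier
  base {n} p = label p (arc 0 (suc n) (s≤s z≤n) ℕₚ.≤-refl)

  edge : ∀ {n} → Clique n → Fin (suc n) → Carrier
  edge p i = label p (arc (toℕ i) (suc (toℕ i)) ℕₚ.≤-refl (toℕ<n i))

  private
    shrink : ∀ {n m y} → y ≤ suc (n ℕ.+ m) → y ∸ m ≤ suc n
    shrink {n} {m} {y} y≤ = ℕₚ.≤-trans (ℕₚ.∸-monoˡ-≤ m y≤) (ℕₚ.≤-reflexive (ℕₚ.m+n∸n≡m (suc n) m))

    above : ∀ {i m y} → i ℕ.+ suc m ≤ y → i < y ∸ m
    above {i} {m} {y} i+m≤y = ℕₚ.m+n≤o⇒m≤o∸n (suc i) (subst (_≤ y) (ℕₚ.+-suc i m) i+m≤y)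

    m≤ : ∀ {i m x} → i ℕ.+ suc m ≤ x → m ≤ x
    m≤ {i} {m} le = ℕₚ.≤-trans (ℕₚ.n≤1+n m) (ℕₚ.m+n≤o⇒n≤o i le)

  module _ {n m : ℕ} (p : Clique n) (i : Fin (suc n)) (q : Clique m) where

    glueAt : (α : Arc (suc (n ℕ.+ m))) → Position (toℕ i) (suc m) (source α) (target α) → Carrier
    glueAt (arc x y x<y y≤) (before y≤i) =
      label p (arc x y x<y (ℕₚ.≤-trans y≤i (ℕₚ.<⇒≤ (toℕ<n i))))
    glueAt (arc x y x<y y≤) (around x≤i i+m≤y _) =
      label p (arc x (y ∸ m) (ℕₚ.≤-<-trans x≤i (above i+m≤y)) (shrink y≤))
    glueAt (arc x y x<y y≤) (after i+m≤x) =
      label p (arc (x ∸ m) (y ∸ m) (ℕₚ.∸-monoˡ-< x<y (m≤ {toℕ i} i+m≤x)) (shrink y≤))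
    glueAt (arc x y x<y y≤) (inside i≤x y≤i+m _) =
      label q (arc (x ∸ toℕ i) (y ∸ toℕ i) (ℕₚ.∸-monoˡ-< x<y i≤x) (ℕₚ.m≤n+o⇒m∸n≤o y (toℕ i) y≤i+m))
    glueAt (arc x y x<y y≤) (glued _ _)          = edge p i ⋆ base q
    glueAt (arc x y x<y y≤) (crossing _ _ _ _)   = 𝟙

    glue : Clique (n ℕ.+ m)
    label     glue α = glueAt α (position (toℕ i) (suc m) (source α) (target α))
    arity-one glue n+m≡0 α = go α (position (toℕ i) (suc m) (source α) (target α))
      where
      n≡0 = ℕₚ.m+n≡0⇒m≡0 n n+m≡0
      m≡0 = ℕₚ.m+n≡0⇒n≡0 n n+m≡0
      go : ∀ α pos → glueAt α pos ≈ 𝟙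
      go (arc x y _ _) (before _)         = arity-one p n≡0 _
      go (arc x y _ _) (around _ _ _)     = arity-one p n≡0 _
      go (arc x y _ _) (after _)          = arity-one p n≡0 _
      go (arc x y _ _) (inside _ _ _)     = arity-one q m≡0 _
      go (arc x y _ _) (glued _ _)        =
        trans (∙-cong (arity-one p n≡0 _) (arity-one q m≡0 _)) (identityˡ 𝟙)
      go (arc x y _ _) (crossing _ _ _ _) = refl

  -- Labels extended by the unit to all pairs of naturals
  ⟦_⟧ : ∀ {n} → Clique n → ℕ → ℕ → Carrier
  ⟦_⟧ {n} p x y with x <? y | y ≤? suc n
  ... | yes x<y | yes y≤n = label p (arc x y x<y y≤n)
  ... | yes _   | no  _   = 𝟙
  ... | no  _   | _       = 𝟙

  ⟦⟧-in : ∀ {n} (p : Clique n) {x y} .(x<y : x < y) .(y≤n : y ≤ suc n) →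
          ⟦ p ⟧ x y ≡ label p (arc x y x<y y≤n)
  ⟦⟧-in {n} p {x} {y} x<y y≤n with x <? y | y ≤? suc n
  ... | yes _   | yes _   = ≡.refl
  ... | yes _   | no  y≰n = ⊥-elim (y≰n (recompute (y ≤? suc n) y≤n))
  ... | no  x≮y | _       = ⊥-elim (x≮y (recompute (x <? y) x<y))

  ⟦⟧-out : ∀ {n} (p : Clique n) {x y} → ¬ (x < y × y ≤ suc n) → ⟦ p ⟧ x y ≡ 𝟙
  ⟦⟧-out {n} p {x} {y} out with x <? y | y ≤? suc n
  ... | yes x<y | yes y≤n = ⊥-elim (out (x<y , y≤n))
  ... | yes _   | no  _   = ≡.refl
  ... | no  _   | _       = ≡.refl

  ⟦⟧-arity-one : (p : Clique 0) → ∀ x y → ⟦ p ⟧ x y ≈ 𝟙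
  ⟦⟧-arity-one p x y with x <? y | y ≤? 1
  ... | yes _ | yes _ = arity-one p ≡.refl _
  ... | yes _ | no  _ = refl
  ... | no  _ | _     = refl

  ⟦⟧-cong : ∀ {n} {p q : Clique n} → p ≈ᶜ q → ∀ x y → ⟦ p ⟧ x y ≈ ⟦ q ⟧ x y
  ⟦⟧-cong {n} e x y with x <? y | y ≤? suc n
  ... | yes _ | yes _ = labels e _
  ... | yes _ | no  _ = refl
  ... | no  _ | _     = refl

  ⟦⟧-injective : ∀ {n} {p q : Clique n} →
                 (∀ x y → x < y → y ≤ suc n → ⟦ p ⟧ x y ≈ ⟦ q ⟧ x y) → p ≈ᶜ q
  ⟦⟧-injective {n} {p} {q} e = mk λ where
    (arc x y x<y y≤n) → trans (reflexive (≡.sym (⟦⟧-in p x<y y≤n)))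
      (trans (e x y (recompute (x <? y) x<y) (recompute (y ≤? suc n) y≤n))
        (reflexive (⟦⟧-in q x<y y≤n)))

  at : Maybe ℕ → Maybe ℕ → (ℕ → ℕ → Carrier) → Carrier
  at (just x) (just y) f = f x y
  at (just x) nothing  f = 𝟙
  at nothing  _        f = 𝟙

  pull : (ℕ → Maybe ℕ) → (ℕ → ℕ → Carrier) → ℕ → ℕ → Carrier
  pull φ f x y = at (φ x) (φ y) f

  at-cong : ∀ s t {f g : ℕ → ℕ → Carrier} → (∀ x y → f x y ≈ g x y) → at s t f ≈ at s t g
  at-cong (just x) (just y) e = e x y
  at-cong (just x) nothing  e = refl
  at-cong nothing  t        e = refl

  at-⋆ : ∀ s t f g → at s t (λ x y → f x y ⋆ g x y) ≈ at s t f ⋆ at s t g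
  at-⋆ (just x) (just y) f g = refl
  at-⋆ (just x) nothing  f g = sym (identityˡ 𝟙)
  at-⋆ nothing  t        f g = sym (identityˡ 𝟙)

  at-pull : ∀ s t φ f → at s t (pull φ f) ≡ at (s >>= φ) (t >>= φ) f
  at-pull (just x) (just y) φ f = ≡.refl
  at-pull (just x) nothing  φ f with φ x
  ... | just _  = ≡.refl
  ... | nothing = ≡.refl
  at-pull nothing  t        φ f = ≡.refl

  at-𝟙 : ∀ s t {f : ℕ → ℕ → Carrier} →
         (∀ {x y} → s ≡ just x → t ≡ just y → f x y ≈ 𝟙) → at s t f ≈ 𝟙
  at-𝟙 (just x) (just y) e = e ≡.refl ≡.refl
  at-𝟙 (just x) nothing  e = refl
  at-𝟙 nothing  t        e = refl

  at-nothingʳ : ∀ s {t} {f : ℕ → ℕ → Carrier} → t ≡ nothing → at s t f ≈ 𝟙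
  at-nothingʳ (just x) ≡.refl = refl
  at-nothingʳ nothing  e      = refl

  maybe-ext : ∀ {s t : Maybe ℕ} → (∀ {x} → s ≡ just x → t ≡ just x) →
              (∀ {x} → t ≡ just x → s ≡ just x) → s ≡ t
  maybe-ext {just x}  {t}       f g = ≡.sym (f ≡.refl)
  maybe-ext {nothing} {just x}  f g = g ≡.refl
  maybe-ext {nothing} {nothing} f g = ≡.refl

  bind-just : ∀ (s : Maybe ℕ) {k : ℕ → Maybe ℕ} {c} → (s >>= k) ≡ just c →
              ∃ λ b → s ≡ just b × k b ≡ just c
  bind-just (just b) e = b , ≡.refl , e

  just-bind : ∀ {s : Maybe ℕ} {k : ℕ → Maybe ℕ} b {c} → s ≡ just b → k b ≡ just c →
              (s >>= k) ≡ just c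
  just-bind b ≡.refl e = e

  -- Partial inverses of outerVertex i m and of v ↦ i + v
  outer⁻¹ : ℕ → ℕ → ℕ → Maybe ℕ
  outer⁻¹ i m v with v ≤? i
  ... | yes _ = just v
  ... | no  _ with i ℕ.+ suc m ≤? v
  ...   | yes _ = just (v ∸ m)
  ...   | no  _ = nothing

  inner⁻¹ : ℕ → ℕ → ℕ → Maybe ℕ
  inner⁻¹ i m v with i ≤? v | v ≤? i ℕ.+ suc m
  ... | yes _ | yes _ = just (v ∸ i)
  ... | yes _ | no  _ = nothing
  ... | no  _ | _     = nothing

  outer⁻¹⇒ : ∀ i m v {x} → outer⁻¹ i m v ≡ just x → v ≡ outerVertex i m x
  outer⁻¹⇒ i m v e with v ≤? i
  outer⁻¹⇒ i m v ≡.refl | yes v≤i = ≡.sym (outerVertex-≤ i m v≤i)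
  outer⁻¹⇒ i m v e      | no  v≰i with i ℕ.+ suc m ≤? v
  outer⁻¹⇒ i m v ≡.refl | no  v≰i | yes le = ≡.sym (≡.trans
    (outerVertex-> i m (above le)) (ℕₚ.m∸n+n≡m (m≤ {i} le)))

  outer⁻¹⇐ : ∀ i m v {x} → v ≡ outerVertex i m x → outer⁻¹ i m v ≡ just x
  outer⁻¹⇐ i m v {x} e with x ≤? i
  outer⁻¹⇐ i m .x {x} ≡.refl | yes x≤i with x ≤? i
  ... | yes _   = ≡.refl
  ... | no  x≰i = ⊥-elim (x≰i x≤i)
  outer⁻¹⇐ i m .(x ℕ.+ m) {x} ≡.refl | no x≰i with x ℕ.+ m ≤? i
  ... | yes x+m≤i = ⊥-elim (x≰i (ℕₚ.m+n≤o⇒m≤o x x+m≤i))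
  ... | no  _ with i ℕ.+ suc m ≤? x ℕ.+ m
  ...   | yes _ = ≡.cong just (ℕₚ.m+n∸n≡m x m)
  ...   | no  ≰ = ⊥-elim (≰ (subst (_≤ x ℕ.+ m) (≡.sym (ℕₚ.+-suc i m))
    (ℕₚ.+-monoˡ-≤ m (ℕₚ.≰⇒> x≰i))))

  inner⁻¹⇒ : ∀ i m v {x} → inner⁻¹ i m v ≡ just x → v ≡ i ℕ.+ x × x ≤ suc m
  inner⁻¹⇒ i m v e with i ≤? v | v ≤? i ℕ.+ suc m
  inner⁻¹⇒ i m v ≡.refl | yes i≤v | yes v≤ =
    ≡.sym (ℕₚ.m+[n∸m]≡n i≤v) , ℕₚ.m≤n+o⇒m∸n≤o v i v≤

  inner⁻¹⇐ : ∀ i m v {x} → v ≡ i ℕ.+ x → x ≤ suc m → inner⁻¹ i m v ≡ just x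
  inner⁻¹⇐ i m .(i ℕ.+ x) {x} ≡.refl x≤m with i ≤? i ℕ.+ x | i ℕ.+ x ≤? i ℕ.+ suc m
  ... | yes _ | yes _ = ≡.cong just (ℕₚ.m+n∸m≡n i x)
  ... | yes _ | no  ≰ = ⊥-elim (≰ (ℕₚ.+-monoʳ-≤ i x≤m))
  ... | no  ≰ | _     = ⊥-elim (≰ (ℕₚ.m≤m+n i x))

  outer⁻¹-hidden : ∀ i m v → i < v → v < i ℕ.+ suc m → outer⁻¹ i m v ≡ nothing
  outer⁻¹-hidden i m v i<v v< with v ≤? i
  ... | yes v≤i = ⊥-elim (ℕₚ.<⇒≱ i<v v≤i)
  ... | no  _ with i ℕ.+ suc m ≤? v
  ...   | yes le = ⊥-elim (ℕₚ.<⇒≱ v< le)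
  ...   | no  _  = ≡.refl

  inner⁻¹-low : ∀ i m v → v < i → inner⁻¹ i m v ≡ nothing
  inner⁻¹-low i m v v<i with i ≤? v
  ... | yes i≤v = ⊥-elim (ℕₚ.<⇒≱ v<i i≤v)
  ... | no  _   = ≡.refl

  inner⁻¹-high : ∀ i m v → i ℕ.+ suc m < v → inner⁻¹ i m v ≡ nothing
  inner⁻¹-high i m v <v with i ≤? v | v ≤? i ℕ.+ suc m
  ... | yes _ | yes v≤ = ⊥-elim (ℕₚ.<⇒≱ <v v≤)
  ... | yes _ | no  _  = ≡.refl
  ... | no  _ | _      = ≡.refl

  outerVertex-mono : ∀ i m {x y} → x < y → outerVertex i m x < outerVertex i m y
  outerVertex-mono i m {x} {y} x<y with x ≤? i | y ≤? i
  ... | yes _   | yes _   = x<y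
  ... | yes _   | no  _   = ℕₚ.<-≤-trans x<y (ℕₚ.m≤m+n y m)
  ... | no  x≰i | yes y≤i = ⊥-elim (x≰i (ℕₚ.≤-trans (ℕₚ.<⇒≤ x<y) y≤i))
  ... | no  _   | no  _   = ℕₚ.+-monoˡ-< m x<y

  module _ {n m : ℕ} (p : Clique n) (i : Fin (suc n)) (q : Clique m) where
    private
      ι = toℕ i
      φ = outer⁻¹ ι m
      ψ = inner⁻¹ ι m
      P Q : ℕ → ℕ → Carrier
      P = pull φ ⟦ p ⟧
      Q = pull ψ ⟦ q ⟧

      i≤n : ι ≤ n
      i≤n = s≤s⁻¹ (toℕ<n i)

      onlyP : ∀ {x y z} → z ≈ P x y → Q x y ≈ 𝟙 → z ≈ P x y ⋆ Q x y
      onlyP e e′ = trans e (trans (sym (identityʳ _)) (∙-cong refl (sym e′)))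

      onlyQ : ∀ {x y z} → P x y ≈ 𝟙 → z ≈ Q x y → z ≈ P x y ⋆ Q x y
      onlyQ e e′ = trans e′ (trans (sym (identityˡ _)) (∙-cong (sym e) refl))

      P-is : ∀ {x y x′ y′} .(x′<y′ : x′ < y′) .(y′≤n : y′ ≤ suc n) →
             φ x ≡ just x′ → φ y ≡ just y′ → label p (arc x′ y′ x′<y′ y′≤n) ≈ P x y
      P-is {x} {y} x′<y′ y′≤n e e′ rewrite e | e′ = reflexive (≡.sym (⟦⟧-in p x′<y′ y′≤n))

      Q-is : ∀ {x y x′ y′} .(x′<y′ : x′ < y′) .(y′≤m : y′ ≤ suc m) →
             ψ x ≡ just x′ → ψ y ≡ just y′ → label q (arc x′ y′ x′<y′ y′≤m) ≈ Q x y
      Q-is {x} {y} x′<y′ y′≤m e e′ rewrite e | e′ = reflexive (≡.sym (⟦⟧-in q x′<y′ y′≤m))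

      P-hiddenˡ : ∀ {x y} → φ x ≡ nothing → P x y ≈ 𝟙
      P-hiddenˡ {x} e rewrite e = refl
      P-hiddenʳ : ∀ {x y} → φ y ≡ nothing → P x y ≈ 𝟙
      P-hiddenʳ {x} {y} e = at-nothingʳ (φ x) e
      Q-hiddenˡ : ∀ {x y} → ψ x ≡ nothing → Q x y ≈ 𝟙
      Q-hiddenˡ {x} e rewrite e = refl
      Q-hiddenʳ : ∀ {x y} → ψ y ≡ nothing → Q x y ≈ 𝟙
      Q-hiddenʳ {x} {y} e = at-nothingʳ (ψ x) e

      φ-≤ : ∀ {v} → v ≤ ι → φ v ≡ just v
      φ-≤ {v} v≤i = outer⁻¹⇐ ι m v (≡.sym (outerVertex-≤ ι m v≤i))

      φ-≥ : ∀ {v} → ι ℕ.+ suc m ≤ v → φ v ≡ just (v ∸ m)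
      φ-≥ {v} le = outer⁻¹⇐ ι m v
        (≡.sym (≡.trans (outerVertex-> ι m (above le)) (ℕₚ.m∸n+n≡m (m≤ {ι} le))))

      ψ-in : ∀ {v} → ι ≤ v → v ≤ ι ℕ.+ suc m → ψ v ≡ just (v ∸ ι)
      ψ-in {v} i≤v v≤ = inner⁻¹⇐ ι m v (≡.sym (ℕₚ.m+[n∸m]≡n i≤v)) (ℕₚ.m≤n+o⇒m∸n≤o v ι v≤)

      glueAt-spec : ∀ {x y} (x<y : x < y) (y≤ : y ≤ suc (n ℕ.+ m)) pos →
                    glueAt p i q (arc x y x<y y≤) pos ≈ P x y ⋆ Q x y
      glueAt-spec {x} {y} x<y y≤ (before y≤i) = onlyP
        (P-is {x} {y} x<y (ℕₚ.≤-trans y≤i (ℕₚ.<⇒≤ (toℕ<n i)))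
          (φ-≤ (ℕₚ.≤-trans (ℕₚ.<⇒≤ x<y) y≤i)) (φ-≤ y≤i))
        (Q-hiddenˡ {x} {y} (inner⁻¹-low ι m x (ℕₚ.<-≤-trans x<y y≤i)))
      glueAt-spec {x} {y} x<y y≤ (around x≤i i+m≤y ¬glued) = onlyP
        (P-is {x} {y} (ℕₚ.≤-<-trans x≤i (above i+m≤y)) (shrink y≤) (φ-≤ x≤i) (φ-≥ i+m≤y)) (Q-case (x ≟ ι))
        where
        Q-case : Dec (x ≡ ι) → Q x y ≈ 𝟙
        Q-case (no x≢i) = Q-hiddenˡ {x} {y} (inner⁻¹-low ι m x (ℕₚ.≤∧≢⇒< x≤i x≢i))
        Q-case (yes x≡i) = Q-hiddenʳ {x} {y} (inner⁻¹-high ι m y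
          (ℕₚ.≤∧≢⇒< i+m≤y λ e → ¬glued (x≡i , ≡.sym e)))
      glueAt-spec {x} {y} x<y y≤ (after i+m≤x) = onlyP
        (P-is {x} {y} (ℕₚ.∸-monoˡ-< x<y (m≤ {ι} i+m≤x)) (shrink y≤)
          (φ-≥ i+m≤x) (φ-≥ (ℕₚ.≤-trans i+m≤x (ℕₚ.<⇒≤ x<y))))
        (Q-hiddenʳ {x} {y} (inner⁻¹-high ι m y (ℕₚ.≤-<-trans i+m≤x x<y)))
      glueAt-spec {x} {y} x<y y≤ (inside i≤x y≤i+m ¬glued) = onlyQ (P-case (x ≟ ι))
        (Q-is {x} {y} (ℕₚ.∸-monoˡ-< x<y i≤x) (ℕₚ.m≤n+o⇒m∸n≤o y ι y≤i+m)
          (ψ-in i≤x (ℕₚ.≤-trans (ℕₚ.<⇒≤ x<y) y≤i+m)) (ψ-in (ℕₚ.≤-trans i≤x (ℕₚ.<⇒≤ x<y)) y≤i+m))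
        where
        P-case : Dec (x ≡ ι) → P x y ≈ 𝟙
        P-case (no x≢i) = P-hiddenˡ {x} {y} (outer⁻¹-hidden ι m x
          (ℕₚ.≤∧≢⇒< i≤x (x≢i ∘ ≡.sym)) (ℕₚ.<-≤-trans x<y y≤i+m))
        P-case (yes x≡i) = P-hiddenʳ {x} {y} (outer⁻¹-hidden ι m y
          (ℕₚ.≤-<-trans i≤x x<y) (ℕₚ.≤∧≢⇒< y≤i+m λ e → ¬glued (x≡i , e)))
      glueAt-spec {x} {y} x<y y≤ (glued x≡i y≡i+m) = ∙-cong
        (P-is {x} {y} ℕₚ.≤-refl (toℕ<n i)
          (≡.trans (≡.cong φ x≡i) (φ-≤ ℕₚ.≤-refl))
          (outer⁻¹⇐ ι m y (≡.trans y≡i+m (≡.trans (ℕₚ.+-suc ι m)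
            (≡.sym (outerVertex-> ι m (ℕₚ.n<1+n ι)))))))
        (Q-is {x} {y} (s≤s z≤n) ℕₚ.≤-refl
          (inner⁻¹⇐ ι m x (≡.trans x≡i (≡.sym (ℕₚ.+-identityʳ ι))) z≤n)
          (inner⁻¹⇐ ι m y y≡i+m ℕₚ.≤-refl))
      glueAt-spec {x} {y} x<y y≤ (crossing y≰i ¬around i+m≰x ¬inside) =
        trans (sym (identityˡ 𝟙)) (∙-cong (sym (P-case (x ≤? ι))) (sym (Q-case (ι ≤? x))))
        where
        P-case : Dec (x ≤ ι) → P x y ≈ 𝟙
        P-case (yes x≤i) = P-hiddenʳ {x} {y} (outer⁻¹-hidden ι m y (ℕₚ.≰⇒> y≰i)
          (ℕₚ.≰⇒> λ le → ¬around (x≤i , le)))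
        P-case (no x≰i) = P-hiddenˡ {x} {y} (outer⁻¹-hidden ι m x (ℕₚ.≰⇒> x≰i) (ℕₚ.≰⇒> i+m≰x))
        Q-case : Dec (ι ≤ x) → Q x y ≈ 𝟙
        Q-case (yes i≤x) = Q-hiddenʳ {x} {y} (inner⁻¹-high ι m y (ℕₚ.≰⇒> λ le → ¬inside (i≤x , le)))
        Q-case (no i≰x) = Q-hiddenˡ {x} {y} (inner⁻¹-low ι m x (ℕₚ.≰⇒> i≰x))

    glue-spec : ∀ x y → ⟦ glue p i q ⟧ x y ≈ P x y ⋆ Q x y
    glue-spec x y with x <? y | y ≤? suc (n ℕ.+ m)
    ... | yes x<y | yes y≤ = glueAt-spec x<y y≤ (position ι (suc m) x y)
    ... | yes x<y | no  y≰ = trans (sym (identityˡ 𝟙)) (∙-cong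
      (sym (at-𝟙 (φ x) (φ y) λ {a} {b} e e′ → reflexive (⟦⟧-out p {a} {b} λ (_ , b≤n) →
        y≰ (subst (_≤ suc (n ℕ.+ m)) (≡.sym (outer⁻¹⇒ ι m y {b} e′)) (outerVertex-bound ι m {suc n} {b} b≤n)))))
      (sym (at-𝟙 (ψ x) (ψ y) λ {a} {b} e e′ → ⊥-elim (y≰ (inner-≤ (inner⁻¹⇒ ι m y e′))))))
      where
      inner-≤ : ∀ {v b} → v ≡ ι ℕ.+ b × b ≤ suc m → v ≤ suc (n ℕ.+ m)
      inner-≤ {b = b} (≡.refl , b≤m) = subst (ι ℕ.+ b ≤_) (ℕₚ.+-suc n m) (ℕₚ.+-mono-≤ i≤n b≤m)
    ... | no  x≮y | _      = trans (sym (identityˡ 𝟙)) (∙-cong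
      (sym (at-𝟙 (φ x) (φ y) λ {a} {b} e e′ → reflexive (⟦⟧-out p {a} {b} λ (a<b , _) →
        x≮y (≡.subst₂ _<_ (≡.sym (outer⁻¹⇒ ι m x {a} e)) (≡.sym (outer⁻¹⇒ ι m y {b} e′))
          (outerVertex-mono ι m {a} {b} a<b)))))
      (sym (at-𝟙 (ψ x) (ψ y) λ {a} {b} e e′ → reflexive (⟦⟧-out q {a} {b} λ (a<b , _) →
        x≮y (≡.subst₂ _<_ (≡.sym (inner⁻¹⇒ ι m x e .proj₁)) (≡.sym (inner⁻¹⇒ ι m y e′ .proj₁))
          (ℕₚ.+-monoʳ-< ι a<b))))))

  glue-cong : ∀ {n m} {p p′ : Clique n} (i : Fin (suc n)) {q q′ : Clique m} →
              p ≈ᶜ p′ → q ≈ᶜ q′ → glue p i q ≈ᶜ glue p′ i q′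
  glue-cong {n} {m} {p} {p′} i {q} {q′} e f = mk λ α → go α (position (toℕ i) (suc m) (source α) (target α))
    where
    go : ∀ α pos → glueAt p i q α pos ≈ glueAt p′ i q′ α pos
    go (arc x y _ _) (before _)         = labels e _
    go (arc x y _ _) (around _ _ _)     = labels e _
    go (arc x y _ _) (after _)          = labels e _
    go (arc x y _ _) (inside _ _ _)     = labels f _
    go (arc x y _ _) (glued _ _)        = ∙-cong (labels e _) (labels f _)
    go (arc x y _ _) (crossing _ _ _ _) = refl

  castᶜ : ∀ {n n′} → n ≡ n′ → Clique n → Clique n′
  castᶜ = subst Clique

  ⟦castᶜ⟧ : ∀ {n n′} (e : n ≡ n′) p x y → ⟦ castᶜ e p ⟧ x y ≡ ⟦ p ⟧ x y
  ⟦castᶜ⟧ ≡.refl p x y = ≡.refl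

  glue-identityˡ : ∀ {m} (q : Clique m) → glue 𝐮 zero q ≈ᶜ q
  glue-identityˡ {m} q = ⟦⟧-injective λ x y x<y y≤m → begin
    ⟦ glue 𝐮 zero q ⟧ x y
      ≈⟨ glue-spec 𝐮 zero q x y ⟩
    pull (outer⁻¹ 0 m) ⟦ 𝐮 ⟧ x y ⋆ pull (inner⁻¹ 0 m) ⟦ q ⟧ x y
      ≈⟨ ∙-cong (at-𝟙 (outer⁻¹ 0 m x) (outer⁻¹ 0 m y) λ {a} {b} _ _ → ⟦⟧-arity-one 𝐮 a b)
           (reflexive (≡.cong₂ (λ s t → at s t ⟦ q ⟧)
             (inner⁻¹⇐ 0 m x ≡.refl (ℕₚ.≤-trans (ℕₚ.<⇒≤ x<y) y≤m)) (inner⁻¹⇐ 0 m y ≡.refl y≤m))) ⟩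
    𝟙 ⋆ ⟦ q ⟧ x y
      ≈⟨ identityˡ _ ⟩
    ⟦ q ⟧ x y ∎
    where open SetoidReasoning setoid

  glue-identityʳ : ∀ {n} (p : Clique n) i → castᶜ (ℕₚ.+-identityʳ n) (glue p i 𝐮) ≈ᶜ p
  glue-identityʳ {n} p i = ⟦⟧-injective λ x y _ _ → begin
    ⟦ castᶜ (ℕₚ.+-identityʳ n) (glue p i 𝐮) ⟧ x y
      ≡⟨ ⟦castᶜ⟧ (ℕₚ.+-identityʳ n) (glue p i 𝐮) x y ⟩
    ⟦ glue p i 𝐮 ⟧ x y
      ≈⟨ glue-spec p i 𝐮 x y ⟩
    pull (outer⁻¹ (toℕ i) 0) ⟦ p ⟧ x y ⋆ pull (inner⁻¹ (toℕ i) 0) ⟦ 𝐮 ⟧ x y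
      ≈⟨ ∙-cong (reflexive (≡.cong₂ (λ s t → at s t ⟦ p ⟧) (all x) (all y)))
           (at-𝟙 (inner⁻¹ (toℕ i) 0 x) (inner⁻¹ (toℕ i) 0 y) λ {a} {b} _ _ → ⟦⟧-arity-one 𝐮 a b) ⟩
    ⟦ p ⟧ x y ⋆ 𝟙
      ≈⟨ identityʳ _ ⟩
    ⟦ p ⟧ x y ∎
    where
    open SetoidReasoning setoid
    all : ∀ v → outer⁻¹ (toℕ i) 0 v ≡ just v
    all v = outer⁻¹⇐ (toℕ i) 0 v (≡.sym stays)
      where
      stays : outerVertex (toℕ i) 0 v ≡ v
      stays with v ≤? toℕ i
      ... | yes _ = ≡.refl
      ... | no  _ = ℕₚ.+-identityʳ v

  exclusive : ∀ {n l} (φ ψ : ℕ → Maybe ℕ) (p : Clique n) (r : Clique l) x y →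
    (∀ {a b c d} → φ x ≡ just a → φ y ≡ just b → ψ x ≡ just c → ψ y ≡ just d → a < b → ⊥) →
    pull φ ⟦ p ⟧ x y ≈ 𝟙 ⊎ pull ψ ⟦ r ⟧ x y ≈ 𝟙
  exclusive φ ψ p r x y excl with φ x | φ y | ψ x | ψ y
  ... | nothing | _       | _       | _       = inj₁ refl
  ... | just _  | nothing | _       | _       = inj₁ refl
  ... | just _  | just _  | nothing | _       = inj₂ refl
  ... | just _  | just _  | just _  | nothing = inj₂ refl
  ... | just a  | just b  | just c  | just d  = inj₁ (reflexive (⟦⟧-out p {a} {b} λ (a<b , _) →
    excl ≡.refl ≡.refl ≡.refl ≡.refl a<b))

  -- Both sides of an associativity law, after expanding the labels
  nested-glue : ∀ {n m l} (p : Clique n) (i : Fin (suc n)) (q : Clique m)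
    (k : Fin (suc (n ℕ.+ m))) (r : Clique l) x y →
    ⟦ glue (glue p i q) k r ⟧ x y ≈
    (pull (λ v → outer⁻¹ (toℕ k) l v >>= outer⁻¹ (toℕ i) m) ⟦ p ⟧ x y ⋆
     pull (λ v → outer⁻¹ (toℕ k) l v >>= inner⁻¹ (toℕ i) m) ⟦ q ⟧ x y) ⋆
    pull (inner⁻¹ (toℕ k) l) ⟦ r ⟧ x y
  nested-glue {m = m} {l} p i q k r x y = trans (glue-spec (glue p i q) k r x y) (∙-cong
    (trans (at-cong s t (glue-spec p i q)) (trans (at-⋆ s t _ _)
      (∙-cong (reflexive (at-pull s t (outer⁻¹ (toℕ i) m) ⟦ p ⟧))
        (reflexive (at-pull s t (inner⁻¹ (toℕ i) m) ⟦ q ⟧)))))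
    refl)
    where
    s = outer⁻¹ (toℕ k) l x
    t = outer⁻¹ (toℕ k) l y

  glue-nested : ∀ {n m l} (p : Clique n) (i : Fin (suc n)) (q : Clique m)
    (j : Fin (suc m)) (r : Clique l) x y →
    ⟦ glue p i (glue q j r) ⟧ x y ≈
    pull (outer⁻¹ (toℕ i) (m ℕ.+ l)) ⟦ p ⟧ x y ⋆
    (pull (λ v → inner⁻¹ (toℕ i) (m ℕ.+ l) v >>= outer⁻¹ (toℕ j) l) ⟦ q ⟧ x y ⋆
     pull (λ v → inner⁻¹ (toℕ i) (m ℕ.+ l) v >>= inner⁻¹ (toℕ j) l) ⟦ r ⟧ x y)
  glue-nested {m = m} {l} p i q j r x y = trans (glue-spec p i (glue q j r) x y) (∙-cong refl
    (trans (at-cong s t (glue-spec q j r)) (trans (at-⋆ s t _ _)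
      (∙-cong (reflexive (at-pull s t (outer⁻¹ (toℕ j) l) ⟦ q ⟧))
        (reflexive (at-pull s t (inner⁻¹ (toℕ j) l) ⟦ r ⟧))))))
    where
    s = inner⁻¹ (toℕ i) (m ℕ.+ l) x
    t = inner⁻¹ (toℕ i) (m ℕ.+ l) y

  pull-≗ : ∀ {φ ψ : ℕ → Maybe ℕ} f → (∀ v → φ v ≡ ψ v) → ∀ x y → pull φ f x y ≈ pull ψ f x y
  pull-≗ f e x y = reflexive (≡.cong₂ (λ s t → at s t f) (e x) (e y))

  outer-outer-seq : ∀ i j m l → j ≤ m → ∀ v →
    (outer⁻¹ (i ℕ.+ j) l v >>= outer⁻¹ i m) ≡ outer⁻¹ i (m ℕ.+ l) v
  outer-outer-seq i j m l j≤m v = maybe-ext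
    (λ {c} e → case-bind (bind-just (outer⁻¹ (i ℕ.+ j) l v) e))
    (λ {c} e → just-bind (outerVertex i m c)
      (outer⁻¹⇐ (i ℕ.+ j) l v (≡.trans (outer⁻¹⇒ i (m ℕ.+ l) v e)
        (≡.sym (outer∘outer-seq i j m l c j≤m))))
      (outer⁻¹⇐ i m (outerVertex i m c) ≡.refl))
    where
    case-bind : ∀ {c} → (∃ λ b → outer⁻¹ (i ℕ.+ j) l v ≡ just b × outer⁻¹ i m b ≡ just c) →
                outer⁻¹ i (m ℕ.+ l) v ≡ just c
    case-bind {c} (b , e , e′) = outer⁻¹⇐ i (m ℕ.+ l) v (≡.trans (outer⁻¹⇒ (i ℕ.+ j) l v e)
      (≡.trans (≡.cong (outerVertex (i ℕ.+ j) l) (outer⁻¹⇒ i m b e′))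
        (outer∘outer-seq i j m l c j≤m)))

  outer-inner-seq : ∀ i j m l → j ≤ m → ∀ v →
    (outer⁻¹ (i ℕ.+ j) l v >>= inner⁻¹ i m) ≡ (inner⁻¹ i (m ℕ.+ l) v >>= outer⁻¹ j l)
  outer-inner-seq i j m l j≤m v = maybe-ext
    (λ e → to (bind-just (outer⁻¹ (i ℕ.+ j) l v) e))
    (λ e → from (bind-just (inner⁻¹ i (m ℕ.+ l) v) e))
    where
    to : ∀ {c} → (∃ λ b → outer⁻¹ (i ℕ.+ j) l v ≡ just b × inner⁻¹ i m b ≡ just c) →
         (inner⁻¹ i (m ℕ.+ l) v >>= outer⁻¹ j l) ≡ just c
    to {c} (b , e , e′) = just-bind (outerVertex j l c)
      (inner⁻¹⇐ i (m ℕ.+ l) v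
        (≡.trans (outer⁻¹⇒ (i ℕ.+ j) l v e)
          (≡.trans (≡.cong (outerVertex (i ℕ.+ j) l) (inner⁻¹⇒ i m b e′ .proj₁))
            (outer∘inner-seq i j l c)))
        (outerVertex-bound j l (inner⁻¹⇒ i m b e′ .proj₂)))
      (outer⁻¹⇐ j l (outerVertex j l c) ≡.refl)
    unbound : ∀ c → outerVertex j l c ≤ suc (m ℕ.+ l) → c ≤ suc m
    unbound c le with c ≤? j
    ... | yes c≤j = ℕₚ.≤-trans c≤j (ℕₚ.≤-trans j≤m (ℕₚ.n≤1+n m))
    ... | no  _   = ℕₚ.+-cancelʳ-≤ l c (suc m) le
    from : ∀ {c} → (∃ λ b → inner⁻¹ i (m ℕ.+ l) v ≡ just b × outer⁻¹ j l b ≡ just c) →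
           (outer⁻¹ (i ℕ.+ j) l v >>= inner⁻¹ i m) ≡ just c
    from {c} (b , e , e′) = just-bind (i ℕ.+ c)
      (outer⁻¹⇐ (i ℕ.+ j) l v (≡.trans (inner⁻¹⇒ i (m ℕ.+ l) v e .proj₁)
        (≡.trans (≡.cong (i ℕ.+_) b≡) (≡.sym (outer∘inner-seq i j l c)))))
      (inner⁻¹⇐ i m (i ℕ.+ c) ≡.refl
        (unbound c (subst (_≤ suc (m ℕ.+ l)) b≡ (inner⁻¹⇒ i (m ℕ.+ l) v e .proj₂))))
      where
      b≡ : b ≡ outerVertex j l c
      b≡ = outer⁻¹⇒ j l b e′

  inner-inner-seq : ∀ i j m l → j ≤ m → ∀ v →
    inner⁻¹ (i ℕ.+ j) l v ≡ (inner⁻¹ i (m ℕ.+ l) v >>= inner⁻¹ j l)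
  inner-inner-seq i j m l j≤m v = maybe-ext to (λ e → from (bind-just (inner⁻¹ i (m ℕ.+ l) v) e))
    where
    to : ∀ {c} → inner⁻¹ (i ℕ.+ j) l v ≡ just c → (inner⁻¹ i (m ℕ.+ l) v >>= inner⁻¹ j l) ≡ just c
    to {c} e = just-bind (j ℕ.+ c)
      (inner⁻¹⇐ i (m ℕ.+ l) v (≡.trans (inner⁻¹⇒ (i ℕ.+ j) l v e .proj₁) (ℕₚ.+-assoc i j c))
        (subst (j ℕ.+ c ≤_) (ℕₚ.+-suc m l) (ℕₚ.+-mono-≤ j≤m (inner⁻¹⇒ (i ℕ.+ j) l v e .proj₂))))
      (inner⁻¹⇐ j l (j ℕ.+ c) ≡.refl (inner⁻¹⇒ (i ℕ.+ j) l v e .proj₂))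
    from : ∀ {c} → (∃ λ b → inner⁻¹ i (m ℕ.+ l) v ≡ just b × inner⁻¹ j l b ≡ just c) →
           inner⁻¹ (i ℕ.+ j) l v ≡ just c
    from {c} (b , e , e′) = inner⁻¹⇐ (i ℕ.+ j) l v
      (≡.trans (inner⁻¹⇒ i (m ℕ.+ l) v e .proj₁)
        (≡.trans (≡.cong (i ℕ.+_) (inner⁻¹⇒ j l b e′ .proj₁)) (≡.sym (ℕₚ.+-assoc i j c))))
      (inner⁻¹⇒ j l b e′ .proj₂)

  -- An arc of the outermost clique which is also one of the innermost
  -- clique forces the middle clique to have arity 1.
  seq-exclusive : ∀ i j m l → j ≤ m → 0 < m → ∀ {x y a b c d} →
    outer⁻¹ i (m ℕ.+ l) x ≡ just a → outer⁻¹ i (m ℕ.+ l) y ≡ just b →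
    inner⁻¹ (i ℕ.+ j) l x ≡ just c → inner⁻¹ (i ℕ.+ j) l y ≡ just d → a < b → ⊥
  seq-exclusive i j m l j≤m 0<m {x} {y} {a} {b} {c} {d} ea eb ec ed a<b with b ≤? i | a ≤? i
  ... | yes b≤i | _ = ℕₚ.<⇒≱ (ℕₚ.<-≤-trans a<b b≤i) (subst (i ≤_) x≡a i≤x)
    where
    x≡a = ≡.trans (outer⁻¹⇒ i (m ℕ.+ l) x ea)
      (outerVertex-≤ i (m ℕ.+ l) (ℕₚ.≤-trans (ℕₚ.<⇒≤ a<b) b≤i))
    i≤x : i ≤ x
    i≤x = subst (i ≤_) (≡.sym (inner⁻¹⇒ (i ℕ.+ j) l x ec .proj₁))
      (ℕₚ.≤-trans (ℕₚ.m≤m+n i j) (ℕₚ.m≤m+n (i ℕ.+ j) c))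
  ... | no  b≰i | yes a≤i = ℕₚ.<⇒≱ 0<m (ℕₚ.+-cancelʳ-≤ (suc (i ℕ.+ l)) m 0 (begin
    m ℕ.+ suc (i ℕ.+ l)    ≡⟨ +ℕ.x∙yz≈y∙xz m (suc i) l ⟩
    suc i ℕ.+ (m ℕ.+ l)    ≤⟨ ℕₚ.+-monoˡ-≤ (m ℕ.+ l) (ℕₚ.≰⇒> b≰i) ⟩
    b ℕ.+ (m ℕ.+ l)        ≡⟨ outerVertex-> i (m ℕ.+ l) (ℕₚ.≰⇒> b≰i) ⟨
    outerVertex i (m ℕ.+ l) b ≡⟨ outer⁻¹⇒ i (m ℕ.+ l) y eb ⟨
    y                      ≡⟨ inner⁻¹⇒ (i ℕ.+ j) l y ed .proj₁ ⟩
    (i ℕ.+ j) ℕ.+ d        ≤⟨ ℕₚ.+-mono-≤ i+j≤i (inner⁻¹⇒ (i ℕ.+ j) l y ed .proj₂) ⟩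
    i ℕ.+ suc l            ≡⟨ ℕₚ.+-suc i l ⟩
    suc (i ℕ.+ l)          ∎))
    where
    open ℕₚ.≤-Reasoning
    i+j≤i : i ℕ.+ j ≤ i
    i+j≤i = ℕₚ.≤-trans (subst (i ℕ.+ j ≤_) (≡.trans
      (≡.sym (inner⁻¹⇒ (i ℕ.+ j) l x ec .proj₁))
      (≡.trans (outer⁻¹⇒ i (m ℕ.+ l) x ea) (outerVertex-≤ i (m ℕ.+ l) a≤i)))
      (ℕₚ.m≤m+n (i ℕ.+ j) c)) a≤i
  ... | no  b≰i | no  a≰i = ℕₚ.n≮n y (begin-strict
    y                      ≡⟨ inner⁻¹⇒ (i ℕ.+ j) l y ed .proj₁ ⟩
    (i ℕ.+ j) ℕ.+ d        ≤⟨ ℕₚ.+-mono-≤ (ℕₚ.+-monoʳ-≤ i j≤m) (inner⁻¹⇒ (i ℕ.+ j) l y ed .proj₂) ⟩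
    (i ℕ.+ m) ℕ.+ suc l    ≡⟨ ≡.trans (ℕₚ.+-suc (i ℕ.+ m) l) (≡.cong suc (ℕₚ.+-assoc i m l)) ⟩
    suc i ℕ.+ (m ℕ.+ l)    ≤⟨ ℕₚ.+-monoˡ-≤ (m ℕ.+ l) (ℕₚ.≰⇒> a≰i) ⟩
    a ℕ.+ (m ℕ.+ l)        <⟨ ℕₚ.+-monoˡ-< (m ℕ.+ l) a<b ⟩
    b ℕ.+ (m ℕ.+ l)        ≡⟨ outerVertex-> i (m ℕ.+ l) (ℕₚ.≰⇒> b≰i) ⟨
    outerVertex i (m ℕ.+ l) b ≡⟨ outer⁻¹⇒ i (m ℕ.+ l) y eb ⟨
    y                      ∎)
    where open ℕₚ.≤-Reasoning

  almost-assoc : ∀ {u v w} → u ≈ 𝟙 ⊎ v ≈ 𝟙 ⊎ w ≈ 𝟙 → (u ⋆ v) ⋆ w ≈ u ⋆ (v ⋆ w)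
  almost-assoc (inj₁ e) = trans (∙-cong (trans (∙-cong e refl) (identityˡ _)) refl)
    (sym (trans (∙-cong e refl) (identityˡ _)))
  almost-assoc (inj₂ (inj₁ e)) = trans (∙-cong (trans (∙-cong refl e) (identityʳ _)) refl)
    (sym (∙-cong refl (trans (∙-cong e refl) (identityˡ _))))
  almost-assoc (inj₂ (inj₂ e)) = trans (trans (∙-cong refl e) (identityʳ _))
    (sym (∙-cong refl (trans (∙-cong refl e) (identityʳ _))))

  glue-sequential : ∀ {n m l} (p : Clique n) (q : Clique m) (r : Clique l)
    (i : Fin (suc n)) (j : Fin (suc m)) (k : Fin (suc (n ℕ.+ m))) → toℕ k ≡ toℕ i ℕ.+ toℕ j →
    castᶜ (ℕₚ.+-assoc n m l) (glue (glue p i q) k r) ≈ᶜ glue p i (glue q j r)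
  glue-sequential {n} {m} {l} p q r i j k k≡ = ⟦⟧-injective λ x y _ _ → begin
    ⟦ castᶜ (ℕₚ.+-assoc n m l) (glue (glue p i q) k r) ⟧ x y
      ≡⟨ ⟦castᶜ⟧ (ℕₚ.+-assoc n m l) (glue (glue p i q) k r) x y ⟩
    ⟦ glue (glue p i q) k r ⟧ x y
      ≈⟨ nested-glue p i q k r x y ⟩
    (pull (λ v → outer⁻¹ (toℕ k) l v >>= outer⁻¹ ι m) ⟦ p ⟧ x y ⋆
     pull (λ v → outer⁻¹ (toℕ k) l v >>= inner⁻¹ ι m) ⟦ q ⟧ x y) ⋆
    pull (inner⁻¹ (toℕ k) l) ⟦ r ⟧ x y
      ≈⟨ ∙-cong (∙-cong
           (pull-≗ ⟦ p ⟧ (λ v → ≡.trans (≡.cong (λ κ → outer⁻¹ κ l v >>= outer⁻¹ ι m) k≡)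
             (outer-outer-seq ι γ m l j≤m v)) x y)
           (pull-≗ ⟦ q ⟧ (λ v → ≡.trans (≡.cong (λ κ → outer⁻¹ κ l v >>= inner⁻¹ ι m) k≡)
             (outer-inner-seq ι γ m l j≤m v)) x y))
           (pull-≗ ⟦ r ⟧ (λ v → ≡.cong (λ κ → inner⁻¹ κ l v) k≡) x y) ⟩
    (P x y ⋆ Q x y) ⋆ pull (inner⁻¹ (ι ℕ.+ γ) l) ⟦ r ⟧ x y
      ≈⟨ almost-assoc (trivial m ≡.refl x y) ⟩
    P x y ⋆ (Q x y ⋆ pull (inner⁻¹ (ι ℕ.+ γ) l) ⟦ r ⟧ x y)
      ≈⟨ ∙-cong refl (∙-cong refl (pull-≗ ⟦ r ⟧ (inner-inner-seq ι γ m l j≤m) x y)) ⟩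
    P x y ⋆ (Q x y ⋆ pull (λ v → inner⁻¹ ι (m ℕ.+ l) v >>= inner⁻¹ γ l) ⟦ r ⟧ x y)
      ≈⟨ glue-nested p i q j r x y ⟨
    ⟦ glue p i (glue q j r) ⟧ x y ∎
    where
    open SetoidReasoning setoid
    ι = toℕ i
    γ = toℕ j
    j≤m : γ ≤ m
    j≤m = s≤s⁻¹ (toℕ<n j)
    P Q : ℕ → ℕ → Carrier
    P = pull (outer⁻¹ ι (m ℕ.+ l)) ⟦ p ⟧
    Q = pull (λ v → inner⁻¹ ι (m ℕ.+ l) v >>= outer⁻¹ γ l) ⟦ q ⟧
    trivial : ∀ m′ → m ≡ m′ → ∀ x y →
      P x y ≈ 𝟙 ⊎ Q x y ≈ 𝟙 ⊎ pull (inner⁻¹ (ι ℕ.+ γ) l) ⟦ r ⟧ x y ≈ 𝟙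
    trivial zero     ≡.refl x y = inj₂ (inj₁ (at-𝟙 (inner⁻¹ ι (m ℕ.+ l) x >>= outer⁻¹ γ l)
      (inner⁻¹ ι (m ℕ.+ l) y >>= outer⁻¹ γ l) λ {a} {b} _ _ → ⟦⟧-arity-one q a b))
    trivial (suc m′) ≡.refl x y with
      exclusive (outer⁻¹ ι (m ℕ.+ l)) (inner⁻¹ (ι ℕ.+ γ) l) p r x y
        (seq-exclusive ι γ m l j≤m (s≤s z≤n))
    ... | inj₁ e = inj₁ e
    ... | inj₂ e = inj₂ (inj₂ e)

  outer-outer-par : ∀ i k m l → i < k → ∀ v →
    (outer⁻¹ (k ℕ.+ m) l v >>= outer⁻¹ i m) ≡ (outer⁻¹ i m v >>= outer⁻¹ k l)
  outer-outer-par i k m l i<k v = maybe-ext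
    (λ e → to (bind-just (outer⁻¹ (k ℕ.+ m) l v) e)) (λ e → from (bind-just (outer⁻¹ i m v) e))
    where
    to : ∀ {c} → (∃ λ b → outer⁻¹ (k ℕ.+ m) l v ≡ just b × outer⁻¹ i m b ≡ just c) →
         (outer⁻¹ i m v >>= outer⁻¹ k l) ≡ just c
    to {c} (b , e , e′) = just-bind (outerVertex k l c)
      (outer⁻¹⇐ i m v (≡.trans (outer⁻¹⇒ (k ℕ.+ m) l v e)
        (≡.trans (≡.cong (outerVertex (k ℕ.+ m) l) (outer⁻¹⇒ i m b e′))
          (outer∘outer-par i k m l c i<k))))
      (outer⁻¹⇐ k l (outerVertex k l c) ≡.refl)
    from : ∀ {c} → (∃ λ b → outer⁻¹ i m v ≡ just b × outer⁻¹ k l b ≡ just c) →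
           (outer⁻¹ (k ℕ.+ m) l v >>= outer⁻¹ i m) ≡ just c
    from {c} (b , e , e′) = just-bind (outerVertex i m c)
      (outer⁻¹⇐ (k ℕ.+ m) l v (≡.trans (outer⁻¹⇒ i m v e)
        (≡.trans (≡.cong (outerVertex i m) (outer⁻¹⇒ k l b e′))
          (≡.sym (outer∘outer-par i k m l c i<k)))))
      (outer⁻¹⇐ i m (outerVertex i m c) ≡.refl)

  outer-inner-par : ∀ i k m l → i < k → ∀ v →
    (outer⁻¹ (k ℕ.+ m) l v >>= inner⁻¹ i m) ≡ inner⁻¹ i m v
  outer-inner-par i k m l i<k v = maybe-ext (λ e → to (bind-just (outer⁻¹ (k ℕ.+ m) l v) e)) from
    where
    to : ∀ {c} → (∃ λ b → outer⁻¹ (k ℕ.+ m) l v ≡ just b × inner⁻¹ i m b ≡ just c) →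
         inner⁻¹ i m v ≡ just c
    to {c} (b , e , e′) = inner⁻¹⇐ i m v (≡.trans (outer⁻¹⇒ (k ℕ.+ m) l v e)
      (≡.trans (≡.cong (outerVertex (k ℕ.+ m) l) b≡) (inner∘outer-par i k m l c i<k c≤m))) c≤m
      where
      b≡ = inner⁻¹⇒ i m b e′ .proj₁
      c≤m = inner⁻¹⇒ i m b e′ .proj₂
    from : ∀ {c} → inner⁻¹ i m v ≡ just c → (outer⁻¹ (k ℕ.+ m) l v >>= inner⁻¹ i m) ≡ just c
    from {c} e = just-bind (i ℕ.+ c)
      (outer⁻¹⇐ (k ℕ.+ m) l v (≡.trans v≡ (≡.sym (inner∘outer-par i k m l c i<k c≤m))))
      (inner⁻¹⇐ i m (i ℕ.+ c) ≡.refl c≤m)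
      where
      v≡ = inner⁻¹⇒ i m v e .proj₁
      c≤m = inner⁻¹⇒ i m v e .proj₂

  inner-outer-par : ∀ i k m l → i < k → ∀ v →
    inner⁻¹ (k ℕ.+ m) l v ≡ (outer⁻¹ i m v >>= inner⁻¹ k l)
  inner-outer-par i k m l i<k v = maybe-ext to (λ e → from (bind-just (outer⁻¹ i m v) e))
    where
    to : ∀ {c} → inner⁻¹ (k ℕ.+ m) l v ≡ just c → (outer⁻¹ i m v >>= inner⁻¹ k l) ≡ just c
    to {c} e = just-bind (k ℕ.+ c)
      (outer⁻¹⇐ i m v (≡.trans (inner⁻¹⇒ (k ℕ.+ m) l v e .proj₁) (inner-par i k m c i<k)))
      (inner⁻¹⇐ k l (k ℕ.+ c) ≡.refl (inner⁻¹⇒ (k ℕ.+ m) l v e .proj₂))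
    from : ∀ {c} → (∃ λ b → outer⁻¹ i m v ≡ just b × inner⁻¹ k l b ≡ just c) →
           inner⁻¹ (k ℕ.+ m) l v ≡ just c
    from {c} (b , e , e′) = inner⁻¹⇐ (k ℕ.+ m) l v
      (≡.trans (outer⁻¹⇒ i m v e) (≡.trans (≡.cong (outerVertex i m) (inner⁻¹⇒ k l b e′ .proj₁))
        (≡.sym (inner-par i k m c i<k))))
      (inner⁻¹⇒ k l b e′ .proj₂)

  par-exclusive : ∀ i k m l → i < k → ∀ {x y a b c d} → x < y →
    inner⁻¹ i m x ≡ just a → inner⁻¹ i m y ≡ just b →
    inner⁻¹ (k ℕ.+ m) l x ≡ just c → inner⁻¹ (k ℕ.+ m) l y ≡ just d → a < b → ⊥
  par-exclusive i k m l i<k {x} {y} {a} {b} {c} {d} x<y ea eb ec ed _ = ℕₚ.n≮n y (begin-strict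
    y                  ≡⟨ inner⁻¹⇒ i m y eb .proj₁ ⟩
    i ℕ.+ b            ≤⟨ ℕₚ.+-monoʳ-≤ i (inner⁻¹⇒ i m y eb .proj₂) ⟩
    i ℕ.+ suc m        ≡⟨ ℕₚ.+-suc i m ⟩
    suc i ℕ.+ m        ≤⟨ ℕₚ.+-monoˡ-≤ m i<k ⟩
    k ℕ.+ m            ≤⟨ ℕₚ.m≤m+n (k ℕ.+ m) c ⟩
    (k ℕ.+ m) ℕ.+ c    ≡⟨ inner⁻¹⇒ (k ℕ.+ m) l x ec .proj₁ ⟨
    x                  <⟨ x<y ⟩
    y                  ∎)
    where open ℕₚ.≤-Reasoning

  almost-comm : ∀ {u v w} → v ≈ 𝟙 ⊎ w ≈ 𝟙 → (u ⋆ v) ⋆ w ≈ (u ⋆ w) ⋆ v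
  almost-comm (inj₁ e) = trans (∙-cong (trans (∙-cong refl e) (identityʳ _)) refl)
    (sym (trans (∙-cong refl e) (identityʳ _)))
  almost-comm (inj₂ e) = sym (almost-comm (inj₁ e))

  glue-parallel : ∀ {n m l} (p : Clique n) (q : Clique m) (r : Clique l) (i k : Fin (suc n))
    (i′ : Fin (suc (n ℕ.+ l))) (k′ : Fin (suc (n ℕ.+ m))) → toℕ i < toℕ k →
    toℕ i′ ≡ toℕ i → toℕ k′ ≡ toℕ k ℕ.+ m →
    castᶜ (+ℕ.xy∙z≈xz∙y n m l) (glue (glue p i q) k′ r) ≈ᶜ glue (glue p k r) i′ q
  glue-parallel {n} {m} {l} p q r i k i′ k′ i<k i′≡ k′≡ = ⟦⟧-injective λ x y x<y _ → begin
    ⟦ castᶜ (+ℕ.xy∙z≈xz∙y n m l) (glue (glue p i q) k′ r) ⟧ x y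
      ≡⟨ ⟦castᶜ⟧ (+ℕ.xy∙z≈xz∙y n m l) (glue (glue p i q) k′ r) x y ⟩
    ⟦ glue (glue p i q) k′ r ⟧ x y
      ≈⟨ nested-glue p i q k′ r x y ⟩
    (pull (λ v → outer⁻¹ (toℕ k′) l v >>= outer⁻¹ ι m) ⟦ p ⟧ x y ⋆
     pull (λ v → outer⁻¹ (toℕ k′) l v >>= inner⁻¹ ι m) ⟦ q ⟧ x y) ⋆
    pull (inner⁻¹ (toℕ k′) l) ⟦ r ⟧ x y
      ≈⟨ ∙-cong (∙-cong
           (pull-≗ ⟦ p ⟧ (λ v → ≡.trans (≡.cong (λ z → outer⁻¹ z l v >>= outer⁻¹ ι m) k′≡)
             (≡.trans (outer-outer-par ι κ m l i<k v)
               (≡.cong (λ z → outer⁻¹ z m v >>= outer⁻¹ κ l) (≡.sym i′≡)))) x y)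
           (pull-≗ ⟦ q ⟧ (λ v → ≡.trans (≡.cong (λ z → outer⁻¹ z l v >>= inner⁻¹ ι m) k′≡)
             (outer-inner-par ι κ m l i<k v)) x y))
           (pull-≗ ⟦ r ⟧ (λ v → ≡.cong (λ z → inner⁻¹ z l v) k′≡) x y) ⟩
    (P x y ⋆ pull (inner⁻¹ ι m) ⟦ q ⟧ x y) ⋆ pull (inner⁻¹ (κ ℕ.+ m) l) ⟦ r ⟧ x y
      ≈⟨ almost-comm (exclusive (inner⁻¹ ι m) (inner⁻¹ (κ ℕ.+ m) l) q r x y
           (par-exclusive ι κ m l i<k x<y)) ⟩
    (P x y ⋆ pull (inner⁻¹ (κ ℕ.+ m) l) ⟦ r ⟧ x y) ⋆ pull (inner⁻¹ ι m) ⟦ q ⟧ x y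
      ≈⟨ ∙-cong (∙-cong refl
           (pull-≗ ⟦ r ⟧ (λ v → ≡.trans (inner-outer-par ι κ m l i<k v)
             (≡.cong (λ z → outer⁻¹ z m v >>= inner⁻¹ κ l) (≡.sym i′≡))) x y))
           (pull-≗ ⟦ q ⟧ (λ v → ≡.cong (λ z → inner⁻¹ z m v) (≡.sym i′≡)) x y) ⟩
    (P x y ⋆ pull (λ v → outer⁻¹ (toℕ i′) m v >>= inner⁻¹ κ l) ⟦ r ⟧ x y) ⋆
    pull (inner⁻¹ (toℕ i′) m) ⟦ q ⟧ x y
      ≈⟨ nested-glue p k r i′ q x y ⟨
    ⟦ glue (glue p k r) i′ q ⟧ x y ∎
    where
    open SetoidReasoning setoid
    ι = toℕ i
    κ = toℕ k
    P : ℕ → ℕ → Carrier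
    P = pull (λ v → outer⁻¹ (toℕ i′) m v >>= outer⁻¹ κ l) ⟦ p ⟧

  module _ {r ℓr} (R : CommutativeRing r ℓr) where
    open FreeModule R
    private
      module R = CommutativeRing R

      C : ℕ → Module R (r ⊔ a ⊔ ℓ) (r ⊔ ℓr ⊔ a ⊔ ℓ)
      C n = freeModule (cliques n)

      module C n = Module (C n)

      Op : ℕ → Set (r ⊔ a ⊔ ℓ)
      Op n = Combination (Clique n)

      glueLinear : ∀ n m → Op n → Fin (suc n) → Op m → Op (n ℕ.+ m)
      glueLinear n m s i t =
        extend (C (n ℕ.+ m)) (λ p → extend (C (n ℕ.+ m)) (λ q → gen (glue p i q)) t) s

      inner-linear : ∀ n m i (p : Clique n) → IsLinear (C m) (C (n ℕ.+ m))
                     (extend (C (n ℕ.+ m)) (λ q → gen (glue p i q)))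
      inner-linear n m i p = extend-isLinear (cliques m) (C (n ℕ.+ m))
        (λ e → gen-cong (glue-cong i (mk λ _ → refl) e))

      linearʳ : ∀ n m s i → IsLinear (C m) (C (n ℕ.+ m)) (glueLinear n m s i)
      linearʳ n m s i = extend-pointwise (C (n ℕ.+ m)) (C m)
        (λ p → extend (C (n ℕ.+ m)) (λ q → gen (glue p i q))) (inner-linear n m i) s

      linearˡ : ∀ n m i t → IsLinear (C n) (C (n ℕ.+ m)) (λ s → glueLinear n m s i t)
      linearˡ n m i t = extend-isLinear (cliques n) (C (n ℕ.+ m)) λ e →
        extend-ext (C (n ℕ.+ m)) (λ q → gen-cong (glue-cong i e (mk λ _ → refl))) t

      cast : ∀ {n n′} → n ≡ n′ → Op n → Op n′
      cast = subst Op

      cast-linear : ∀ {n n′} (e : n ≡ n′) → IsLinear (C n) (C n′) (cast e)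
      cast-linear ≡.refl = isLinear id (λ _ _ → ≋-refl) (λ _ _ → ≋-refl)

      cast-gen : ∀ {n n′} (e : n ≡ n′) p → C._≈ᴹ_ n′ (cast e (gen p)) (gen (castᶜ e p))
      cast-gen ≡.refl p = ≋-refl

      id-linear : ∀ n → IsLinear (C n) (C n) id
      id-linear n = isLinear id (λ _ _ → ≋-refl) (λ _ _ → ≋-refl)

      glueLinear-identityʳ : ∀ n s i →
        C._≈ᴹ_ n (cast (ℕₚ.+-identityʳ n) (glueLinear n 0 s i (gen 𝐮))) s
      glueLinear-identityʳ n s i = linear-unique (cliques n) (C n)
        (∘-isLinear (C n) (C (n ℕ.+ 0)) (C n) (linearˡ n 0 i (gen 𝐮)) (cast-linear e)) (id-linear n)
        (λ p → ≋-trans (cast-gen e (glue p i 𝐮)) (gen-cong (glue-identityʳ p i))) s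
        where e = ℕₚ.+-identityʳ n

      -- It suffices to check a trilinear identity on basis elements.
      trilinear-unique : ∀ n m l k (f g : Op n → Op m → Op l → Op k) →
        (∀ y z → IsLinear (C n) (C k) (λ x → f x y z)) → (∀ y z → IsLinear (C n) (C k) (λ x → g x y z)) →
        (∀ x z → IsLinear (C m) (C k) (λ y → f x y z)) → (∀ x z → IsLinear (C m) (C k) (λ y → g x y z)) →
        (∀ x y → IsLinear (C l) (C k) (f x y)) → (∀ x y → IsLinear (C l) (C k) (g x y)) →
        (∀ p q r → C._≈ᴹ_ k (f (gen p) (gen q) (gen r)) (g (gen p) (gen q) (gen r))) →
        ∀ x y z → C._≈ᴹ_ k (f x y z) (g x y z)
      trilinear-unique n m l k f g f₁ g₁ f₂ g₂ f₃ g₃ e x y z =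
        linear-unique (cliques n) (C k) (f₁ y z) (g₁ y z) (λ p →
          linear-unique (cliques m) (C k) (f₂ (gen p) z) (g₂ (gen p) z) (λ q →
            linear-unique (cliques l) (C k) (f₃ (gen p) (gen q)) (g₃ (gen p) (gen q)) (e p q) z) y) x

      module Nested {n m l k : ℕ} (e : (n ℕ.+ m) ℕ.+ l ≡ k) (i : Fin (suc n)) (j : Fin (suc (n ℕ.+ m))) where
        nested : Op n → Op m → Op l → Op k
        nested x y z = cast e (glueLinear (n ℕ.+ m) l (glueLinear n m x i y) j z)

        nested₁ : ∀ y z → IsLinear (C n) (C k) (λ x → nested x y z)
        nested₁ y z = ∘-isLinear (C n) (C (n ℕ.+ m ℕ.+ l)) (C k)
          (∘-isLinear (C n) (C (n ℕ.+ m)) (C (n ℕ.+ m ℕ.+ l)) (linearˡ n m i y) (linearˡ (n ℕ.+ m) l j z))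
          (cast-linear e)

        nested₂ : ∀ x z → IsLinear (C m) (C k) (λ y → nested x y z)
        nested₂ x z = ∘-isLinear (C m) (C (n ℕ.+ m ℕ.+ l)) (C k)
          (∘-isLinear (C m) (C (n ℕ.+ m)) (C (n ℕ.+ m ℕ.+ l)) (linearʳ n m x i) (linearˡ (n ℕ.+ m) l j z))
          (cast-linear e)

        nested₃ : ∀ x y → IsLinear (C l) (C k) (nested x y)
        nested₃ x y = ∘-isLinear (C l) (C (n ℕ.+ m ℕ.+ l)) (C k)
          (linearʳ (n ℕ.+ m) l (glueLinear n m x i y) j) (cast-linear e)

      glueLinear-sequential : ∀ n m l x y z (i : Fin (suc n)) (j : Fin (suc m)) (k : Fin (suc (n ℕ.+ m))) →
        toℕ k ≡ toℕ i ℕ.+ toℕ j →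
        C._≈ᴹ_ (n ℕ.+ (m ℕ.+ l))
          (cast (ℕₚ.+-assoc n m l) (glueLinear (n ℕ.+ m) l (glueLinear n m x i y) k z))
          (glueLinear n (m ℕ.+ l) x i (glueLinear m l y j z))
      glueLinear-sequential n m l x y z i j k k≡ = trilinear-unique n m l N
        nested (λ x y z → glueLinear n (m ℕ.+ l) x i (glueLinear m l y j z))
        nested₁ (λ y z → linearˡ n (m ℕ.+ l) i (glueLinear m l y j z))
        nested₂ (λ x z → ∘-isLinear (C m) (C (m ℕ.+ l)) (C N) (linearˡ m l j z) (linearʳ n (m ℕ.+ l) x i))
        nested₃ (λ x y → ∘-isLinear (C l) (C (m ℕ.+ l)) (C N) (linearʳ m l y j) (linearʳ n (m ℕ.+ l) x i))
        (λ p q r → ≋-trans (cast-gen e (glue (glue p i q) k r))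
          (gen-cong (glue-sequential p q r i j k k≡)))
        x y z
        where
        N = n ℕ.+ (m ℕ.+ l)
        e = ℕₚ.+-assoc n m l
        open Nested {n} {m} {l} e i k

      glueLinear-parallel : ∀ n m l x y z (i k : Fin (suc n))
        (i′ : Fin (suc (n ℕ.+ l))) (k′ : Fin (suc (n ℕ.+ m))) → toℕ i < toℕ k →
        toℕ i′ ≡ toℕ i → toℕ k′ ≡ toℕ k ℕ.+ m →
        C._≈ᴹ_ ((n ℕ.+ l) ℕ.+ m)
          (cast (+ℕ.xy∙z≈xz∙y n m l) (glueLinear (n ℕ.+ m) l (glueLinear n m x i y) k′ z))
          (glueLinear (n ℕ.+ l) m (glueLinear n l x k z) i′ y)
      glueLinear-parallel n m l x y z i k i′ k′ i<k i′≡ k′≡ = trilinear-unique n m l N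
        nested (λ x y z → glueLinear (n ℕ.+ l) m (glueLinear n l x k z) i′ y)
        nested₁ (λ y z → ∘-isLinear (C n) (C (n ℕ.+ l)) (C N) (linearˡ n l k z) (linearˡ (n ℕ.+ l) m i′ y))
        nested₂ (λ x z → linearʳ (n ℕ.+ l) m (glueLinear n l x k z) i′)
        nested₃ (λ x y → ∘-isLinear (C l) (C (n ℕ.+ l)) (C N) (linearʳ n l x k) (linearˡ (n ℕ.+ l) m i′ y))
        (λ p q r → ≋-trans (cast-gen e (glue (glue p i q) k′ r))
          (gen-cong (glue-parallel p q r i k i′ k′ i<k i′≡ k′≡)))
        x y z
        where
        N = (n ℕ.+ l) ℕ.+ m
        e = +ℕ.xy∙z≈xz∙y n m l
        open Nested {n} {m} {l} e i k′

    operad : Operad R (r ⊔ a ⊔ ℓ) (r ⊔ ℓr ⊔ a ⊔ ℓ)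
    operad = record
      { component  = C
      ; unit       = gen 𝐮
      ; comp       = glueLinear
      ; comp-cong  = λ n m {x} {x′} {y} {y′} i e e′ → ≋-trans
          (IsLinear.cong (linearˡ n m i y) e) (IsLinear.cong (linearʳ n m x′ i) e′)
      ; comp-+ˡ    = λ n m x x′ i y → IsLinear.+-homo (linearˡ n m i y) x x′
      ; comp-+ʳ    = λ n m x i → IsLinear.+-homo (linearʳ n m x i)
      ; comp-*ˡ    = λ n m b x i y → IsLinear.*-homo (linearˡ n m i y) b x
      ; comp-*ʳ    = λ n m b x i → IsLinear.*-homo (linearʳ n m x i) b
      ; identityˡ  = λ m → linear-unique (cliques m) (C m) (linearʳ 0 m (gen 𝐮) zero) (id-linear m)
          (λ q → gen-cong (glue-identityˡ q))
      ; identityʳ  = glueLinear-identityʳ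
      ; sequential = glueLinear-sequential
      ; parallel   = glueLinear-parallel
      }

module _ {a ℓ} (M : UnitalMagma a ℓ) where
  private module M = UnitalMagma M

  IsRankFunction : (M.Carrier → ℤ) → Set (a ⊔ ℓ)
  IsRankFunction = MonoidMorphisms.IsMonoidHomomorphism rawMonoid ℤ.+-0-rawMonoid
    where
    rawMonoid : RawMonoid a ℓ
    rawMonoid = record { _≈_ = M._≈_ ; _∙_ = M._∙_ ; ε = M.ε }

module _ {c ℓ₁ ℓ₂} (K : HeytingField c ℓ₁ ℓ₂) where
  open HeytingFieldProperties K
  open RationalFunctions commutativeRing isDomain hiding (operad)
  open FreeModule commutativeRing using (Combination; extend)

  linearForm : ∀ {n} → Arc n → RationalFunction n
  linearForm {n} (arc x y _ _) = Frac.embed n (interval n x y)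

  linearForm-≉0 : ∀ {n} (α : Arc n) → ¬ Rat._≈_ n (linearForm α) (Rat.0# n)
  linearForm-≉0 {n} (arc x y x<y y≤n) = Frac.embed-≉0 n
    (interval-≉0 isDomain n (recompute (x <? y) x<y) (recompute (y ≤? n) y≤n))

  RatFct : Operad commutativeRing (c ⊔ ℓ₁) ℓ₁
  RatFct = RationalFunctions.operad commutativeRing isDomain

  module _ {a ℓ} (M : UnitalMagma a ℓ) where
    open Cliques M hiding (operad)
    private module M = UnitalMagma M

    C : Operad commutativeRing (c ⊔ a ⊔ ℓ) (c ⊔ ℓ₁ ⊔ a ⊔ ℓ)
    C = Cliques.operad M commutativeRing

    module _ (θ : M.Carrier → ℤ) where

      -- (u_x + … + u_{y-1}) ^ θ(p(x , y))
      arcFactor : ∀ {n} → Clique n → Arc (suc n) → RationalFunction (suc n)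
      arcFactor {n} p α = power (linearForm α) (linearForm-≉0 α) (θ (label p α))
        where open Frac (suc n) using (power)

      pairFactor : ∀ {n} → Clique n → (x y : Fin (suc (suc n))) → RationalFunction (suc n)
      pairFactor {n} p x y with toℕ x <? toℕ y
      ... | yes x<y = arcFactor p (arc (toℕ x) (toℕ y) x<y (s≤s⁻¹ (toℕ<n y)))
      ... | no  _   = Rat.1# (suc n)

      F-clique : ∀ {n} → Clique n → RationalFunction (suc n)
      F-clique {n} p = product λ x → product λ y → pairFactor p x y
        where open Sums (Rat.*-commutativeMonoid (suc n)) using () renaming (sum to product)

      F : ∀ n → Combination (Clique n) → RationalFunction (suc n)
      F n = extend (rationalFunctions (suc n)) F-clique

{-# OPTIONS --safe #-}
module Submission where

-- The image of a clique p is a product, over all pairs of vertices x < y, of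
-- the linear form u_x + … + u_{y-1} raised to the power θ(p(x , y)).  Two facts
-- make this product compatible with partial composition.
--
-- On labels: a composite p ∘ᵢ q assigns to each pair of vertices the product
-- P ⋆ Q, where P is the label of the pair in p, or the unit if the pair does
-- not come from p, and Q is likewise its label in q (glue-spec).  The arc along
-- which the polygons are glued is the only one where both factors matter.  As
-- θ turns ⋆ into a sum and the unit into 0, the power laws split the image of
-- p ∘ᵢ q into the product of the forms to the powers θ(P) and of the forms to
-- the powers θ(Q) (power-+, weightedProduct-+).
--
-- On forms: each of the two substitutions in the composition of rational
-- functions comes from an increasing map f on vertices and sends the form of
-- the pair (x , y) to the form of (f x , f y).  Pairs outside the image of f
-- have exponent 0, so reindexing along f identifies the product of the forms
-- to the powers θ(P) with the image of p after the outer substitution, and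
-- similarly for q and the inner one (weightedProduct-[], pull-weight-[]).
--
-- This settles composition on basis elements (F-clique-glue).  Bilinearity of
-- both compositions extends it to all combinations (F-comp).

open import Defs
open import Algebra.Apartness.Bundles using (HeytingField)
open import Algebra.Bundles using (AbelianGroup; CommutativeMonoid; CommutativeRing; UnitalMagma)
import Algebra.Module.Morphism.Structures as ModuleMorphisms
open import Algebra.Module.Bundles using (Module)
open import Algebra.Morphism.Structures using (module MonoidMorphisms)
import Algebra.Properties.CommutativeMonoid.Sum as Sums
import Algebra.Properties.CommutativeSemigroup as CommutativeSemigroupProperties
import Algebra.Properties.Group as GroupProperties
import Algebra.Properties.Semiring.Exp as Exponentiation
open import Data.Empty using (⊥-elim)
open import Data.Fin.Base using (Fin; zero; suc; toℕ; fromℕ<; punchIn; punchOut)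
open import Data.Fin.Properties
  using (0≢1+n; punchIn-injective; punchIn-punchOut; punchInᵢ≢i; punchOut-injective;
         toℕ-fromℕ<; toℕ-injective; toℕ<n)
open import Data.Integer.Base as ℤ using (ℤ; +_; -[1+_]; _⊖_)
open import Data.Integer.Properties using ([1+m]⊖[1+n]≡m⊖n)
open import Data.Maybe.Base using (Maybe; just)
open import Data.Nat.Base as ℕ using (ℕ; zero; suc; _≤_; _<_; s≤s; s≤s⁻¹)
open import Data.Nat.Properties as ℕₚ using (_≤?_; _<?_)
open import Data.Product.Base using (_,_; proj₁)
open import Function.Base using (_∘_)
open import Relation.Binary.Definitions using (tri<; tri≈; tri>)
open import Relation.Binary.PropositionalEquality as ≡ using (_≡_; _≢_)
import Relation.Binary.Reasoning.Setoid as SetoidReasoning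
open import Relation.Nullary using (¬_; yes; no)
open import Relation.Nullary.Decidable using (recompute)

-- Sums over finite sets, in a commutative monoid

module SumProperties {a ℓ} (M : CommutativeMonoid a ℓ) where
  open CommutativeMonoid M
  open Sums M using (sum; sum-remove; sum-cong-≋; sum-replicate-zero; ∑-distrib-+)
  open SetoidReasoning setoid

  sum-trivial : ∀ {n} {h : Fin n → Carrier} → (∀ x → h x ≈ ε) → sum h ≈ ε
  sum-trivial {n} e = trans (sum-cong-≋ e) (sum-replicate-zero n)

  -- A family that is trivial off the image of an injection has the same sum
  -- as its restriction along the injection.
  sum-reindex : ∀ {m n} (f : Fin m → Fin n) → (∀ {i j} → f i ≡ f j → i ≡ j) →
                (h : Fin n → Carrier) → (∀ x → (∀ i → f i ≢ x) → h x ≈ ε) →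
                sum h ≈ sum (h ∘ f)
  sum-reindex {zero}          f inj h off = sum-trivial λ x → off x λ ()
  sum-reindex {suc m} {zero}  f inj h off with () ← f zero
  sum-reindex {suc m} {suc n} f inj h off = begin
    sum h                             ≈⟨ sum-remove {i = f zero} h ⟩
    h (f zero) ∙ sum (h ∘ skip)       ≈⟨ ∙-congˡ (sum-reindex g g-injective (h ∘ skip) g-off) ⟩
    h (f zero) ∙ sum (h ∘ skip ∘ g)   ≈⟨ ∙-congˡ (sum-cong-≋ λ i → reflexive (≡.cong h (skip∘g i))) ⟩
    sum (h ∘ f)                       ∎
    where
    -- skip enumerates the indices other than f zero, and g is f ∘ suc read
    -- through this enumeration.
    skip = punchIn (f zero)
    f0≢ : ∀ i → f zero ≢ f (suc i)
    f0≢ i e = 0≢1+n (inj e)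
    g : Fin m → Fin n
    g i = punchOut (f0≢ i)
    skip∘g : ∀ i → skip (g i) ≡ f (suc i)
    skip∘g i = punchIn-punchOut (f0≢ i)
    g-injective : ∀ {i j} → g i ≡ g j → i ≡ j
    g-injective {i} {j} e with ≡.refl ← inj (punchOut-injective (f0≢ i) (f0≢ j) e) = ≡.refl
    g-off : ∀ x → (∀ i → g i ≢ x) → h (skip x) ≈ ε
    g-off x ∉g = off (skip x) λ where
      zero    e → punchInᵢ≢i (f zero) x (≡.sym e)
      (suc i) e → ∉g i (punchIn-injective (f zero) (g i) x (≡.trans (skip∘g i) e))

  doubleSum : ∀ {m n} → (Fin m → Fin n → Carrier) → Carrier
  doubleSum h = sum λ x → sum (h x)

  doubleSum-cong : ∀ {m n} (h k : Fin m → Fin n → Carrier) → (∀ x y → h x y ≈ k x y) →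
                   doubleSum h ≈ doubleSum k
  doubleSum-cong h k e = sum-cong-≋ λ x → sum-cong-≋ (e x)

  doubleSum-trivial : ∀ {m n} (h : Fin m → Fin n → Carrier) → (∀ x y → h x y ≈ ε) → doubleSum h ≈ ε
  doubleSum-trivial h e = sum-trivial λ x → sum-trivial (e x)

  doubleSum-∙ : ∀ {m n} (h k : Fin m → Fin n → Carrier) →
                doubleSum (λ x y → h x y ∙ k x y) ≈ doubleSum h ∙ doubleSum k
  doubleSum-∙ h k = trans (sum-cong-≋ λ x → ∑-distrib-+ (h x) (k x))
    (∑-distrib-+ (λ x → sum (h x)) (λ x → sum (k x)))

  doubleSum-reindex : ∀ {m n} (f : Fin m → Fin n) → (∀ {i j} → f i ≡ f j → i ≡ j) →
    (h : Fin n → Fin n → Carrier) →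
    (∀ x y → (∀ i → f i ≢ x) → h x y ≈ ε) → (∀ x y → (∀ i → f i ≢ y) → h x y ≈ ε) →
    doubleSum h ≈ doubleSum (λ i j → h (f i) (f j))
  doubleSum-reindex f inj h offˡ offʳ = trans
    (sum-reindex f inj (λ x → sum (h x)) (λ x ∉f → sum-trivial λ y → offˡ x y ∉f))
    (sum-cong-≋ λ i → sum-reindex f inj (h (f i)) (λ y → offʳ (f i) y))

module _ {a ℓa b ℓb} (M : CommutativeMonoid a ℓa) (N : CommutativeMonoid b ℓb) where
  private
    module M = CommutativeMonoid M
    module N = CommutativeMonoid N
    open Sums M using () renaming (sum to sumᴹ)
    open Sums N using () renaming (sum to sumᴺ; sum-cong-≋ to sumᴺ-cong)
    open SumProperties M using () renaming (doubleSum to doubleSumᴹ)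
    open SumProperties N using () renaming (doubleSum to doubleSumᴺ)

  module _ (φ : M.Carrier → N.Carrier) (φ-ε : φ M.ε N.≈ N.ε)
           (φ-∙ : ∀ x y → φ (x M.∙ y) N.≈ φ x N.∙ φ y) where

    monoidSum-homo : ∀ {n} (h : Fin n → M.Carrier) → φ (sumᴹ h) N.≈ sumᴺ (φ ∘ h)
    monoidSum-homo {zero}  h = φ-ε
    monoidSum-homo {suc n} h = N.trans (φ-∙ _ _) (N.∙-congˡ (monoidSum-homo (h ∘ suc)))

    monoidDoubleSum-homo : ∀ {m n} (h : Fin m → Fin n → M.Carrier) →
                           φ (doubleSumᴹ h) N.≈ doubleSumᴺ (λ x y → φ (h x y))
    monoidDoubleSum-homo h = N.trans (monoidSum-homo (λ x → sumᴹ (h x)))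
      (sumᴺ-cong λ x → monoidSum-homo (h x))

-- Integer powers of fractions

module PowerProperties {c ℓ} (R : CommutativeRing c ℓ) (dom : IsDomain R) where
  private module R = CommutativeRing R
  open FieldOfFractions R dom
  open CommutativeRing commutativeRing
  open Exponentiation semiring
  open CommutativeSemigroupProperties *-commutativeSemigroup using (interchange)
  open SetoidReasoning setoid

  inverse-cong : ∀ {f g} f≉0 g≉0 → f ≈ g → inverse f f≉0 ≈ inverse g g≉0
  inverse-cong _ _ (mk e) = mk (R.trans (R.*-comm _ _) (R.trans (R.sym e) (R.*-comm _ _)))

  power-cong : ∀ {f g} f≉0 g≉0 → f ≈ g → ∀ k → power f f≉0 k ≈ power g g≉0 k
  power-cong f≉0 g≉0 e (+ n)    = ^-congˡ n e
  power-cong f≉0 g≉0 e -[1+ n ] = ^-congˡ (suc n) (inverse-cong f≉0 g≉0 e)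

  module _ (f : Fraction) (f≉0 : ¬ f ≈ 0#) where
    private
      f⁻¹ = inverse f f≉0

    power-⊖ : ∀ m n → power f f≉0 (m ⊖ n) ≈ f ^ m * f⁻¹ ^ n
    power-⊖ m       zero    = sym (*-identityʳ _)
    power-⊖ zero    (suc n) = sym (*-identityˡ _)
    power-⊖ (suc m) (suc n) = begin
      power f f≉0 (suc m ⊖ suc n)     ≡⟨ ≡.cong (power f f≉0) ([1+m]⊖[1+n]≡m⊖n m n) ⟩
      power f f≉0 (m ⊖ n)             ≈⟨ power-⊖ m n ⟩
      f ^ m * f⁻¹ ^ n                 ≈⟨ *-identityˡ _ ⟨
      1# * (f ^ m * f⁻¹ ^ n)          ≈⟨ *-congʳ (inverseʳ f f≉0) ⟨
      (f * f⁻¹) * (f ^ m * f⁻¹ ^ n)   ≈⟨ interchange f f⁻¹ (f ^ m) (f⁻¹ ^ n) ⟩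
      f ^ suc m * f⁻¹ ^ suc n         ∎

    power-+ : ∀ k l → power f f≉0 (k ℤ.+ l) ≈ power f f≉0 k * power f f≉0 l
    power-+ (+ m)    (+ n)    = ^-homo-* f m n
    power-+ (+ m)    -[1+ n ] = power-⊖ m (suc n)
    power-+ -[1+ m ] (+ n)    = trans (power-⊖ n (suc m)) (*-comm _ _)
    power-+ -[1+ m ] -[1+ n ] = begin
      f⁻¹ ^ suc (suc (m ℕ.+ n))  ≡⟨ ≡.cong (λ k → f⁻¹ ^ suc k) (ℕₚ.+-suc m n) ⟨
      f⁻¹ ^ (suc m ℕ.+ suc n)    ≈⟨ ^-homo-* f⁻¹ (suc m) (suc n) ⟩
      f⁻¹ ^ suc m * f⁻¹ ^ suc n  ∎

-- Products of powers of interval forms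

module WeightedProducts {c ℓ} (R : CommutativeRing c ℓ) (dom : IsDomain R) where
  open RationalFunctions R dom
  private
    module Power n = PowerProperties (polynomialRing R n) (poly-isDomain n)
    module Prod n = SumProperties (Rat.*-commutativeMonoid n)
    module Exp n = Exponentiation (Rat.semiring n)

  -- u_x + … + u_{y-1}, the variables being numbered from 0
  intervalForm : ∀ n → ℕ → ℕ → RationalFunction n
  intervalForm n x y = Frac.embed n (interval n x y)

  intervalForm-≉0 : ∀ n {x y} → .(x < y) → .(y ≤ n) → ¬ Rat._≈_ n (intervalForm n x y) (Rat.0# n)
  intervalForm-≉0 n {x} {y} x<y y≤n = Frac.embed-≉0 n
    (interval-≉0 dom n (recompute (x <? y) x<y) (recompute (y ≤? n) y≤n))

  module _ {a b} (s : Substitution a b) where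
    private
      module B = Rat b
      open IsRingHomProperties (Frac.commutativeRing a) (Frac.commutativeRing b) ([]-isRingHom s)

    ^-[] : ∀ f n → (Exp._^_ a f n [ s ]) B.≈ Exp._^_ b (f [ s ]) n
    ^-[] f zero    = 1#-homo
    ^-[] f (suc n) = B.trans (*-homo f _) (B.*-congˡ (^-[] f n))

    power-[] : ∀ f f≉0 {g} g≉0 → (f [ s ]) B.≈ g →
               ∀ k → (Frac.power a f f≉0 k [ s ]) B.≈ Frac.power b g g≉0 k
    power-[] f f≉0 g≉0 e (+ n)    = B.trans (^-[] f n) (Exp.^-congˡ b n e)
    -- The inverse swaps numerator and denominator, so its case reads the cross
    -- product e with the two sides exchanged.
    power-[] f f≉0 g≉0 (FieldOfFractions.mk e) -[1+ n ] = B.trans (^-[] (Frac.inverse a f f≉0) (suc n))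
      (Exp.^-congˡ b (suc n) (FieldOfFractions.mk
        (P.trans (P.*-comm _ _) (P.trans (P.sym e) (P.*-comm _ _)))))
      where module P = CommutativeRing (polynomialRing R b)

  -- The interval form of (x , y) to the power k, for x < y ≤ n.  It is 1 on
  -- the other pairs, so that products can range over all pairs of vertices.
  intervalPower : ∀ n → ℕ → ℕ → ℤ → RationalFunction n
  intervalPower n x y k with x <? y | y ≤? n
  ... | yes x<y | yes y≤n = Frac.power n (intervalForm n x y) (intervalForm-≉0 n x<y y≤n) k
  ... | yes _   | no  _   = Rat.1# n
  ... | no  _   | _       = Rat.1# n

  intervalPower-0 : ∀ n x y → Rat._≈_ n (intervalPower n x y (+ 0)) (Rat.1# n)
  intervalPower-0 n x y with x <? y | y ≤? n
  ... | yes _ | yes _ = Rat.refl n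
  ... | yes _ | no  _ = Rat.refl n
  ... | no  _ | _     = Rat.refl n

  intervalPower-+ : ∀ n x y k l → Rat._≈_ n (intervalPower n x y (k ℤ.+ l))
                    (Rat._*_ n (intervalPower n x y k) (intervalPower n x y l))
  intervalPower-+ n x y k l with x <? y | y ≤? n
  ... | yes x<y | yes y≤n = Power.power-+ n (intervalForm n x y) (intervalForm-≉0 n x<y y≤n) k l
  ... | yes _   | no  _   = Rat.sym n (Rat.*-identityˡ n _)
  ... | no  _   | _       = Rat.sym n (Rat.*-identityˡ n _)

  -- The factor of weightedProduct at a pair of vertices
  arcTerm : ∀ n → (ℕ → ℕ → ℤ) → Fin (suc n) → Fin (suc n) → RationalFunction n
  arcTerm n w x y = intervalPower n (toℕ x) (toℕ y) (w (toℕ x) (toℕ y))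

  -- The product over all arcs (x , y) of the polygon with vertices 0, …, n of
  -- the interval form of (x , y) to the power w x y
  weightedProduct : ∀ n → (ℕ → ℕ → ℤ) → RationalFunction n
  weightedProduct n w = Prod.doubleSum n (arcTerm n w)

  weightedProduct-cong : ∀ n {w w′} → (∀ x y → w x y ≡ w′ x y) →
                         Rat._≈_ n (weightedProduct n w) (weightedProduct n w′)
  weightedProduct-cong n {w} {w′} e = Prod.doubleSum-cong n (arcTerm n w) (arcTerm n w′) λ x y →
    Rat.reflexive n (≡.cong (intervalPower n (toℕ x) (toℕ y)) (e (toℕ x) (toℕ y)))

  weightedProduct-0 : ∀ n → Rat._≈_ n (weightedProduct n λ _ _ → + 0) (Rat.1# n)
  weightedProduct-0 n = Prod.doubleSum-trivial n (arcTerm n λ _ _ → + 0) λ x y →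
    intervalPower-0 n (toℕ x) (toℕ y)

  weightedProduct-+ : ∀ n w w′ → Rat._≈_ n (weightedProduct n λ x y → w x y ℤ.+ w′ x y)
                      (Rat._*_ n (weightedProduct n w) (weightedProduct n w′))
  weightedProduct-+ n w w′ = Rat.trans n
    (Prod.doubleSum-cong n (arcTerm n λ x y → w x y ℤ.+ w′ x y)
      (λ x y → Rat._*_ n (arcTerm n w x y) (arcTerm n w′ x y))
      (λ x y → intervalPower-+ n (toℕ x) (toℕ y) _ _))
    (Prod.doubleSum-∙ n (arcTerm n w) (arcTerm n w′))

  -- The substitution s is induced by f, which embeds the vertices 0, …, a
  -- into 0, …, b increasingly.
  record VertexEmbedding {a b} (s : Substitution a b) (f : ℕ → ℕ) : Set ℓ where
    field
      moving     : Moves b (image s) f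
      increasing : ∀ {x y} → x < y → f x < f y
      within     : ∀ {x} → x ≤ a → f x ≤ b

    injective : ∀ {x y} → f x ≡ f y → x ≡ y
    injective {x} {y} e with ℕₚ.<-cmp x y
    ... | tri< x<y _ _ = ⊥-elim (ℕₚ.<⇒≢ (increasing x<y) e)
    ... | tri≈ _ x≡y _ = x≡y
    ... | tri> _ _ y<x = ⊥-elim (ℕₚ.<⇒≢ (increasing y<x) (≡.sym e))

    reflecting : ∀ {x y} → f x < f y → x < y
    reflecting {x} {y} fx<fy with ℕₚ.<-cmp x y
    ... | tri< x<y _ _ = x<y
    ... | tri≈ _ x≡y _ = ⊥-elim (ℕₚ.<⇒≢ fx<fy (≡.cong f x≡y))
    ... | tri> _ _ y<x = ⊥-elim (ℕₚ.<-asym fx<fy (increasing y<x))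

    intervalPower-[] : ∀ {x y} → y ≤ a → ∀ k →
      Rat._≈_ b (intervalPower b (f x) (f y) k) (intervalPower a x y k [ s ])
    intervalPower-[] {x} {y} y≤a k with x <? y | y ≤? a | f x <? f y | f y ≤? b
    ... | yes x<y | yes y≤ | yes fx<fy | yes fy≤ = Rat.sym b
      (power-[] s (intervalForm a x y) (intervalForm-≉0 a x<y y≤) (intervalForm-≉0 b fx<fy fy≤)
        (Frac.≈ᶠ-from-parts b
          (moves-interval b (image s) moving (ℕₚ.<⇒≤ x<y) y≤ (ℕₚ.<⇒≤ fx<fy)) 1#-homo) k)
      where open IsRingHomProperties (polynomialRing R a) (polynomialRing R b)
                   (substitute-isRingHom b (image s)) using (1#-homo)
    ... | yes x<y | yes y≤ | yes fx<fy | no  fy≰ = ⊥-elim (fy≰ (within y≤))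
    ... | yes x<y | yes y≤ | no  fx≮fy | _       = ⊥-elim (fx≮fy (increasing x<y))
    ... | yes x<y | no  y≰ | _         | _       = ⊥-elim (y≰ y≤a)
    ... | no  x≮y | _      | yes fx<fy | _       = ⊥-elim (x≮y (reflecting fx<fy))
    ... | no  _   | _      | no  _     | _       = Rat.sym b 1#-homo
      where open IsRingHomProperties (Frac.commutativeRing a) (Frac.commutativeRing b)
                   ([]-isRingHom s) using (1#-homo)

    -- Substitution pushes the weights w forward along f, extended by 0 to the
    -- pairs outside the image of f; w′ is this extension.
    weightedProduct-[] : ∀ w w′ →
      (∀ {x y} → x ≤ a → y ≤ a → w′ (f x) (f y) ≡ w x y) →
      (∀ {x y} → (∀ {v} → v ≤ a → f v ≢ x) → w′ x y ≡ + 0) →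
      (∀ {x y} → (∀ {v} → v ≤ a → f v ≢ y) → w′ x y ≡ + 0) →
      Rat._≈_ b (weightedProduct b w′) (weightedProduct a w [ s ])
    weightedProduct-[] w w′ on offˡ offʳ = begin
      weightedProduct b w′
        ≈⟨ Prod.doubleSum-reindex b g g-injective (arcTerm b w′)
             (λ x y ∉g → zeroWeight x y (offˡ (∉f ∉g))) (λ x y ∉g → zeroWeight x y (offʳ (∉f ∉g))) ⟩
      Prod.doubleSum b (λ i j → arcTerm b w′ (g i) (g j))
        ≈⟨ Prod.doubleSum-cong b (λ i j → arcTerm b w′ (g i) (g j)) (λ i j → arcTerm a w i j [ s ]) term-g ⟩
      Prod.doubleSum b (λ i j → arcTerm a w i j [ s ])
        ≈⟨ monoidDoubleSum-homo (Rat.*-commutativeMonoid a) *-commutativeMonoid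
             _[ s ] Hom.1#-homo Hom.*-homo (arcTerm a w) ⟨
      weightedProduct a w [ s ] ∎
      where
      open Rat b hiding (zero)
      open SetoidReasoning setoid
      module Hom = IsRingHomProperties (Frac.commutativeRing a) (Frac.commutativeRing b) ([]-isRingHom s)

      toℕ≤a : ∀ (i : Fin (suc a)) → toℕ i ≤ a
      toℕ≤a i = s≤s⁻¹ (toℕ<n i)

      -- f on the vertices 0, …, a
      g : Fin (suc a) → Fin (suc b)
      g i = fromℕ< (s≤s (within (toℕ≤a i)))

      toℕ-g : ∀ i → toℕ (g i) ≡ f (toℕ i)
      toℕ-g i = toℕ-fromℕ< (s≤s (within (toℕ≤a i)))

      g-injective : ∀ {i j} → g i ≡ g j → i ≡ j
      g-injective {i} {j} e = toℕ-injective (injective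
        (≡.trans (≡.sym (toℕ-g i)) (≡.trans (≡.cong toℕ e) (toℕ-g j))))

      ∉f : ∀ {x} → (∀ i → g i ≢ x) → ∀ {v} → v ≤ a → f v ≢ toℕ x
      ∉f ∉g {v} v≤a fv≡x = ∉g (fromℕ< (s≤s v≤a)) (toℕ-injective
        (≡.trans (toℕ-g _) (≡.trans (≡.cong f (toℕ-fromℕ< (s≤s v≤a))) fv≡x)))

      zeroWeight : ∀ x y → w′ (toℕ x) (toℕ y) ≡ + 0 → arcTerm b w′ x y ≈ 1#
      zeroWeight x y e = trans (reflexive (≡.cong (intervalPower b (toℕ x) (toℕ y)) e))
        (intervalPower-0 b (toℕ x) (toℕ y))

      term-g : ∀ i j → arcTerm b w′ (g i) (g j) ≈ arcTerm a w i j [ s ]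
      term-g i j rewrite toℕ-g i | toℕ-g j | on (toℕ≤a i) (toℕ≤a j) =
        intervalPower-[] (toℕ≤a j) (w (toℕ i) (toℕ j))

-- Linear maps and bilinearity of operadic composition

module _ {r ℓr m₁ ℓ₁ m₂ ℓ₂} {R : CommutativeRing r ℓr} (M : Module R m₁ ℓ₁) (N : Module R m₂ ℓ₂) where
  private
    module M = Module M
    module N = Module N

  isLinear⇒isModuleHomomorphism : ∀ {f} → IsLinear M N f →
    ModuleMorphisms.ModuleMorphisms.IsModuleHomomorphism M.rawBimodule N.rawBimodule f
  isLinear⇒isModuleHomomorphism {f} lin = record
    { isBimoduleHomomorphism = record
      { +ᴹ-isGroupHomomorphism = record
        { isMonoidHomomorphism = record
          { isMagmaHomomorphism = record
            { isRelHomomorphism = record { cong = cong }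
            ; homo = +-homo
            }
          ; ε-homo = 0-homo
          }
        ; ⁻¹-homo = λ x → inverseˡ-unique _ _ (begin
            f (M.-ᴹ x) N.+ᴹ f x    ≈⟨ +-homo _ x ⟨
            f (M.-ᴹ x M.+ᴹ x)      ≈⟨ cong (M.-ᴹ‿inverseˡ x) ⟩
            f M.0ᴹ                 ≈⟨ 0-homo ⟩
            N.0ᴹ                   ∎)
        }
      ; *ₗ-homo = *-homo
      ; *ᵣ-homo = λ a x → begin
          f (x M.*ᵣ a)   ≈⟨ cong (M.*ₗ-*ᵣ-coincident a x) ⟨
          f (a M.*ₗ x)   ≈⟨ *-homo a x ⟩
          a N.*ₗ f x     ≈⟨ N.*ₗ-*ᵣ-coincident a (f x) ⟩
          f x N.*ᵣ a     ∎
      }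
    }
    where
    open IsLinear lin
    open SetoidReasoning N.≈ᴹ-setoid
    open GroupProperties (AbelianGroup.group N.+ᴹ-abelianGroup) using (inverseˡ-unique)

module OperadProperties {r ℓr m ℓm} {R : CommutativeRing r ℓr} (O : Operad R m ℓm) where
  open Operad O
  private module O n = Module (component n)

  comp-linearˡ : ∀ n m i y → IsLinear (component n) (component (n ℕ.+ m)) (λ x → comp n m x i y)
  comp-linearˡ n m i y = isLinear (λ e → comp-cong n m i e (O.≈ᴹ-refl m))
    (λ x x′ → comp-+ˡ n m x x′ i y) (λ a x → comp-*ˡ n m a x i y)

  comp-linearʳ : ∀ n m x i → IsLinear (component m) (component (n ℕ.+ m)) (comp n m x i)
  comp-linearʳ n m x i = isLinear (comp-cong n m i (O.≈ᴹ-refl n))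
    (comp-+ʳ n m x i) (λ a → comp-*ʳ n m a x i)

-- The rational function of a clique

module CliqueFractions {c ℓ₁ ℓ₂ a ℓ} (K : HeytingField c ℓ₁ ℓ₂) (M : UnitalMagma a ℓ)
                       (θ : UnitalMagma.Carrier M → ℤ) (rank : IsRankFunction M θ) where
  open HeytingFieldProperties K
  open WeightedProducts commutativeRing isDomain
  open RationalFunctions commutativeRing isDomain hiding (operad)
  open Cliques M hiding (operad)
  private
    module M = UnitalMagma M
    module θ = MonoidMorphisms.IsMonoidHomomorphism rank
    module Power n = PowerProperties (polynomialRing commutativeRing n) (poly-isDomain n)
    module Prod n = SumProperties (Rat.*-commutativeMonoid n)

  -- The exponents in the image of p; 0 on pairs that are not arcs of p
  weight : ∀ {n} → Clique n → ℕ → ℕ → ℤ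
  weight p x y = θ (⟦ p ⟧ x y)

  F-clique-product : ∀ {n} (p : Clique n) →
    Rat._≈_ (suc n) (F-clique K M θ p) (weightedProduct (suc n) (weight p))
  F-clique-product {n} p = Prod.doubleSum-cong (suc n) (pairFactor K M θ p)
    (arcTerm (suc n) (weight p)) factor
    where
    factor : ∀ x y → Rat._≈_ (suc n) (pairFactor K M θ p x y)
      (intervalPower (suc n) (toℕ x) (toℕ y) (weight p (toℕ x) (toℕ y)))
    factor x y with toℕ x <? toℕ y | toℕ y ≤? suc n
    ... | yes x<y | yes y≤n = Power.power-cong (suc n)
      (linearForm-≉0 K (arc (toℕ x) (toℕ y) x<y y≤n)) (intervalForm-≉0 (suc n) x<y y≤n)
      (Rat.refl (suc n)) (θ (label p (arc (toℕ x) (toℕ y) x<y y≤n)))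
    ... | yes _   | no  y≰n = ⊥-elim (y≰n (s≤s⁻¹ (toℕ<n y)))
    ... | no  _   | _       = Rat.refl (suc n)

  F-clique-cong : ∀ {n} {p q : Clique n} → p ≈ᶜ q →
                  Rat._≈_ (suc n) (F-clique K M θ p) (F-clique K M θ q)
  F-clique-cong {n} {p} {q} e = trans (F-clique-product p)
    (trans (weightedProduct-cong (suc n) λ x y → θ.⟦⟧-cong (⟦⟧-cong e x y)) (sym (F-clique-product q)))
    where open Rat (suc n) using (trans; sym)

  F-clique-𝐮 : Rat._≈_ 1 (F-clique K M θ 𝐮) (Rat.1# 1)
  F-clique-𝐮 = begin
    F-clique K M θ 𝐮                  ≈⟨ F-clique-product 𝐮 ⟩
    weightedProduct 1 (weight 𝐮)
      ≈⟨ weightedProduct-cong 1 (λ x y → ≡.trans (θ.⟦⟧-cong (⟦⟧-arity-one 𝐮 x y)) θ.ε-homo) ⟩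
    weightedProduct 1 (λ _ _ → + 0)   ≈⟨ weightedProduct-0 1 ⟩
    Rat.1# 1                          ∎
    where open SetoidReasoning (Rat.setoid 1)

  -- Labels pulled back along a partial inverse of f give the exponents of p
  -- pushed forward along f.
  pull-weight-[] : ∀ {n b} (s : Substitution (suc n) b) {f : ℕ → ℕ} → VertexEmbedding s f →
    (f⁻¹ : ℕ → Maybe ℕ) → (∀ {v x} → f⁻¹ v ≡ just x → v ≡ f x) →
    (∀ {x} → x ≤ suc n → f⁻¹ (f x) ≡ just x) → (p : Clique n) →
    Rat._≈_ b (weightedProduct b λ x y → θ (pull f⁻¹ ⟦ p ⟧ x y)) (weightedProduct (suc n) (weight p) [ s ])
  pull-weight-[] {n} s {f} emb f⁻¹ f⁻¹⇒ f⁻¹⇐ p = VertexEmbedding.weightedProduct-[] emb (weight p) _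
    (λ x≤ y≤ → ≡.cong₂ (λ t u → θ (at t u ⟦ p ⟧)) (f⁻¹⇐ x≤) (f⁻¹⇐ y≤))
    (λ {x} {y} ∉f → trivial x y λ a≤ _ fa≡ _ → ∉f a≤ fa≡)
    (λ {x} {y} ∉f → trivial x y λ _ b≤ _ fb≡ → ∉f b≤ fb≡)
    where
    -- A pair has the unit label unless both vertices come from an arc of p.
    trivial : ∀ x y → (∀ {a b} → a ≤ suc n → b ≤ suc n → f a ≡ x → ¬ f b ≡ y) →
              θ (pull f⁻¹ ⟦ p ⟧ x y) ≡ + 0
    trivial x y ∉f = ≡.trans (θ.⟦⟧-cong (at-𝟙 (f⁻¹ x) (f⁻¹ y) λ {a} {b} ea eb →
      M.reflexive (⟦⟧-out p λ (a<b , b≤) →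
        ∉f (ℕₚ.≤-trans (ℕₚ.<⇒≤ a<b) b≤) b≤ (≡.sym (f⁻¹⇒ ea)) (≡.sym (f⁻¹⇒ eb))))) θ.ε-homo

  module _ (n m : ℕ) (i : Fin (suc n)) where

    outer-embedding : VertexEmbedding (outer n m i) (outerVertex (toℕ i) m)
    outer-embedding = record
      { moving     = outer-moves n m i
      ; increasing = outerVertex-mono (toℕ i) m
      ; within     = outerVertex-bound (toℕ i) m
      }

    inner-embedding : VertexEmbedding (inner n m i) (toℕ i ℕ.+_)
    inner-embedding = record
      { moving     = inner-moves n m i
      ; increasing = ℕₚ.+-monoʳ-< (toℕ i)
      ; within     = inner-bound n m i
      }

    F-clique-glue : ∀ p q → Rat._≈_ (suc (n ℕ.+ m)) (F-clique K M θ (glue p i q))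
                    (compose n m i (F-clique K M θ p) (F-clique K M θ q))
    F-clique-glue p q = begin
      F-clique K M θ (glue p i q)
        ≈⟨ F-clique-product (glue p i q) ⟩
      weightedProduct N (weight (glue p i q))
        ≈⟨ weightedProduct-cong N (λ x y → ≡.trans (θ.⟦⟧-cong (glue-spec p i q x y)) (θ.homo _ _)) ⟩
      weightedProduct N (λ x y → P x y ℤ.+ Q x y)
        ≈⟨ weightedProduct-+ N P Q ⟩
      weightedProduct N P * weightedProduct N Q
        ≈⟨ *-cong
             (pull-weight-[] (outer n m i) outer-embedding (outer⁻¹ ι m)
               (λ {v} → outer⁻¹⇒ ι m v) (λ _ → outer⁻¹⇐ ι m _ ≡.refl) p)
             (pull-weight-[] (inner n m i) inner-embedding (inner⁻¹ ι m)
               (λ {v} e → inner⁻¹⇒ ι m v e .proj₁) (inner⁻¹⇐ ι m _ ≡.refl) q) ⟩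
      compose n m i (weightedProduct (suc n) (weight p)) (weightedProduct (suc m) (weight q))
        ≈⟨ *-cong (Out.cong (F-clique-product p)) (In.cong (F-clique-product q)) ⟨
      compose n m i (F-clique K M θ p) (F-clique K M θ q) ∎
      where
      N = suc (n ℕ.+ m)
      ι = toℕ i
      open Rat N
      open SetoidReasoning setoid
      module Out = IsRingHomProperties (Frac.commutativeRing (suc n)) (Frac.commutativeRing N)
                     ([]-isRingHom (outer n m i))
      module In  = IsRingHomProperties (Frac.commutativeRing (suc m)) (Frac.commutativeRing N)
                     ([]-isRingHom (inner n m i))
      P Q : ℕ → ℕ → ℤ
      P x y = θ (pull (outer⁻¹ ι m) ⟦ p ⟧ x y)
      Q x y = θ (pull (inner⁻¹ ι m) ⟦ q ⟧ x y)

  private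
    module C = Operad (C K M)
    module Rational = Operad (RatFct K)
    open FreeModule commutativeRing using (extend-isLinear; linear-unique)

  F-linear : ∀ n → IsLinear (C.component n) (Rational.component n) (F K M θ n)
  F-linear n = extend-isLinear (cliques n) (Rational.component n) F-clique-cong

  F-comp : ∀ n m x i y → Rational.[ n ℕ.+ m ]
    F K M θ (n ℕ.+ m) (C.comp n m x i y) ≈ Rational.comp n m (F K M θ n x) i (F K M θ m y)
  F-comp n m x i y =
    linear-unique (cliques n) codomain
      (∘-isLinear (C.component n) (C.component (n ℕ.+ m)) codomain
        (OperadProperties.comp-linearˡ (C K M) n m i y) (F-linear (n ℕ.+ m)))
      (∘-isLinear (C.component n) (Rational.component n) codomain
        (F-linear n) (OperadProperties.comp-linearˡ (RatFct K) n m i (F K M θ m y)))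
      (λ p → linear-unique (cliques m) codomain
        (∘-isLinear (C.component m) (C.component (n ℕ.+ m)) codomain
          (OperadProperties.comp-linearʳ (C K M) n m (gen p) i) (F-linear (n ℕ.+ m)))
        (∘-isLinear (C.component m) (Rational.component m) codomain
          (F-linear m) (OperadProperties.comp-linearʳ (RatFct K) n m (F-clique K M θ p) i))
        (F-clique-glue n m i p) y)
      x
    where
    codomain = Rational.component (n ℕ.+ m)
    open FreeModule commutativeRing using (gen)

theorem2p2p10 : ∀ {c ℓ₁ ℓ₂ a ℓ} (K : HeytingField c ℓ₁ ℓ₂) →
    CharacteristicZero (HeytingFieldProperties.commutativeRing K) →
    (M : UnitalMagma a ℓ) (θ : UnitalMagma.Carrier M → ℤ) →
    IsRankFunction M θ →
    IsOperadMorphism (C K M) (RatFct K) (F K M θ)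
theorem2p2p10 K _ M θ rank = record
  { linear    = λ n → isLinear⇒isModuleHomomorphism (Operad.component (C K M) n)
                  (Operad.component (RatFct K) n) (F-linear n)
  ; unit-homo = F-clique-𝐮
  ; comp-homo = F-comp
  }
  where open CliqueFractions K M θ rank
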